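{- There exist infinitely many real quadratic fields, as well as infinitely many imaginary quadratic fields, whose ideal class group has an element of order $3$ in its non-genus part (i.e. in the principal genus, the subgroup of squares of the class group). -}

module Defs where

open import Level using (0ℓ) renaming (suc to lsuc)
open import Algebra.Bundles using (AbelianGroup; CommutativeRing; RawRing)
open import Algebra.Core using (Op₁; Op₂)
open import Algebra.Definitions using (Invertible)
open import Algebra.Structures using (IsCommutativeRing)
open import Algebra.Morphism.Structures using (IsRingIsomorphism)
import Algebra.Definitions.RawMonoid as RawMonoidPower
import Algebra.Properties.CommutativeSemigroup as CommutativeSemigroupProperties
open import Data.Integer.Base as ℤ using (ℤ; +_; -[1+_]; 0ℤ; 1ℤ)
import Data.Integer.Properties as ℤ
open import Data.List.Base using (List; []; _∷_; length)
open import Data.List.Relation.Unary.All using (All)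
open import Data.Nat.Base as ℕ using (ℕ; zero; suc; z≤n; s≤s)
import Data.Nat.Properties as ℕ
open import Data.Nat.Coprimality as Coprimality using (Coprime)
open import Data.Nat.Divisibility using (_∣_; divides; ∣⇒≤; ∣-trans; m∣m*n)
open import Data.Product using (Σ; ∃; Σ-syntax; ∃-syntax; _×_; _,_; proj₁; proj₂; swap)
open import Data.Rational.Base as ℚ using (ℚ; mkℚ; 0ℚ; 1ℚ)
  renaming (_+_ to _⊕_; _*_ to _⊛_; -_ to ⊖_)
import Data.Rational.Properties as ℚ
open import Data.Rational.Literals using (fromℤ)
open import Data.Rational.Solver using (module +-*-Solver)
open import Data.Rational.Unnormalised.Base as ℚᵘ using (*≡*)
import Data.Rational.Unnormalised.Properties as ℚᵘ
open import Function.Base using (_∘_)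
open import Data.Sum.Base using (inj₁; inj₂)
open import Relation.Binary.PropositionalEquality
open import Relation.Nullary using (¬_; yes; no; contradiction)
open import Relation.Unary using (Pred; _∈_; _⊆_; _≐_)

------------------------------------------------------------------------
-- Groups

module _ {c ℓ} (G : AbelianGroup c ℓ) where

  open AbelianGroup G
  open RawMonoidPower rawMonoid renaming (_×_ to infixr 8 _times_)

  -- n times x is x ∙ … ∙ x (n factors), i.e. the power xⁿ.

  HasOrder : Carrier → ℕ → Set ℓ
  HasOrder x n = 0 ℕ.< n × (n times x) ≈ ε
               × (∀ m → 0 ℕ.< m → m ℕ.< n → ¬ ((m times x) ≈ ε))

  IsSquare : Carrier → Set _
  IsSquare x = ∃[ y ] x ≈ y ∙ y

------------------------------------------------------------------------
-- Invertible fractional ideals and the ideal class group, for a subring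
-- O of a commutative ring A.  Below, A is a quadratic field and O its
-- ring of integers; the units of A are then the nonzero elements, by
-- nonzero⇒unit.

module Ideals
  {A : Set} {_+_ _*_ : Op₂ A} { -_ : Op₁ A} {0# 1# : A}
  (isCommutativeRing : IsCommutativeRing _≡_ _+_ _*_ -_ 0# 1#)
  (O : Pred A 0ℓ)
  (0∈O : 0# ∈ O) (1∈O : 1# ∈ O)
  (O-+ : ∀ {x y} → x ∈ O → y ∈ O → (x + y) ∈ O)
  (O-* : ∀ {x y} → x ∈ O → y ∈ O → (x * y) ∈ O)
  where

  private
    ring : CommutativeRing 0ℓ 0ℓ
    ring = record { isCommutativeRing = isCommutativeRing }

  open CommutativeRing ring
    using (+-assoc; +-identityˡ; +-identityʳ; *-assoc; *-comm; *-identityˡ; *-identityʳ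
          ; distribˡ; distribʳ; zeroˡ; zeroʳ; *-commutativeSemigroup)
  open CommutativeSemigroupProperties *-commutativeSemigroup
    using (interchange; x∙yz≈y∙xz)

  Unit : Pred A 0ℓ
  Unit = Invertible _≡_ 1# _*_

  record FractionalIdeal : Set₁ where
    field
      Carrier     : Pred A 0ℓ
      0∈          : 0# ∈ Carrier
      +-closed    : ∀ {x y} → x ∈ Carrier → y ∈ Carrier → (x + y) ∈ Carrier
      *-closed    : ∀ {r x} → r ∈ O → x ∈ Carrier → (r * x) ∈ Carrier
      denominator : ∃[ c ] c ∈ O × Unit c × (∀ {x} → x ∈ Carrier → (c * x) ∈ O)

  open FractionalIdeal

  -- The finite sums Σ aᵢ bᵢ with aᵢ ∈ I and bᵢ ∈ J.

  data Products (I J : Pred A 0ℓ) : Pred A 0ℓ where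
    none : 0# ∈ Products I J
    more : ∀ {a b z} → a ∈ I → b ∈ J → z ∈ Products I J → ((a * b) + z) ∈ Products I J

  Products-+ : ∀ {I J x y} → x ∈ Products I J → y ∈ Products I J → (x + y) ∈ Products I J
  Products-+ {I} {J} {y = y} none q = subst (Products I J) (sym (+-identityˡ y)) q
  Products-+ {I} {J} {y = y} (more {a} {b} {z} i j p) q =
    subst (Products I J) (sym (+-assoc (a * b) z y)) (more i j (Products-+ p q))

  product : ∀ {I J : Pred A 0ℓ} {a b} → a ∈ I → b ∈ J → (a * b) ∈ Products I J
  product {I} {J} i j = subst (Products I J) (+-identityʳ _) (more i j none)

  least : ∀ {I J} (P : Pred A 0ℓ) → 0# ∈ P →
          (∀ {x y} → x ∈ P → y ∈ P → (x + y) ∈ P) →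
          (∀ {a b} → a ∈ I → b ∈ J → (a * b) ∈ P) → Products I J ⊆ P
  least P z p m none         = z
  least P z p m (more i j q) = p (m i j) (least P z p m q)

  leastUnder : ∀ {I J I′ J′} x →
               (∀ {a b} → a ∈ I → b ∈ J → (x * (a * b)) ∈ Products I′ J′) →
               ∀ {w} → w ∈ Products I J → (x * w) ∈ Products I′ J′
  leastUnder {I′ = I′} {J′} x m = least (λ w → (x * w) ∈ Products I′ J′)
    (subst (Products I′ J′) (sym (zeroʳ x)) none)
    (λ p q → subst (Products I′ J′) (sym (distribˡ x _ _)) (Products-+ p q))
    m

  Unit-* : ∀ {x y} → Unit x → Unit y → Unit (x * y)
  Unit-* {x} {y} (x′ , l , r) (y′ , l′ , r′) =
    x′ * y′ ,
    trans (interchange x′ y′ x y) (trans (cong₂ _*_ l l′) (*-identityˡ 1#)) ,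
    trans (interchange x y x′ y′) (trans (cong₂ _*_ r r′) (*-identityˡ 1#))

  Unit-1 : Unit 1#
  Unit-1 = 1# , *-identityˡ 1# , *-identityˡ 1#

  comm⊆ : ∀ {I J} → Products I J ⊆ Products J I
  comm⊆ {I} {J} = least (Products J I) none Products-+
    λ i j → subst (Products J I) (*-comm _ _) (product j i)

  assoc⊆ : ∀ {I J L} → Products (Products I J) L ⊆ Products I (Products J L)
  assoc⊆ {I} {J} {L} = least T none Products-+ λ {p} {c} p∈ c∈ →
    subst T (*-comm c p) (leastUnder c
      (λ {a} {b} a∈ b∈ → subst T
        (trans (sym (*-assoc a b c)) (*-comm (a * b) c))
        (product a∈ (product b∈ c∈)))
      p∈)
    where T = Products I (Products J L)

  mono : ∀ {I J I′ J′} → I ⊆ I′ → J ⊆ J′ → Products I J ⊆ Products I′ J′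
  mono {I′ = I′} {J′} f g = least (Products I′ J′) none Products-+ λ i j → product (f i) (g j)

  -- I (J L) ⊆ I (L J) ⊆ (L J) I ⊆ L (J I) ⊆ (J I) L ⊆ (I J) L

  assoc⊇ : ∀ {I J L} → Products I (Products J L) ⊆ Products (Products I J) L
  assoc⊇ {I} {J} {L} =
    mono (λ {x} → comm⊆ {J} {I} {x}) (λ p → p) ∘ comm⊆ ∘ assoc⊆ ∘ comm⊆ ∘ mono (λ p → p) comm⊆

  infixl 7 _·_

  _·_ : FractionalIdeal → FractionalIdeal → FractionalIdeal
  I · J = record
    { Carrier     = Products (Carrier I) (Carrier J)
    ; 0∈          = none
    ; +-closed    = Products-+
    ; *-closed    = λ {r} r∈ → leastUnder r λ {a} {b} a∈ b∈ →
        subst (Products (Carrier I) (Carrier J)) (*-assoc r a b) (product (*-closed I r∈ a∈) b∈)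
    ; denominator =
        let (c , c∈ , cᵘ , cI) = denominator I
            (e , e∈ , eᵘ , eJ) = denominator J
        in c * e , O-* c∈ e∈ , Unit-* cᵘ eᵘ ,
           least (λ z → ((c * e) * z) ∈ O)
             (subst O (sym (zeroʳ (c * e))) 0∈O)
             (λ p q → subst O (sym (distribˡ (c * e) _ _)) (O-+ p q))
             (λ {a} {b} a∈ b∈ → subst O (interchange c a e b) (O-* (cI a∈) (eJ b∈)))
    }

  𝟙 : FractionalIdeal
  𝟙 = record
    { Carrier     = O
    ; 0∈          = 0∈O
    ; +-closed    = O-+
    ; *-closed    = O-*
    ; denominator = 1# , 1∈O , Unit-1 , O-* 1∈O
    }

  -- The ideal x I.

  Scaled : A → Pred A 0ℓ → Pred A 0ℓ
  Scaled x I z = ∃[ w ] w ∈ I × z ≡ x * w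

  infix 4 _∼_

  _∼_ : FractionalIdeal → FractionalIdeal → Set
  I ∼ J = ∃[ x ] Unit x × Carrier I ≐ Scaled x (Carrier J)

  ≐⇒∼ : ∀ {I J} → Carrier I ≐ Carrier J → I ∼ J
  ≐⇒∼ {I} (f , g) = 1# , Unit-1 ,
    (λ {z} i → z , f i , sym (*-identityˡ z)) ,
    (λ { (w , j , eq) → subst (Carrier I) (sym (trans eq (*-identityˡ w))) (g j) })

  ∼-refl : ∀ {I} → I ∼ I
  ∼-refl {I} = ≐⇒∼ {I} {I} ((λ i → i) , (λ i → i))

  ∼-sym : ∀ {I J} → I ∼ J → J ∼ I
  ∼-sym {I} {J} (x , (y , yx , xy) , f , g) = y , (x , xy , yx) ,
    (λ {z} j → x * z , g (z , j , refl) , sym (cancel y x yx z)) ,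
    (λ { (w , i , eq) → let (v , j , eq′) = f i in
         subst (Carrier J) (sym (trans eq (trans (cong (y *_) eq′) (cancel y x yx v)))) j })
    where
    cancel : ∀ a b → a * b ≡ 1# → ∀ z → a * (b * z) ≡ z
    cancel a b eq z = trans (sym (*-assoc a b z)) (trans (cong (_* z) eq) (*-identityˡ z))

  ∼-trans : ∀ {I J L} → I ∼ J → J ∼ L → I ∼ L
  ∼-trans (x , xᵘ , f , g) (y , yᵘ , h , k) = x * y , Unit-* xᵘ yᵘ ,
    (λ i → let (w , j , eq) = f i ; (v , l , eq′) = h j in
      v , l , trans eq (trans (cong (x *_) eq′) (sym (*-assoc x y v)))) ,
    (λ { (v , l , eq) → g (y * v , k (v , l , refl) , trans eq (*-assoc x y v)) })

  ·-cong : ∀ {I I′ J J′} → I ∼ I′ → J ∼ J′ → I · J ∼ I′ · J′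
  ·-cong {I} {I′} {J} {J′} (x , xᵘ , f , g) (y , yᵘ , h , k) = x * y , Unit-* xᵘ yᵘ ,
    least (Scaled (x * y) P′) (0# , none , sym (zeroʳ _))
      (λ { (w , p , eq) (w′ , p′ , eq′) →
           w + w′ , Products-+ p p′ , trans (cong₂ _+_ eq eq′) (sym (distribˡ (x * y) w w′)) })
      (λ i j → let (a , a∈ , eq) = f i ; (b , b∈ , eq′) = h j in
           a * b , product a∈ b∈ , trans (cong₂ _*_ eq eq′) (interchange x a y b)) ,
    (λ { (w , p , eq) → subst P (sym eq)
           (leastUnder (x * y)
             (λ {a} {b} a∈ b∈ → subst P (interchange x a y b)
               (product (g (a , a∈ , refl)) (k (b , b∈ , refl))))
             p) })
    where
    P  = Products (Carrier I) (Carrier J)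
    P′ = Products (Carrier I′) (Carrier J′)

  ·-identityˡ : ∀ I → 𝟙 · I ∼ I
  ·-identityˡ I = ≐⇒∼ {𝟙 · I} {I}
    ( least (Carrier I) (0∈ I) (+-closed I) (*-closed I)
    , λ {z} i → subst (Products O (Carrier I)) (*-identityˡ z) (product 1∈O i))

  ·-comm : ∀ I J → I · J ∼ J · I
  ·-comm I J = ≐⇒∼ {I · J} {J · I} (comm⊆ , comm⊆)

  ·-identityʳ : ∀ I → I · 𝟙 ∼ I
  ·-identityʳ I = ∼-trans {I · 𝟙} {𝟙 · I} {I} (·-comm I 𝟙) (·-identityˡ I)

  ·-assoc : ∀ I J L → (I · J) · L ∼ I · (J · L)
  ·-assoc I J L = ≐⇒∼ {(I · J) · L} {I · (J · L)} (assoc⊆ , assoc⊇)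

  record InvertibleIdeal : Set₁ where
    field
      ideal    : FractionalIdeal
      inverse  : FractionalIdeal
      inverses : Carrier (ideal · inverse) ≐ O

  open InvertibleIdeal

  inverseˡ : ∀ I → inverse I · ideal I ∼ 𝟙
  inverseˡ I = ≐⇒∼ {inverse I · ideal I} {𝟙}
    (proj₁ (inverses I) ∘ comm⊆ , comm⊆ ∘ proj₂ (inverses I))

  _∙_ : InvertibleIdeal → InvertibleIdeal → InvertibleIdeal
  I ∙ J = record
    { ideal    = ideal I · ideal J
    ; inverse  = inverse J · inverse I
    ; inverses = f ∘ h , k ∘ g
    }
    where
    X  = Carrier (ideal I)
    Y  = Carrier (ideal J)
    X′ = Carrier (inverse I)
    Y′ = Carrier (inverse J)

    h : Products (Products X Y) (Products Y′ X′) ⊆ Products X (Products (Products Y Y′) X′)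
    h = mono (λ p → p) assoc⊇ ∘ assoc⊆

    k : Products X (Products (Products Y Y′) X′) ⊆ Products (Products X Y) (Products Y′ X′)
    k = assoc⊇ ∘ mono (λ p → p) assoc⊆

    f : Products X (Products (Products Y Y′) X′) ⊆ O
    f = proj₁ (inverses I) ∘ mono (λ p → p)
          (least X′ (0∈ (inverse I)) (+-closed (inverse I))
            (λ r x → *-closed (inverse I) (proj₁ (inverses J) r) x))

    g : O ⊆ Products X (Products (Products Y Y′) X′)
    g = mono (λ p → p)
          (λ {z} x → subst (Products (Products Y Y′) X′) (*-identityˡ z)
            (product (proj₂ (inverses J) 1∈O) x))
        ∘ proj₂ (inverses I)

  ε : InvertibleIdeal
  ε = record
    { ideal    = 𝟙
    ; inverse  = 𝟙
    ; inverses = least O 0∈O O-+ O-*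
               , λ {z} z∈ → subst (Products O O) (*-identityˡ z) (product 1∈O z∈)
    }

  _⁻¹ : InvertibleIdeal → InvertibleIdeal
  I ⁻¹ = record
    { ideal    = inverse I
    ; inverse  = ideal I
    ; inverses = proj₁ (inverses I) ∘ comm⊆ , comm⊆ ∘ proj₂ (inverses I)
    }

  -- I⁻¹ = I⁻¹ (J J⁻¹) = (I⁻¹ J) J⁻¹ = (I⁻¹ I) J⁻¹ = J⁻¹

  ⁻¹-cong : ∀ I J → ideal I ∼ ideal J → inverse I ∼ inverse J
  ⁻¹-cong I J i∼j =
    ∼-trans {I′} {I′ · 𝟙} {J′}
      (∼-sym {I′ · 𝟙} {I′} (·-identityʳ I′))
    (∼-trans {I′ · 𝟙} {I′ · (J₁ · J′)} {J′}
      (·-cong {I′} {I′} {𝟙} {J₁ · J′} (∼-refl {I′})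
        (∼-sym {J₁ · J′} {𝟙} (≐⇒∼ {J₁ · J′} {𝟙} (inverses J))))
    (∼-trans {I′ · (J₁ · J′)} {(I′ · J₁) · J′} {J′}
      (∼-sym {(I′ · J₁) · J′} {I′ · (J₁ · J′)} (·-assoc I′ J₁ J′))
    (∼-trans {(I′ · J₁) · J′} {𝟙 · J′} {J′}
      (·-cong {I′ · J₁} {𝟙} {J′} {J′}
        (∼-trans {I′ · J₁} {I′ · I₁} {𝟙}
          (·-cong {I′} {I′} {J₁} {I₁} (∼-refl {I′}) (∼-sym {I₁} {J₁} i∼j))
          (inverseˡ I))
        (∼-refl {J′}))
      (·-identityˡ J′))))
    where
    I₁ = ideal I
    J₁ = ideal J
    I′ = inverse I
    J′ = inverse J

  -- The invertible fractional ideals modulo the principal ones: elements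
  -- are ideals, and equality of classes is I ∼ J, i.e. I = x J for some
  -- invertible x.

  classGroup : AbelianGroup (lsuc 0ℓ) 0ℓ
  classGroup = record
    { Carrier        = InvertibleIdeal
    ; _≈_            = λ I J → ideal I ∼ ideal J
    ; _∙_            = _∙_
    ; ε              = ε
    ; _⁻¹            = _⁻¹
    ; isAbelianGroup = record
      { isGroup = record
        { isMonoid = record
          { isSemigroup = record
            { isMagma = record
              { isEquivalence = record
                { refl  = λ {I} → ∼-refl {ideal I}
                ; sym   = λ {I} {J} → ∼-sym {ideal I} {ideal J}
                ; trans = λ {I} {J} {L} → ∼-trans {ideal I} {ideal J} {ideal L}
                }
              ; ∙-cong = λ {I} {I′} {J} {J′} → ·-cong {ideal I} {ideal I′} {ideal J} {ideal J′}
              }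
            ; assoc = λ I J L → ·-assoc (ideal I) (ideal J) (ideal L)
            }
          ; identity = (λ I → ·-identityˡ (ideal I))
                     , (λ I → ·-identityʳ (ideal I))
          }
        ; inverse = (λ I → inverseˡ I)
                  , (λ I → ≐⇒∼ {ideal I · inverse I} {𝟙} (inverses I))
        ; ⁻¹-cong = λ {I} {J} → ⁻¹-cong I J
        }
      ; comm = λ I J → ·-comm (ideal I) (ideal J)
      }
    }

------------------------------------------------------------------------
-- The field ℚ(√d)

-- ⟨ a , b ⟩ is a + b √d.

record ℚ[√_] (d : ℤ) : Set where
  constructor ⟨_,_⟩
  field
    rational irrational : ℚ

module Quadratic (d : ℤ) where

  private
    K = ℚ[√ d ]
    δ = fromℤ d

  open ℚ[√_]
  open +-*-Solver using (solve; _:+_; _:*_; :-_; con; _:=_)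

  infixl 6 _+_
  infixl 7 _*_
  infix  8 -_

  _+_ : Op₂ K
  ⟨ a , b ⟩ + ⟨ a′ , b′ ⟩ = ⟨ a ⊕ a′ , b ⊕ b′ ⟩

  _*_ : Op₂ K
  ⟨ a , b ⟩ * ⟨ a′ , b′ ⟩ = ⟨ a ⊛ a′ ⊕ δ ⊛ (b ⊛ b′) , a ⊛ b′ ⊕ b ⊛ a′ ⟩

  -_ : Op₁ K
  - ⟨ a , b ⟩ = ⟨ ⊖ a , ⊖ b ⟩

  ι : ℤ → K
  ι z = ⟨ fromℤ z , 0ℚ ⟩

  0# 1# : K
  0# = ι 0ℤ
  1# = ι 1ℤ

  isCommutativeRing : IsCommutativeRing _≡_ _+_ _*_ -_ 0# 1#
  isCommutativeRing = record
    { isRing = record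
      { +-isAbelianGroup = record
        { isGroup = record
          { isMonoid = record
            { isSemigroup = record
              { isMagma = record { isEquivalence = isEquivalence ; ∙-cong = cong₂ _+_ }
              ; assoc   = λ { ⟨ a , b ⟩ ⟨ a′ , b′ ⟩ ⟨ a″ , b″ ⟩ →
                              cong₂ ⟨_,_⟩ (ℚ.+-assoc a a′ a″) (ℚ.+-assoc b b′ b″) }
              }
            ; identity = (λ { ⟨ a , b ⟩ → cong₂ ⟨_,_⟩ (ℚ.+-identityˡ a) (ℚ.+-identityˡ b) })
                       , (λ { ⟨ a , b ⟩ → cong₂ ⟨_,_⟩ (ℚ.+-identityʳ a) (ℚ.+-identityʳ b) })
            }
          ; inverse = (λ { ⟨ a , b ⟩ → cong₂ ⟨_,_⟩ (ℚ.+-inverseˡ a) (ℚ.+-inverseˡ b) })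
                    , (λ { ⟨ a , b ⟩ → cong₂ ⟨_,_⟩ (ℚ.+-inverseʳ a) (ℚ.+-inverseʳ b) })
          ; ⁻¹-cong = cong -_
          }
        ; comm = λ { ⟨ a , b ⟩ ⟨ a′ , b′ ⟩ → cong₂ ⟨_,_⟩ (ℚ.+-comm a a′) (ℚ.+-comm b b′) }
        }
      ; *-cong     = cong₂ _*_
      ; *-assoc    = *-assoc
      ; *-identity = *-identityˡ , (λ x → trans (*-comm x 1#) (*-identityˡ x))
      ; distrib    = distribˡ
                   , (λ x y z → trans (*-comm (y + z) x)
                       (trans (distribˡ x y z) (cong₂ _+_ (*-comm x y) (*-comm x z))))
      }
    ; *-comm = *-comm
    }
    where
    *-comm : ∀ x y → x * y ≡ y * x
    *-comm ⟨ a , b ⟩ ⟨ a′ , b′ ⟩ = cong₂ ⟨_,_⟩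
      (solve 5 (λ e a b a′ b′ → a :* a′ :+ e :* (b :* b′) := a′ :* a :+ e :* (b′ :* b))
        refl δ a b a′ b′)
      (solve 4 (λ a b a′ b′ → a :* b′ :+ b :* a′ := a′ :* b :+ b′ :* a) refl a b a′ b′)

    *-assoc : ∀ x y z → (x * y) * z ≡ x * (y * z)
    *-assoc ⟨ a , b ⟩ ⟨ a′ , b′ ⟩ ⟨ a″ , b″ ⟩ = cong₂ ⟨_,_⟩
      (solve 7 (λ e a b a′ b′ a″ b″ →
          (a :* a′ :+ e :* (b :* b′)) :* a″ :+ e :* ((a :* b′ :+ b :* a′) :* b″)
          := a :* (a′ :* a″ :+ e :* (b′ :* b″)) :+ e :* (b :* (a′ :* b″ :+ b′ :* a″)))
        refl δ a b a′ b′ a″ b″)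
      (solve 7 (λ e a b a′ b′ a″ b″ →
          (a :* a′ :+ e :* (b :* b′)) :* b″ :+ (a :* b′ :+ b :* a′) :* a″
          := a :* (a′ :* b″ :+ b′ :* a″) :+ b :* (a′ :* a″ :+ e :* (b′ :* b″)))
        refl δ a b a′ b′ a″ b″)

    *-identityˡ : ∀ x → 1# * x ≡ x
    *-identityˡ ⟨ a , b ⟩ = cong₂ ⟨_,_⟩
      (solve 3 (λ e a b → con 1ℚ :* a :+ e :* (con 0ℚ :* b) := a) refl δ a b)
      (solve 2 (λ a b → con 1ℚ :* b :+ con 0ℚ :* a := b) refl a b)

    distribˡ : ∀ x y z → x * (y + z) ≡ x * y + x * z
    distribˡ ⟨ a , b ⟩ ⟨ a′ , b′ ⟩ ⟨ a″ , b″ ⟩ = cong₂ ⟨_,_⟩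
      (solve 7 (λ e a b a′ b′ a″ b″ →
          a :* (a′ :+ a″) :+ e :* (b :* (b′ :+ b″))
          := (a :* a′ :+ e :* (b :* b′)) :+ (a :* a″ :+ e :* (b :* b″)))
        refl δ a b a′ b′ a″ b″)
      (solve 6 (λ a b a′ b′ a″ b″ →
          a :* (b′ :+ b″) :+ b :* (a′ :+ a″)
          := (a :* b′ :+ b :* a′) :+ (a :* b″ :+ b :* a″))
        refl a b a′ b′ a″ b″)

  commutativeRing : CommutativeRing 0ℓ 0ℓ
  commutativeRing = record { isCommutativeRing = isCommutativeRing }

  open CommutativeRing commutativeRing
    using ( *-monoid; *-commutativeSemigroup; +-identityˡ; *-assoc; *-comm; *-identityʳ
          ; distribˡ; zeroʳ)
  open CommutativeSemigroupProperties *-commutativeSemigroup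
    using (interchange; x∙yz≈y∙xz; x∙yz≈yx∙z)

  -- monic (c₀ ∷ … ∷ cₙ₋₁ ∷ []) x is c₀ + c₁ x + … + cₙ₋₁ xⁿ⁻¹ + xⁿ.

  monic : List ℤ → K → K
  monic []       x = 1#
  monic (c ∷ cs) x = ι c + x * monic cs x

  IsIntegral : Pred K 0ℓ
  IsIntegral x = ∃[ cs ] monic cs x ≡ 0#

  ----------------------------------------------------------------------
  -- The integral elements form a subring: x is integral if and only if
  -- the powers of x have a common denominator.

  IsInteger : Pred ℚ 0ℓ
  IsInteger q = ∃[ z ] q ≡ fromℤ z

  fromℤ-+ : ∀ y z → fromℤ y ⊕ fromℤ z ≡ fromℤ (y ℤ.+ z)
  fromℤ-+ y z = ℚ.toℚᵘ-injective (ℚᵘ.≃-trans (ℚ.toℚᵘ-homo-+ (fromℤ y) (fromℤ z))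
    (*≡* (cong (ℤ._* 1ℤ) (cong₂ ℤ._+_ (ℤ.*-identityʳ y) (ℤ.*-identityʳ z)))))

  fromℤ-* : ∀ y z → fromℤ y ⊛ fromℤ z ≡ fromℤ (y ℤ.* z)
  fromℤ-* y z = ℚ.toℚᵘ-injective (ℚ.toℚᵘ-homo-* (fromℤ y) (fromℤ z))

  fromℤ-- : ∀ z → ⊖ fromℤ z ≡ fromℤ (ℤ.- z)
  fromℤ-- (+ zero)  = refl
  fromℤ-- (+ suc n) = refl
  fromℤ-- -[1+ n ]  = refl

  integer-+ : ∀ {p q} → IsInteger p → IsInteger q → IsInteger (p ⊕ q)
  integer-+ (y , refl) (z , refl) = y ℤ.+ z , fromℤ-+ y z

  integer-* : ∀ {p q} → IsInteger p → IsInteger q → IsInteger (p ⊛ q)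
  integer-* (y , refl) (z , refl) = y ℤ.* z , fromℤ-* y z

  integer-- : ∀ {p} → IsInteger p → IsInteger (⊖ p)
  integer-- (z , refl) = ℤ.- z , fromℤ-- z

  -- The order ℤ[√d].

  Z√ : Pred K 0ℓ
  Z√ ⟨ a , b ⟩ = IsInteger a × IsInteger b

  Z√-+ : ∀ {x y} → x ∈ Z√ → y ∈ Z√ → (x + y) ∈ Z√
  Z√-+ (a , b) (a′ , b′) = integer-+ a a′ , integer-+ b b′

  Z√-* : ∀ {x y} → x ∈ Z√ → y ∈ Z√ → (x * y) ∈ Z√
  Z√-* (a , b) (a′ , b′) =
    integer-+ (integer-* a a′) (integer-* (d , refl) (integer-* b b′)) ,
    integer-+ (integer-* a b′) (integer-* b a′)

  Z√-- : ∀ {x} → x ∈ Z√ → (- x) ∈ Z√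
  Z√-- (a , b) = integer-- a , integer-- b

  Z√-ι : ∀ z → ι z ∈ Z√
  Z√-ι z = (z , refl) , (0ℤ , refl)

  Z√-cancel : ∀ {x y} → x ∈ Z√ → (x + y) ∈ Z√ → y ∈ Z√
  Z√-cancel {x} {y} p q = subst Z√ eq (Z√-+ (Z√-- p) q)
    where
    open CommutativeRing commutativeRing using (+-assoc; -‿inverseˡ)
    eq : - x + (x + y) ≡ y
    eq = trans (sym (+-assoc (- x) x y)) (trans (cong (_+ y) (-‿inverseˡ x)) (+-identityˡ y))

  infixr 9 _^_

  _^_ : K → ℕ → K
  x ^ zero  = 1#
  x ^ suc n = x * x ^ n

  PowersBoundedBy : K → ℕ → Set
  PowersBoundedBy x N = ∀ k → (ι (+ N) * x ^ k) ∈ Z√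

  HasBoundedPowers : Pred K 0ℓ
  HasBoundedPowers x = ∃[ n ] PowersBoundedBy x (suc n)

  ι-* : ∀ y z → ι (y ℤ.* z) ≡ ι y * ι z
  ι-* y z = cong₂ ⟨_,_⟩
    (trans (sym (fromℤ-* y z))
      (solve 3 (λ e a a′ → a :* a′ := a :* a′ :+ e :* (con 0ℚ :* con 0ℚ)) refl δ (fromℤ y) (fromℤ z)))
    (solve 2 (λ a a′ → con 0ℚ := a :* con 0ℚ :+ con 0ℚ :* a′) refl (fromℤ y) (fromℤ z))

  ι-ℕ* : ∀ m n → ι (+ (m ℕ.* n)) ≡ ι (+ m) * ι (+ n)
  ι-ℕ* m n = trans (cong ι (ℤ.pos-* m n)) (ι-* (+ m) (+ n))

  fromℤ-clear : ∀ q → fromℤ (ℚ.↧ q) ⊛ q ≡ fromℤ (ℚ.↥ q)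
  fromℤ-clear q@(mkℚ n e-1 _) = ℚ.toℚᵘ-injective (ℚᵘ.≃-trans (ℚ.toℚᵘ-homo-* (fromℤ (ℚ.↧ q)) q)
    (*≡* (trans (ℤ.*-identityʳ (ℚ.↧ q ℤ.* n)) (trans (ℤ.*-comm (ℚ.↧ q) n)
      (cong (n ℤ.*_) (cong (+_ ∘ suc) (sym (ℕ.+-identityʳ e-1))))))))

  clear : ∀ x → ∃[ n ] (ι (+ suc n) * x) ∈ Z√
  clear ⟨ p@(mkℚ _ i _) , q@(mkℚ _ j _) ⟩ = j ℕ.+ i ℕ.* suc j ,
    subst IsInteger (sym (trans
        (cong (λ u → u ⊛ p ⊕ δ ⊛ (0ℚ ⊛ q)) N≡)
        (solve 5 (λ u v p q e → (u :* v) :* p :+ e :* (con 0ℚ :* q) := v :* (u :* p)) refl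
          P Q p q δ)))
      (integer-* (_ , refl) (_ , fromℤ-clear p)) ,
    subst IsInteger (sym (trans
        (cong (λ u → u ⊛ q ⊕ 0ℚ ⊛ p) N≡)
        (solve 4 (λ u v p q → (u :* v) :* q :+ con 0ℚ :* p := u :* (v :* q)) refl P Q p q)))
      (integer-* (_ , refl) (_ , fromℤ-clear q))
    where
    P = fromℤ (ℚ.↧ p)
    Q = fromℤ (ℚ.↧ q)
    N≡ : fromℤ (+ suc (j ℕ.+ i ℕ.* suc j)) ≡ P ⊛ Q
    N≡ = trans (cong fromℤ (ℤ.pos-* (suc i) (suc j))) (sym (fromℤ-* (ℚ.↧ p) (ℚ.↧ q)))

  clearPowers : ∀ x n → ∃[ N ] (∀ k → k ℕ.≤ n → (ι (+ suc N) * x ^ k) ∈ Z√)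
  clearPowers x zero = 0 , λ { zero _ → Z√-* (Z√-ι (+ 1)) (Z√-ι (+ 1)) }
  clearPowers x (suc n) = _ , bound
    where
    N = proj₁ (clearPowers x n)
    c = proj₁ (clear x)
    bound : ∀ k → k ℕ.≤ suc n → (ι (+ (suc c ℕ.* suc N)) * x ^ k) ∈ Z√
    bound zero    _         = Z√-* (Z√-ι (+ (suc c ℕ.* suc N))) (Z√-ι (+ 1))
    bound (suc k) (s≤s k≤n) = subst Z√
      (trans (interchange (ι (+ suc c)) x (ι (+ suc N)) (x ^ k))
        (cong (_* (x ^ suc k)) (sym (ι-ℕ* (suc c) (suc N)))))
      (Z√-* (proj₂ (clear x)) (proj₂ (clearPowers x n) k k≤n))

  horner : ∀ x cs y → (∀ i → i ℕ.< length cs → (y * x ^ i) ∈ Z√) →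
           (y * monic cs x) ∈ Z√ → (y * x ^ length cs) ∈ Z√
  horner x []       y h p = p
  horner x (c ∷ cs) y h p = subst Z√ (*-assoc y x _)
    (horner x cs (y * x)
      (λ i i< → subst Z√ (sym (*-assoc y x _)) (h (suc i) (s≤s i<)))
      (subst Z√ (sym (*-assoc y x _))
        (Z√-cancel
          (Z√-* (subst Z√ (*-identityʳ y) (h 0 (s≤s z≤n))) (Z√-ι c))
          (subst Z√ (distribˡ y (ι c) (x * monic cs x)) p))))

  ^-+ : ∀ x m n → x ^ (m ℕ.+ n) ≡ x ^ m * x ^ n
  ^-+ x zero    n = sym (trans (*-comm 1# (x ^ n)) (*-identityʳ (x ^ n)))
  ^-+ x (suc m) n = trans (cong (x *_) (^-+ x m n)) (sym (*-assoc x (x ^ m) (x ^ n)))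

  integral⇒bounded : ∀ {x} → IsIntegral x → HasBoundedPowers x
  integral⇒bounded {x} (cs , root) = N , λ k → upTo (suc k) k (ℕ.m≤n+m (suc k) n)
    where
    n = length cs
    N = proj₁ (clearPowers x n)
    M = ι (+ suc N)

    upTo : ∀ j k → k ℕ.< n ℕ.+ j → (M * x ^ k) ∈ Z√
    upTo zero k k< = proj₂ (clearPowers x n) k
      (ℕ.<⇒≤ (subst (k ℕ.<_) (ℕ.+-identityʳ n) k<))
    upTo (suc j) k k< with ℕ.m≤n⇒m<n∨m≡n (ℕ.≤-pred (subst (k ℕ.<_) (ℕ.+-suc n j) k<))
    ... | inj₁ k<n+j = upTo j k k<n+j
    ... | inj₂ refl  = subst Z√
      (trans (*-assoc M (x ^ j) (x ^ n))
        (cong (M *_) (trans (sym (^-+ x j n)) (cong (x ^_) (ℕ.+-comm j n)))))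
      (horner x cs (M * x ^ j)
        (λ i i<n → subst Z√ (trans (cong (M *_) (^-+ x j i)) (sym (*-assoc M (x ^ j) (x ^ i))))
          (upTo j (j ℕ.+ i) (subst (j ℕ.+ i ℕ.<_) (ℕ.+-comm j n) (ℕ.+-monoʳ-< j i<n))))
        (subst Z√ (sym (trans (cong (M * x ^ j *_) root) (zeroʳ (M * x ^ j)))) (Z√-ι 0ℤ)))

  ^-* : ∀ x y k → (x * y) ^ k ≡ x ^ k * y ^ k
  ^-* x y zero    = sym (*-identityʳ 1#)
  ^-* x y (suc k) = trans (cong (x * y *_) (^-* x y k)) (interchange x y (x ^ k) (y ^ k))

  bounded-* : ∀ {x y} → HasBoundedPowers x → HasBoundedPowers y → HasBoundedPowers (x * y)
  bounded-* {x} {y} (m , p) (n , q) = _ , λ k → subst Z√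
    (trans (interchange (ι (+ suc m)) (x ^ k) (ι (+ suc n)) (y ^ k))
      (cong₂ _*_ (sym (ι-ℕ* (suc m) (suc n))) (sym (^-* x y k))))
    (Z√-* (p k) (q k))

  bounded-+ : ∀ {x y} → HasBoundedPowers x → HasBoundedPowers y → HasBoundedPowers (x + y)
  bounded-+ {x} {y} (m , p) (n , q) = _ , λ k → subst Z√
    (cong (_* (x + y) ^ k)
      (trans (cong₂ _*_ (*-identityʳ M) (*-identityʳ N)) (sym (ι-ℕ* (suc m) (suc n)))))
    (mixed k 0 0)
    where
    open CommutativeRing commutativeRing using (distribʳ)
    M = ι (+ suc m)
    N = ι (+ suc n)

    mixed : ∀ k i j → (((M * x ^ i) * (N * y ^ j)) * (x + y) ^ k) ∈ Z√
    mixed zero    i j = subst Z√ (sym (*-identityʳ _)) (Z√-* (p i) (q j))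
    mixed (suc k) i j = subst Z√
      (sym (trans (cong (A *_) (distribʳ S x y)) (trans (distribˡ A (x * S) (y * S))
        (cong₂ _+_ eqˣ eqʸ))))
      (Z√-+ (mixed k (suc i) j) (mixed k i (suc j)))
      where
      S = (x + y) ^ k
      A = (M * x ^ i) * (N * y ^ j)
      eqˣ : A * (x * S) ≡ ((M * (x * x ^ i)) * (N * y ^ j)) * S
      eqˣ = trans (x∙yz≈yx∙z A x S) (cong (_* S) (trans (sym (*-assoc x _ _))
              (cong (_* (N * y ^ j)) (x∙yz≈y∙xz x M (x ^ i)))))
      eqʸ : A * (y * S) ≡ ((M * x ^ i) * (N * (y * y ^ j))) * S
      eqʸ = trans (x∙yz≈yx∙z A y S) (cong (_* S) (trans (x∙yz≈y∙xz y (M * x ^ i) (N * y ^ j))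
              (cong ((M * x ^ i) *_) (x∙yz≈y∙xz y N (y ^ j)))))

  conjugate : K → K
  conjugate ⟨ a , b ⟩ = ⟨ a , ⊖ b ⟩

  conjugate-* : ∀ x y → conjugate (x * y) ≡ conjugate x * conjugate y
  conjugate-* ⟨ a , b ⟩ ⟨ a′ , b′ ⟩ = cong₂ ⟨_,_⟩
    (solve 5 (λ e a b a′ b′ → a :* a′ :+ e :* (b :* b′) := a :* a′ :+ e :* (:- b :* :- b′))
      refl δ a b a′ b′)
    (solve 4 (λ a b a′ b′ → :- (a :* b′ :+ b :* a′) := a :* :- b′ :+ :- b :* a′) refl a b a′ b′)

  conjugate-^ : ∀ x k → conjugate (x ^ k) ≡ conjugate x ^ k
  conjugate-^ x zero    = refl
  conjugate-^ x (suc k) = trans (conjugate-* x (x ^ k)) (cong (conjugate x *_) (conjugate-^ x k))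

  bounded-conjugate : ∀ {x} → HasBoundedPowers x → HasBoundedPowers (conjugate x)
  bounded-conjugate {x} (n , p) = n , λ k → subst Z√
    (trans (conjugate-* (ι (+ suc n)) (x ^ k)) (cong (ι (+ suc n) *_) (conjugate-^ x k)))
    (proj₁ (p k) , integer-- (proj₂ (p k)))

  bounded-rational : ∀ q → HasBoundedPowers ⟨ q , 0ℚ ⟩ → IsInteger q
  bounded-rational (mkℚ a zero c) _ = a , refl
  bounded-rational q@(mkℚ a (suc e) c) (n , p) = contradiction too-small ℕ.1+n≰n
    where
    x = ⟨ q , 0ℚ ⟩
    b = suc (suc e)
    N = suc n

    num : ℕ → ℤ
    num k = proj₁ (proj₁ (p k))

    clear-q : ι (+ b) * x ≡ ι a
    clear-q = cong₂ ⟨_,_⟩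
      (trans (solve 3 (λ e u v → u :* v :+ e :* (con 0ℚ :* con 0ℚ) := u :* v) refl δ (fromℤ (+ b)) q)
        (fromℤ-clear q))
      (solve 2 (λ u v → u :* con 0ℚ :+ con 0ℚ :* v := con 0ℚ) refl (fromℤ (+ b)) q)

    ι-^ : ∀ z k → ι z ^ k ≡ ι (z ℤ.^ k)
    ι-^ z zero    = refl
    ι-^ z (suc k) = trans (cong (ι z *_) (ι-^ z k)) (sym (ι-* z (z ℤ.^ k)))

    cleared : ∀ k → ι (+ b) ^ k * (ι (+ N) * x ^ k) ≡ ι (+ N ℤ.* a ℤ.^ k)
    cleared k = trans (x∙yz≈y∙xz (ι (+ b) ^ k) (ι (+ N)) (x ^ k))
      (trans (cong (ι (+ N) *_)
               (trans (sym (^-* (ι (+ b)) x k)) (trans (cong (_^ k) clear-q) (ι-^ a k))))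
        (sym (ι-* (+ N) (a ℤ.^ k))))

    rational-ι* : ∀ z y → rational (ι z * y) ≡ fromℤ z ⊛ rational y
    rational-ι* z ⟨ u , v ⟩ =
      solve 4 (λ e z u v → z :* u :+ e :* (con 0ℚ :* v) := z :* u) refl δ (fromℤ z) u v

    numerators : ∀ k → (+ b) ℤ.^ k ℤ.* num k ≡ + N ℤ.* a ℤ.^ k
    numerators k = cong ℚ.↥_ (trans (sym (fromℤ-* ((+ b) ℤ.^ k) (num k)))
      (trans (cong (fromℤ ((+ b) ℤ.^ k) ⊛_) (sym (proj₂ (proj₁ (p k)))))
      (trans (sym (rational-ι* ((+ b) ℤ.^ k) (ι (+ N) * x ^ k)))
      (cong rational (trans (cong (_* (ι (+ N) * x ^ k)) (sym (ι-^ (+ b) k))) (cleared k))))))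

    abs-^ : ∀ z k → ℤ.∣ z ℤ.^ k ∣ ≡ ℤ.∣ z ∣ ℕ.^ k
    abs-^ z zero    = refl
    abs-^ z (suc k) = trans (ℤ.abs-* z (z ℤ.^ k)) (cong (ℤ.∣ z ∣ ℕ.*_) (abs-^ z k))

    coprime-* : ∀ {l m n} → Coprime l m → Coprime l n → Coprime l (m ℕ.* n)
    coprime-* lm ln (i∣l , i∣mn) = ln (i∣l , Coprimality.coprime-divisor
      (λ { (j∣i , j∣m) → lm (∣-trans j∣i i∣l , j∣m) }) i∣mn)

    coprime-^ : ∀ {l m} → Coprime l m → ∀ k → Coprime l (m ℕ.^ k)
    coprime-^ lm zero    = Coprimality.sym (Coprimality.1-coprimeTo _)
    coprime-^ lm (suc k) = coprime-* lm (coprime-^ lm k)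

    c′ : Coprime ℤ.∣ a ∣ b
    c′ = Coprimality.recompute c

    coprime : ∀ k → Coprime (b ℕ.^ k) (ℤ.∣ a ∣ ℕ.^ k)
    coprime k = Coprimality.sym (coprime-^ (Coprimality.sym (coprime-^ (Coprimality.sym c′) k)) k)

    divides-N : ∀ k → b ℕ.^ k ∣ N
    divides-N k = Coprimality.coprime-divisor (coprime k) (divides ℤ.∣ num k ∣
      (trans (ℕ.*-comm (ℤ.∣ a ∣ ℕ.^ k) N)
      (trans (cong (N ℕ.*_) (sym (abs-^ a k)))
      (trans (sym (ℤ.abs-* (+ N) (a ℤ.^ k)))
      (trans (cong ℤ.∣_∣ (sym (numerators k)))
      (trans (ℤ.abs-* ((+ b) ℤ.^ k) (num k))
      (trans (cong (ℕ._* ℤ.∣ num k ∣) (abs-^ (+ b) k))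
      (ℕ.*-comm (b ℕ.^ k) ℤ.∣ num k ∣))))))))

    grows : ∀ k → k ℕ.< b ℕ.^ k
    grows zero    = s≤s z≤n
    grows (suc k) = ℕ.≤-<-trans (grows k) (ℕ.^-monoʳ-< b (s≤s (s≤s z≤n)) (ℕ.n<1+n k))

    too-small : N ℕ.< N
    too-small = ℕ.<-≤-trans (grows N) (∣⇒≤ (divides-N N))

  -- x is a root of X² - t X + n, where t and n are its trace and norm.

  bounded⇒integral : ∀ {x} → HasBoundedPowers x → IsIntegral x
  bounded⇒integral {x@(⟨ a , b ⟩)} p = norm ∷ ℤ.- trace ∷ [] , cong₂ ⟨_,_⟩
    (trans (cong₂ (λ n t → n ⊕ (a ⊛ (t ⊕ (a ⊛ 1ℚ ⊕ δ ⊛ (b ⊛ 0ℚ))) ⊕ δ ⊛ (b ⊛ (0ℚ ⊕ (a ⊛ 0ℚ ⊕ b ⊛ 1ℚ)))))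
              (sym norm≡) (trans (sym (fromℤ-- trace)) (cong ⊖_ (sym trace≡))))
      (solve 3 (λ e a b →
          (a :* a :+ e :* (b :* :- b)) :+
            (a :* (:- (a :+ a) :+ (a :* con 1ℚ :+ e :* (b :* con 0ℚ)))
              :+ e :* (b :* (con 0ℚ :+ (a :* con 0ℚ :+ b :* con 1ℚ))))
          := con 0ℚ)
        refl δ a b))
    (trans (cong (λ t → 0ℚ ⊕ (a ⊛ (0ℚ ⊕ (a ⊛ 0ℚ ⊕ b ⊛ 1ℚ)) ⊕ b ⊛ (t ⊕ (a ⊛ 1ℚ ⊕ δ ⊛ (b ⊛ 0ℚ)))))
              (trans (sym (fromℤ-- trace)) (cong ⊖_ (sym trace≡))))
      (solve 3 (λ e a b →
          con 0ℚ :+ (a :* (con 0ℚ :+ (a :* con 0ℚ :+ b :* con 1ℚ))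
            :+ b :* (:- (a :+ a) :+ (a :* con 1ℚ :+ e :* (b :* con 0ℚ))))
          := con 0ℚ)
        refl δ a b))
    where
    trace-integer : IsInteger (a ⊕ a)
    trace-integer = bounded-rational (a ⊕ a) (subst HasBoundedPowers
      (cong ⟨ a ⊕ a ,_⟩ (ℚ.+-inverseʳ b)) (bounded-+ p (bounded-conjugate p)))

    norm-integer : IsInteger (a ⊛ a ⊕ δ ⊛ (b ⊛ ⊖ b))
    norm-integer = bounded-rational _ (subst HasBoundedPowers
      (cong ⟨ a ⊛ a ⊕ δ ⊛ (b ⊛ ⊖ b) ,_⟩ (solve 2 (λ a b → a :* :- b :+ b :* a := con 0ℚ) refl a b))
      (bounded-* p (bounded-conjugate p)))

    trace  = proj₁ trace-integer
    trace≡ = proj₂ trace-integer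
    norm   = proj₁ norm-integer
    norm≡  = proj₂ norm-integer

  integral-+ : ∀ {x y} → IsIntegral x → IsIntegral y → IsIntegral (x + y)
  integral-+ p q = bounded⇒integral (bounded-+ (integral⇒bounded p) (integral⇒bounded q))

  integral-* : ∀ {x y} → IsIntegral x → IsIntegral y → IsIntegral (x * y)
  integral-* p q = bounded⇒integral (bounded-* (integral⇒bounded p) (integral⇒bounded q))

  integral-ι : ∀ z → IsIntegral (ι z)
  integral-ι z = bounded⇒integral (0 , λ k → Z√-* (Z√-ι (+ 1)) (Z√-^ k))
    where
    Z√-^ : ∀ k → (ι z ^ k) ∈ Z√
    Z√-^ zero    = Z√-ι (+ 1)
    Z√-^ (suc k) = Z√-* (Z√-ι z) (Z√-^ k)

  open Ideals isCommutativeRing IsIntegral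
    (integral-ι 0ℤ) (integral-ι 1ℤ) integral-+ integral-* public
    using (Unit; FractionalIdeal; InvertibleIdeal; classGroup)

------------------------------------------------------------------------
-- Quadratic fields

Squarefree : ℤ → Set
Squarefree d = ∀ m → m ℕ.* m ∣ ℤ.∣ d ∣ → m ≡ 1

-- Every quadratic field is ℚ(√d) for exactly one squarefree d ≠ 1.
-- Squarefreeness excludes d = 0.

record QuadraticField : Set where
  field
    radicand   : ℤ
    squarefree : Squarefree radicand
    radicand≢1 : radicand ≢ 1ℤ

  open Quadratic radicand public

  nonzero⇒unit : ∀ x → x ≢ 0# → Unit x
  nonzero⇒unit x@(⟨ a , b ⟩) x≢0 with norm ℚ.≟ 0ℚ
    where norm = a ⊛ a ⊕ ⊖ (fromℤ radicand ⊛ (b ⊛ b))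
  ... | no n≢0 = y , trans (*-comm y x) xy≡1 , xy≡1
    where
    open CommutativeRing commutativeRing using (*-comm)
    open +-*-Solver using (solve; _:+_; _:*_; :-_; con; _:=_)
    δ = fromℤ radicand
    n = a ⊛ a ⊕ ⊖ (δ ⊛ (b ⊛ b))
    instance
      n-nonZero : ℚ.NonZero n
      n-nonZero = ℚ.≢-nonZero n≢0
    r = ℚ.1/ n
    y = ⟨ a ⊛ r , ⊖ b ⊛ r ⟩
    xy≡1 : x * y ≡ 1#
    xy≡1 = cong₂ ⟨_,_⟩
      (trans (solve 4 (λ e a b r →
                a :* (a :* r) :+ e :* (b :* (:- b :* r))
                := (a :* a :+ :- (e :* (b :* b))) :* r) refl δ a b r)
        (ℚ.*-inverseʳ n))
      (solve 3 (λ a b r → a :* (:- b :* r) :+ b :* (a :* r) := con 0ℚ) refl a b r)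
  ... | yes n≡0 with b ℚ.≟ 0ℚ
  ...   | yes refl = contradiction (cong ⟨_, 0ℚ ⟩ a≡0) x≢0
    where
    open +-*-Solver using (solve; _:+_; _:*_; :-_; con; _:=_)
    δ = fromℤ radicand
    a²≡0 : a ⊛ a ≡ 0ℚ
    a²≡0 = trans (solve 2 (λ e a → a :* a := a :* a :+ :- (e :* (con 0ℚ :* con 0ℚ))) refl δ a) n≡0
    a≡0 : a ≡ 0ℚ
    a≡0 with a ℚ.≟ 0ℚ
    ... | yes eq = eq
    ... | no a≢0 = trans (sym (ℚ.*-identityˡ a)) (trans (cong (_⊛ a) (sym (ℚ.*-inverseˡ a)))
        (trans (ℚ.*-assoc (ℚ.1/ a) a a) (trans (cong (ℚ.1/ a ⊛_) a²≡0) (ℚ.*-zeroʳ (ℚ.1/ a)))))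
      where instance
        a-nonZero : ℚ.NonZero a
        a-nonZero = ℚ.≢-nonZero a≢0
  ...   | no b≢0 = contradiction d≡1 radicand≢1
    where
    open +-*-Solver using (solve; _:+_; _:*_; :-_; con; _:=_)
    δ = fromℤ radicand
    instance
      b-nonZero : ℚ.NonZero b
      b-nonZero = ℚ.≢-nonZero b≢0
    r = ℚ.1/ b
    q = a ⊛ r

    q²≡δ : q ⊛ q ≡ δ
    q²≡δ = trans
      (solve 4 (λ e a b r → (a :* r) :* (a :* r)
          := (a :* a :+ :- (e :* (b :* b))) :* (r :* r) :+ e :* ((b :* r) :* (b :* r)))
        refl δ a b r)
      (trans (cong₂ (λ u v → u ⊛ (r ⊛ r) ⊕ δ ⊛ (v ⊛ v)) n≡0 (ℚ.*-inverseʳ b))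
        (solve 2 (λ e r → con 0ℚ :* (r :* r) :+ e :* (con 1ℚ :* con 1ℚ) := e) refl δ r))

    integral : IsIntegral ⟨ q , 0ℚ ⟩
    integral = ℤ.- radicand ∷ 0ℤ ∷ [] , cong₂ ⟨_,_⟩
      (trans (cong (λ u → u ⊕ (q ⊛ (0ℚ ⊕ (q ⊛ 1ℚ ⊕ δ ⊛ (0ℚ ⊛ 0ℚ)))
                                ⊕ δ ⊛ (0ℚ ⊛ (0ℚ ⊕ (q ⊛ 0ℚ ⊕ 0ℚ ⊛ 1ℚ)))))
               (trans (sym (fromℤ-- radicand)) (cong ⊖_ (sym q²≡δ))))
        (solve 2 (λ e q → :- (q :* q) :+ (q :* (con 0ℚ :+ (q :* con 1ℚ :+ e :* (con 0ℚ :* con 0ℚ)))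
              :+ e :* (con 0ℚ :* (con 0ℚ :+ (q :* con 0ℚ :+ con 0ℚ :* con 1ℚ))))
            := con 0ℚ) refl δ q))
      (solve 2 (λ e q → con 0ℚ :+ (q :* (con 0ℚ :+ (q :* con 0ℚ :+ con 0ℚ :* con 1ℚ))
              :+ con 0ℚ :* (con 0ℚ :+ (q :* con 1ℚ :+ e :* (con 0ℚ :* con 0ℚ))))
            := con 0ℚ) refl δ q)

    q-integer : IsInteger q
    q-integer = bounded-rational q (integral⇒bounded integral)

    z = proj₁ q-integer

    z²≡d : z ℤ.* z ≡ radicand
    z²≡d = cong ℚ.↥_ (trans (sym (fromℤ-* z z))
      (trans (sym (cong₂ _⊛_ (proj₂ q-integer) (proj₂ q-integer))) q²≡δ))

    square≡1 : ∀ i → ℤ.∣ i ∣ ≡ 1 → i ℤ.* i ≡ 1ℤ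
    square≡1 (+ 1)      refl = refl
    square≡1 (-[1+ 0 ]) refl = refl

    d≡1 : radicand ≡ 1ℤ
    d≡1 = trans (sym z²≡d) (square≡1 z (squarefree ℤ.∣ z ∣ (divides 1
      (trans (trans (cong ℤ.∣_∣ (sym z²≡d)) (ℤ.abs-* z z)) (sym (ℕ.+-identityʳ _))))))

Real Imaginary : Pred QuadraticField 0ℓ
Real      K = 0ℤ ℤ.< QuadraticField.radicand K
Imaginary K = QuadraticField.radicand K ℤ.< 0ℤ

infix 4 _≅_

_≅_ : QuadraticField → QuadraticField → Set
K ≅ L = ∃ (IsRingIsomorphism (rawRing K) (rawRing L))
  where
  rawRing : QuadraticField → RawRing 0ℓ 0ℓ
  rawRing K = CommutativeRing.rawRing (QuadraticField.commutativeRing K)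

-- No finite list exhausts, up to isomorphism, the fields satisfying P.

InfinitelyMany : ∀ {ℓ} → Pred QuadraticField ℓ → Set ℓ
InfinitelyMany P = ∀ Ls → ∃[ K ] P K × All (λ L → ¬ (K ≅ L)) Ls

-- The principal genus is the subgroup of squares of the class group.

PrincipalGenusHasElementOfOrder : ℕ → Pred QuadraticField (lsuc 0ℓ)
PrincipalGenusHasElementOfOrder n K = ∃[ x ] HasOrder Cl x n × IsSquare Cl x
  where Cl = QuadraticField.classGroup K

{-# OPTIONS --safe #-}
module Submission where

-- An element x of order 3 in an abelian group is a square, since x = x² x², so
-- it suffices to find fields whose class group has an element of order 3.
--
-- Let α be an algebraic integer of a quadratic field whose norm is a cube m³
-- and whose trace is prime to m. The ideal 𝔞 = (m, α) has cube (α), and if 𝔞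
-- is principal then α is a unit times a cube (PrincipalCube, order-3-class).
-- To see that an integer is not a cube, note that if γ has trace X and norm N,
-- then γ³ has trace X³ - 3 N X and norm N³. So a cube of odd norm has even
-- trace (odd-trace⇒¬cube), and the trace of a cube whose norm is divisible by 3
-- is not 2 modulo 9 (trace-2-mod-9⇒¬cube).
--
-- Imaginary fields: for an odd prime p and t = p + 2, let α have trace 2 t³ - p and
-- norm t⁶, both odd. The discriminant p (p - 4 t³) of its minimal polynomial is
-- divisible by p exactly once, so p divides the radicand d of the field of α,
-- and |d| is as large as desired. As soon as p > 4 the only units of the field
-- are ±1 (unit-rational), which are cubes, so α is not a unit times a cube.
--
-- Real fields: for an odd multiple n of 3, let A = n³ and ε = (A + √(A² + 4)) / 2,
-- a unit of norm -1. Then α = ε - 1 has trace A - 2 and norm (-n)³. The unit ε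
-- need not be fundamental, but ε² is not a cube, and this is enough. Indeed
-- for any unit η, the Euclidean algorithm on units of norm 1 shows that ε² and
-- η² (or its conjugate) are powers of one unit w (Units.generator). As ε² is
-- not a cube, its exponent is prime to 3, hence η εʲ is a cube for some j
-- (unit-modulo-cubes). If α were a unit times a cube, then α εʲ would be a cube
-- for some j, and it would be one for some j < 3. But α and α ε² have odd norm
-- and odd trace, while α ε has norm A and trace A² - A + 2, which are 0 modulo 3
-- and 2 modulo 9 (not-cube). Finally, if n < n′ ≤ 5 n / 4 then A = n³ and B = n′³
-- give different fields, because (A² + 4) (B² + 4) is not a square
-- (product-not-square). So among sufficiently many consecutive n, one avoids
-- any given finite list of fields.
--
-- The numbers A² + 4 and p (p - 4 t³) need not be squarefree: the radicand is
-- the squarefree part, and α and ε are integral because their traces and norms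
-- are integers.

open import Defs
open import Data.Product using (_×_)
open import Level using (0ℓ)
open import Algebra.Bundles using (AbelianGroup; CommutativeRing)
open import Algebra.Core using (Op₁; Op₂)
open import Algebra.Morphism.Structures using (IsRingIsomorphism)
import Algebra.Properties.CommutativeSemiring.Exp as Exponentiation
import Algebra.Solver.Ring as RingSolver
open import Algebra.Solver.Ring.AlmostCommutativeRing using (fromCommutativeRing; _-Raw-AlmostCommutative⟶_)
import Algebra.Solver.Ring.NaturalCoefficients.Default as SemiringSolver
open import Algebra.Structures using (IsCommutativeRing)
open import Data.Fin.Base as Fin using (Fin; toℕ)
import Data.Fin.Properties as Fin
open import Data.Integer.Base as ℤ using (ℤ; +_; -[1+_]; 0ℤ; 1ℤ; -1ℤ)
import Data.Integer.DivMod as ℤ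
import Data.Integer.Properties as ℤ
open import Data.Integer.Tactic.RingSolver using (solve-∀)
open import Data.List.Base using (List; []; _∷_; length; lookup; map)
open import Data.List.Membership.DecPropositional ℤ._≟_ using (_∈?_)
open import Data.List.Membership.Propositional using () renaming (_∈_ to _∈ˡ_; _∉_ to _∉ˡ_)
open import Data.List.Membership.Propositional.Properties using (∈-map⁺)
open import Data.List.Relation.Unary.All as All using (All; []; _∷_)
import Data.List.Relation.Unary.Any as Any
import Data.List.Relation.Unary.Any.Properties as Any
open import Data.Maybe.Base as Maybe using (Maybe)
open import Data.Nat.Base as ℕ using (ℕ; zero; suc; z≤n; s≤s; _≤_; _<_; _!; NonZero)
open import Data.Nat.Coprimality as Coprimality using (Coprime)
open import Data.Nat.Divisibility using
  ( _∣_; _∣?_; divides; ∣⇒≤; ∣-trans; ∣1⇒≡1; 0∣⇒≡0; m∣m*n; ∣m⇒∣m*n; ∣m+n∣m⇒∣n; *-cancelˡ-∣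
  ; *-pres-∣; m≤n⇒m!∣n!)
import Data.Nat.DivMod as ℕ
open import Data.Nat.Induction using (<-rec; <-wellFounded; Acc; acc)
open import Data.Nat.Primality using
  (Prime; euclidsLemma; prime⇒irreducible; prime⇒nonZero; ¬prime[1])
open import Data.Nat.Primality.Factorisation using (PrimeFactorisation; factorise)
import Data.Nat.Properties as ℕ
import Data.Nat.Tactic.RingSolver as ℕ-Solver
open import Data.Product using (∃-syntax; _,_; proj₁; proj₂)
open import Data.Rational.Base as ℚ using (ℚ; mkℚ; 0ℚ; 1ℚ; ½; *<*; *≤*)
  renaming (_+_ to _⊕_; _*_ to _⊛_; -_ to ⊖_)
open import Data.Rational.Literals using (fromℤ)
import Data.Rational.Properties as ℚ
open import Data.Rational.Solver using (module +-*-Solver)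
open import Data.Sum.Base using (_⊎_; inj₁; inj₂)
open import Relation.Binary.PropositionalEquality hiding (J)
open import Relation.Nullary using (¬_; Dec; yes; no; contradiction; ¬?; decidable-stable; _×-dec_)
open import Relation.Nullary.Decidable using (dec⇒maybe; from-no)
open import Relation.Unary using (Pred; _∈_; _⊆_)

------------------------------------------------------------------------
-- Elements of order 3

module _ {c ℓ} (G : AbelianGroup c ℓ) where
  open AbelianGroup G
    renaming (refl to ≈-refl; sym to ≈-sym; trans to ≈-trans)

  order-3-square : ∀ {x} → x ∙ (x ∙ x) ≈ ε → ¬ (x ≈ ε) → HasOrder G x 3 × IsSquare G x
  order-3-square {x} x³≈ε x≉ε =
    ( s≤s z≤n
    , ≈-trans (∙-congˡ (∙-congˡ (identityʳ x))) x³≈ε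
    , λ { zero () _
        ; 1 _ _ x≈ε → x≉ε (≈-trans (≈-sym (identityʳ x)) x≈ε)
        ; 2 _ _ x²≈ε → x≉ε (≈-trans (≈-sym (identityʳ x))
            (≈-trans (∙-congˡ (≈-sym (≈-trans (≈-sym (∙-congˡ (identityʳ x))) x²≈ε))) x³≈ε))
        ; (suc (suc (suc _))) _ (s≤s (s≤s (s≤s ()))) })
    , x ∙ x
    , ≈-sym (≈-trans (assoc x x (x ∙ x)) (≈-trans (∙-congˡ x³≈ε) (identityʳ x)))

------------------------------------------------------------------------
-- An ideal whose cube is principal

-- A is a commutative ring and O a subring, as in the definition of the class group.
module IdealCube
  {A : Set} {_+_ _*_ : Op₂ A} { -_ : Op₁ A} {0# 1# : A}
  (isCommutativeRing : IsCommutativeRing _≡_ _+_ _*_ -_ 0# 1#)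
  (O : Pred A 0ℓ)
  (0∈O : 0# ∈ O) (1∈O : 1# ∈ O)
  (O-+ : ∀ {x y} → x ∈ O → y ∈ O → (x + y) ∈ O)
  (O-* : ∀ {x y} → x ∈ O → y ∈ O → (x * y) ∈ O)
  where

  open Ideals isCommutativeRing O 0∈O 1∈O O-+ O-*
  open FractionalIdeal

  private
    ring : CommutativeRing 0ℓ 0ℓ
    ring = record { isCommutativeRing = isCommutativeRing }

  open CommutativeRing ring using (*-identityʳ; *-identityˡ; zeroʳ; distribˡ; *-assoc; *-comm; commutativeSemiring)
  open SemiringSolver commutativeSemiring using (solve; con; _:+_; _:*_; _:=_)

  -- The element α of O has "conjugate" ᾱ in O, "norm" α ᾱ = m³, and a "trace"
  -- α + ᾱ that generates the unit ideal together with m.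
  module PrincipalCube {m α ᾱ u v : A}
    (m∈O : m ∈ O) (α∈O : α ∈ O) (ᾱ∈O : ᾱ ∈ O) (u∈O : u ∈ O) (v∈O : v ∈ O)
    (α-unit : Unit α)
    (norm   : α * ᾱ ≡ m * (m * m))
    (bezout : (u * m) + (v * (α + ᾱ)) ≡ 1#)
    where

    private
      α⁻¹ : A
      α⁻¹ = proj₁ α-unit

      swap : ∀ r x y → r * (x * y) ≡ x * (r * y)
      swap = solve 3 (λ r x y → r :* (x :* y) := x :* (r :* y)) refl

      cancel : ∀ x → α⁻¹ * (α * x) ≡ x
      cancel x = trans (sym (*-assoc α⁻¹ α x))
        (trans (cong (_* x) (proj₁ (proj₂ α-unit))) (*-identityˡ x))

      cancel′ : ∀ x → α * (α⁻¹ * x) ≡ x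
      cancel′ x = trans (sym (*-assoc α α⁻¹ x))
        (trans (cong (_* x) (proj₂ (proj₂ α-unit))) (*-identityˡ x))

    -- The ideal m O + α O.
    𝔞 : FractionalIdeal
    𝔞 = record
      { Carrier     = λ z → ∃[ p ] ∃[ q ] p ∈ O × q ∈ O × z ≡ (m * p) + (α * q)
      ; 0∈          = 0# , 0# , 0∈O , 0∈O , zero-eq m α
      ; +-closed    = λ { (p , q , p∈ , q∈ , refl) (p′ , q′ , p′∈ , q′∈ , refl) →
          p + p′ , q + q′ , O-+ p∈ p′∈ , O-+ q∈ q′∈ , add-eq m α p q p′ q′ }
      ; *-closed    = λ { {r} r∈ (p , q , p∈ , q∈ , refl) →
          r * p , r * q , O-* r∈ p∈ , O-* r∈ q∈ , mul-eq m α r p q }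
      ; denominator = 1# , 1∈O , Unit-1 , λ { (p , q , p∈ , q∈ , refl) →
          O-* 1∈O (O-+ (O-* m∈O p∈) (O-* α∈O q∈)) }
      }
      where
      zero-eq : ∀ m α → 0# ≡ (m * 0#) + (α * 0#)
      zero-eq = solve 2 (λ m α →
        con 0 := (m :* con 0) :+ (α :* con 0)) refl
      add-eq : ∀ m α p q p′ q′ →
        ((m * p) + (α * q)) + ((m * p′) + (α * q′)) ≡ (m * (p + p′)) + (α * (q + q′))
      add-eq = solve 6 (λ m α p q p′ q′ →
        ((m :* p) :+ (α :* q)) :+ ((m :* p′) :+ (α :* q′)) := (m :* (p :+ p′)) :+ (α :* (q :+ q′))) refl
      mul-eq : ∀ m α r p q → r * ((m * p) + (α * q)) ≡ (m * (r * p)) + (α * (r * q))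
      mul-eq = solve 5 (λ m α r p q →
        r :* ((m :* p) :+ (α :* q)) := (m :* (r :* p)) :+ (α :* (r :* q))) refl

    private
      I I² I³ : Pred A 0ℓ
      I  = Carrier 𝔞
      I² = Products I I
      I³ = Products I I²

    I⊆O : I ⊆ O
    I⊆O (p , q , p∈ , q∈ , refl) = O-+ (O-* m∈O p∈) (O-* α∈O q∈)

    I²⊆O : I² ⊆ O
    I²⊆O = least O 0∈O O-+ (λ a∈ b∈ → O-* (I⊆O a∈) (I⊆O b∈))

    m∈I : m ∈ I
    m∈I = 1# , 0# , 1∈O , 0∈O , eq m α
      where
      eq : ∀ m α → m ≡ (m * 1#) + (α * 0#)
      eq = solve 2 (λ m α →
        m := (m :* con 1) :+ (α :* con 0)) refl

    α∈I : α ∈ I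
    α∈I = 0# , 1# , 0∈O , 1∈O , eq m α
      where
      eq : ∀ m α → α ≡ (m * 0#) + (α * 1#)
      eq = solve 2 (λ m α →
        α := (m :* con 0) :+ (α :* con 1)) refl

    -- Apart from m³ = α ᾱ, each product of three generators m, α has a factor α.
    cube⊆ : I³ ⊆ Scaled α O
    cube⊆ = least S S-0 S-+ λ {a} {b} a∈ b∈ →
      least (λ b → ∀ {a} → a ∈ I → S (a * b))
        (λ {a} _ → subst S (sym (zeroʳ a)) S-0)
        (λ f g {a} a∈ → subst S (sym (distribˡ a _ _)) (S-+ (f a∈) (g a∈)))
        (λ b∈ c∈ a∈ → triple a∈ b∈ c∈)
        b∈ a∈
      where
      S = Scaled α O
      S-0 : S 0#
      S-0 = 0# , 0∈O , sym (zeroʳ α)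
      S-+ : ∀ {x y} → S x → S y → S (x + y)
      S-+ (w , w∈ , refl) (w′ , w′∈ , refl) = w + w′ , O-+ w∈ w′∈ , sym (distribˡ α w w′)

      expand : ∀ m α p q p′ q′ p″ q″ →
        ((m * p) + (α * q)) * (((m * p′) + (α * q′)) * ((m * p″) + (α * q″))) ≡
        (((m * (m * m)) * (p * (p′ * p″))) +
         (α * ((m * m) * ((p * (p′ * q″)) + ((p * (q′ * p″)) + (q * (p′ * p″))))))) +
        ((α * ((m * α) * ((p * (q′ * q″)) + ((q * (p′ * q″)) + (q * (q′ * p″)))))) +
         (α * ((α * α) * (q * (q′ * q″)))))
      expand = solve 8 (λ m α p q p′ q′ p″ q″ →
        ((m :* p) :+ (α :* q)) :* (((m :* p′) :+ (α :* q′)) :* ((m :* p″) :+ (α :* q″))) :=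
        (((m :* (m :* m)) :* (p :* (p′ :* p″))) :+
         (α :* ((m :* m) :* ((p :* (p′ :* q″)) :+ ((p :* (q′ :* p″)) :+ (q :* (p′ :* p″))))))) :+
        ((α :* ((m :* α) :* ((p :* (q′ :* q″)) :+ ((q :* (p′ :* q″)) :+ (q :* (q′ :* p″)))))) :+
         (α :* ((α :* α) :* (q :* (q′ :* q″)))))) refl

      collect : ∀ α ᾱ x y z w →
        (((α * ᾱ) * x) + (α * y)) + ((α * z) + (α * w)) ≡ α * (((ᾱ * x) + y) + (z + w))
      collect = solve 6 (λ α ᾱ x y z w →
        (((α :* ᾱ) :* x) :+ (α :* y)) :+ ((α :* z) :+ (α :* w)) := α :* (((ᾱ :* x) :+ y) :+ (z :+ w))) refl

      triple : ∀ {a b c} → a ∈ I → b ∈ I → c ∈ I → S (a * (b * c))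
      triple (p , q , p∈ , q∈ , refl) (p′ , q′ , p′∈ , q′∈ , refl) (p″ , q″ , p″∈ , q″∈ , refl) =
        _ ,
        O-+ (O-+ (O-* ᾱ∈O (O-* p∈ (O-* p′∈ p″∈)))
                 (O-* (O-* m∈O m∈O)
                   (O-+ (O-* p∈ (O-* p′∈ q″∈)) (O-+ (O-* p∈ (O-* q′∈ p″∈)) (O-* q∈ (O-* p′∈ p″∈))))))
            (O-+ (O-* (O-* m∈O α∈O)
                   (O-+ (O-* p∈ (O-* q′∈ q″∈)) (O-+ (O-* q∈ (O-* p′∈ q″∈)) (O-* q∈ (O-* q′∈ p″∈)))))
                 (O-* (O-* α∈O α∈O) (O-* q∈ (O-* q′∈ q″∈)))) ,
        trans (expand m α p q p′ q′ p″ q″)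
          (trans (cong₂ _+_ (cong₂ _+_ (cong (_* (p * (p′ * p″))) (sym norm)) refl) refl)
            (collect α ᾱ _ _ _ _))

    -- α = α (u m + v (α + ᾱ))², which expands into multiples of products of three
    -- generators because α ᾱ = m³.
    α∈I³ : α ∈ I³
    α∈I³ = subst I³ (sym α-eq)
      (plus (times (O-* u∈O u∈O) (prod α∈I m∈I m∈I))
      (plus (times (O-* 2∈O (O-* u∈O v∈O)) (prod m∈I α∈I α∈I))
      (plus (times (O-* 2∈O (O-* (O-* u∈O v∈O) m∈O)) (prod m∈I m∈I m∈I))
      (plus (times (O-* v∈O v∈O) (prod α∈I α∈I α∈I))
            (times (O-* (O-* v∈O v∈O) (O-+ (O-* 2∈O α∈O) ᾱ∈O)) (prod m∈I m∈I m∈I))))))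
      where
      2∈O : (1# + 1#) ∈ O
      2∈O = O-+ 1∈O 1∈O
      plus : ∀ {x y} → x ∈ I³ → y ∈ I³ → (x + y) ∈ I³
      plus = Products-+
      times : ∀ {r x} → r ∈ O → x ∈ I³ → (r * x) ∈ I³
      times = *-closed (𝔞 · (𝔞 · 𝔞))
      prod : ∀ {a b c} → a ∈ I → b ∈ I → c ∈ I → (a * (b * c)) ∈ I³
      prod a∈ b∈ c∈ = product {J = I²} a∈ (product b∈ c∈)

      expand : ∀ m α ᾱ u v →
        α * (((u * m) + (v * (α + ᾱ))) * ((u * m) + (v * (α + ᾱ)))) ≡
        ((u * u) * (α * (m * m))) +
        ((((1# + 1#) * (u * v)) * (m * (α * α))) +
        ((((1# + 1#) * ((u * v) * m)) * (α * ᾱ)) +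
        (((v * v) * (α * (α * α))) +
        (((v * v) * (((1# + 1#) * α) + ᾱ)) * (α * ᾱ)))))
      expand = solve 5 (λ m α ᾱ u v →
        α :* (((u :* m) :+ (v :* (α :+ ᾱ))) :* ((u :* m) :+ (v :* (α :+ ᾱ)))) :=
        ((u :* u) :* (α :* (m :* m))) :+
        ((((con 1 :+ con 1) :* (u :* v)) :* (m :* (α :* α))) :+
        ((((con 1 :+ con 1) :* ((u :* v) :* m)) :* (α :* ᾱ)) :+
        (((v :* v) :* (α :* (α :* α))) :+
        (((v :* v) :* (((con 1 :+ con 1) :* α) :+ ᾱ)) :* (α :* ᾱ)))))) refl

      -- The expansion, with α ᾱ replaced by n.
      sum : A → A
      sum n = ((u * u) * (α * (m * m))) +
        ((((1# + 1#) * (u * v)) * (m * (α * α))) +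
        ((((1# + 1#) * ((u * v) * m)) * n) +
        (((v * v) * (α * (α * α))) +
        (((v * v) * (((1# + 1#) * α) + ᾱ)) * n))))

      α-eq : α ≡ sum (m * (m * m))
      α-eq = trans (sym (trans (cong (λ e → α * (e * e)) bezout)
                 (trans (cong (α *_) (*-identityʳ 1#)) (*-identityʳ α))))
        (trans (expand m α ᾱ u v) (cong sum norm))

    cube⊇ : Scaled α O ⊆ I³
    cube⊇ (w , w∈ , refl) = subst I³ (*-comm w α) (*-closed (𝔞 · (𝔞 · 𝔞)) w∈ α∈I³)

    -- The ideal α⁻¹ 𝔞², described without division.
    𝔞⁻¹ : FractionalIdeal
    𝔞⁻¹ = record
      { Carrier     = λ z → (α * z) ∈ I²
      ; 0∈          = subst I² (sym (zeroʳ α)) none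
      ; +-closed    = λ p q → subst I² (sym (distribˡ α _ _)) (Products-+ p q)
      ; *-closed    = λ {r} {x} r∈ p → subst I² (swap r α x) (*-closed (𝔞 · 𝔞) r∈ p)
      ; denominator = α , α∈O , α-unit , I²⊆O
      }

    𝔞-invertible : InvertibleIdeal
    𝔞-invertible = record
      { ideal    = 𝔞
      ; inverse  = 𝔞⁻¹
      ; inverses = least O 0∈O O-+ to , from
      }
      where
      J : Pred A 0ℓ
      J = Carrier 𝔞⁻¹

      to : ∀ {a b} → a ∈ I → b ∈ J → (a * b) ∈ O
      to {a} {b} a∈ b∈ with cube⊆ (product {J = I²} a∈ b∈)
      ... | w , w∈ , eq = subst O
        (trans (sym (cancel w)) (trans (cong (α⁻¹ *_) (trans (sym eq) (swap a α b))) (cancel (a * b)))) w∈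

      from′ : ∀ {x} → x ∈ I³ → (α⁻¹ * x) ∈ Products I J
      from′ = leastUnder′ λ {a} {b} a∈ b∈ → subst (Products I J) (swap a α⁻¹ b)
        (product {J = J} a∈ (subst I² (sym (cancel′ b)) b∈))
        where
        leastUnder′ : (∀ {a b} → a ∈ I → b ∈ I² → (α⁻¹ * (a * b)) ∈ Products I J) →
          ∀ {w} → w ∈ I³ → (α⁻¹ * w) ∈ Products I J
        leastUnder′ = leastUnder {I} {I²} {I} {J} α⁻¹

      from : O ⊆ Products I J
      from {w} w∈ = subst (Products I J) (cancel w) (from′ (cube⊇ (w , w∈ , refl)))

    𝔞³∼𝟙 : 𝔞 · (𝔞 · 𝔞) ∼ 𝟙
    𝔞³∼𝟙 = α , α-unit , cube⊆ , cube⊇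

    -- If 𝔞 = β O, then α O = 𝔞³ = β³ O, so that α = η β³ and β³ = α η′ with η and
    -- η′ in O.
    principal⇒cube : 𝔞 ∼ 𝟙 →
      ∃[ β ] ∃[ η ] ∃[ η′ ] β ∈ O × η ∈ O × η′ ∈ O × η * η′ ≡ 1# × α ≡ η * (β * (β * β))
    principal⇒cube (β , _ , f , g)
      with least S S-0 S-+ S-3 α∈I³
      where
      S = Scaled (β * (β * β)) O
      S-0 : S 0#
      S-0 = 0# , 0∈O , sym (zeroʳ _)
      S-+ : ∀ {x y} → S x → S y → S (x + y)
      S-+ (w , w∈ , refl) (w′ , w′∈ , refl) = w + w′ , O-+ w∈ w′∈ , sym (distribˡ _ w w′)
      eq : ∀ β x y z → (β * x) * ((β * y) * (β * z)) ≡ (β * (β * β)) * (x * (y * z))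
      eq = solve 4 (λ β x y z →
        (β :* x) :* ((β :* y) :* (β :* z)) := (β :* (β :* β)) :* (x :* (y :* z))) refl
      S-3 : ∀ {a b} → a ∈ I → b ∈ I² → S (a * b)
      S-3 a∈ b∈ = least (λ b → ∀ {a} → a ∈ I → S (a * b))
        (λ {a} _ → subst S (sym (zeroʳ a)) S-0)
        (λ f g {a} a∈ → subst S (sym (distribˡ a _ _)) (S-+ (f a∈) (g a∈)))
        (λ b∈ c∈ a∈ → let (x , x∈ , x-eq) = f a∈ ; (y , y∈ , y-eq) = f b∈ ; (z , z∈ , z-eq) = f c∈ in
           x * (y * z) , O-* x∈ (O-* y∈ z∈) ,
           trans (cong₂ _*_ x-eq (cong₂ _*_ y-eq z-eq)) (eq β x y z))
        b∈ a∈
    ... | η , η∈ , α≡ with cube⊆ (product {J = I²} β∈I (product β∈I β∈I))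
      where
      β∈I : β ∈ I
      β∈I = g (1# , 1∈O , sym (*-identityʳ β))
    ... | η′ , η′∈ , β³≡ =
      β , η , η′ , I⊆O (g (1# , 1∈O , sym (*-identityʳ β))) , η∈ , η′∈ , ηη′≡1 ,
      trans α≡ (*-comm _ η)
      where
      -- α η η′ = β³ η = α
      move : ∀ α η η′ → α * (η * η′) ≡ (α * η′) * η
      move = solve 3 (λ α η η′ →
        α :* (η :* η′) := (α :* η′) :* η) refl
      ηη′≡1 : η * η′ ≡ 1#
      ηη′≡1 = trans (sym (cancel (η * η′)))
        (trans (cong (α⁻¹ *_) (trans (move α η η′) (trans (cong (_* η) (sym β³≡)) (sym α≡))))
          (proj₁ (proj₂ α-unit)))

------------------------------------------------------------------------
-- Natural numbers and integers

-- A prime factor of N! + 1 exceeds N.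
prime-above : ∀ N → ∃[ p ] Prime p × N ℕ.< p
prime-above N = go (factorise (suc (N !)))
  where
  go : PrimeFactorisation (suc (N !)) → ∃[ p ] Prime p × N ℕ.< p
  go record { factors = [] ; isFactorisation = eq } =
    contradiction (ℕ.suc-injective eq) (ℕ.≢-nonZero⁻¹ (N !) {{N ℕ.!≢0}})
  go record { factors = p ∷ ps ; isFactorisation = eq ; factorsPrime = pp ∷ _ } with p ℕ.≤? N
  ... | no p≰N = p , pp , ℕ.≰⇒> p≰N
  ... | yes p≤N = contradiction (subst Prime p≡1 pp) ¬prime[1]
    where
    p∣p! : ∀ {p} → .{{NonZero p}} → p ∣ p !
    p∣p! {suc p} = m∣m*n (p !)
    p≡1 : p ≡ 1
    p≡1 = ∣1⇒≡1 (∣m+n∣m⇒∣n (subst (p ∣_) (trans (sym eq) (ℕ.+-comm 1 (N !))) (m∣m*n _))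
      (∣-trans (p∣p! {{prime⇒nonZero pp}}) (m≤n⇒m!∣n! p≤N)))

-- Squares of numbers m ≥ 2 are divided out as long as possible.
squarefree-part : ∀ n → .{{NonZero n}} →
  ∃[ s ] ∃[ e ] n ≡ s ℕ.* s ℕ.* e × (∀ m → m ℕ.* m ∣ e → m ≡ 1)
squarefree-part n@(suc _) = <-rec P step n n≢0
  where
  P : ℕ → Set
  P n = n ≢ 0 → ∃[ s ] ∃[ e ] n ≡ s ℕ.* s ℕ.* e × (∀ m → m ℕ.* m ∣ e → m ≡ 1)
  n≢0 : n ≢ 0
  n≢0 ()
  step : ∀ n → (∀ {k} → k ℕ.< n → P k) → P n
  step n rec n≢0 with ℕ.anyUpTo? (λ m → (2 ℕ.≤? m) ×-dec (m ℕ.* m ∣? n)) (suc n)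
  ... | no none = 1 , n , sym (ℕ.+-identityʳ n) , sf
    where
    sf : ∀ m → m ℕ.* m ∣ n → m ≡ 1
    sf 0 0∣n = contradiction (0∣⇒≡0 0∣n) n≢0
    sf 1 _   = refl
    sf m@(suc (suc _)) m²∣n = contradiction
      (m , s≤s (ℕ.≤-trans (ℕ.m≤m*n m m) (∣⇒≤ {{ℕ.≢-nonZero n≢0}} m²∣n)) , s≤s (s≤s z≤n) , m²∣n) none
  ... | yes (m@(suc (suc _)) , _ , 2≤m@(s≤s (s≤s _)) , divides q n≡q*m²) =
    s ℕ.* m , e , trans n≡q*m² (trans (cong (ℕ._* (m ℕ.* m)) q≡) (eq s m e)) , sf
    where
    q≢0 : q ≢ 0
    q≢0 refl = n≢0 n≡q*m²
    q<n : q ℕ.< n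
    q<n = subst (q ℕ.<_) (sym n≡q*m²) (ℕ.m<m*n q (m ℕ.* m) {{ℕ.≢-nonZero q≢0}} (s≤s (s≤s z≤n)))
    part = rec q<n q≢0
    s = proj₁ part
    e = proj₁ (proj₂ part)
    q≡ = proj₁ (proj₂ (proj₂ part))
    sf = proj₂ (proj₂ (proj₂ part))
    eq : ∀ s m e → s ℕ.* s ℕ.* e ℕ.* (m ℕ.* m) ≡ s ℕ.* m ℕ.* (s ℕ.* m) ℕ.* e
    eq = ℕ-Solver.solve-∀

fromℤ-injective : ∀ {y z} → fromℤ y ≡ fromℤ z → y ≡ z
fromℤ-injective = cong ℚ.↥_

module _ (d : ℤ) where
  open Quadratic d using (IsInteger; fromℤ-*; fromℤ-clear)

  -- If q = a / b in lowest terms and d q² is an integer, then b² divides d.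
  squarefree⇒integer : Squarefree d → ∀ q → IsInteger (fromℤ d ⊛ (q ⊛ q)) → IsInteger q
  squarefree⇒integer d-sf q@(mkℚ a b-1 c) (z , dq²≡z) = q-int (d-sf b b²∣d)
    where
    b = suc b-1

    q-int : b ≡ 1 → IsInteger q
    q-int refl = a , refl

    da²≡zb² : d ℤ.* (a ℤ.* a) ≡ z ℤ.* (+ b ℤ.* + b)
    da²≡zb² = fromℤ-injective
      (trans (sym (trans (cong (fromℤ d ⊛_) (fromℤ-* a a)) (fromℤ-* d _)))
      (trans (cong (λ x → fromℤ d ⊛ (x ⊛ x)) (sym (fromℤ-clear q)))
      (trans (solve 3 (λ d b q → d :* ((b :* q) :* (b :* q)) := (d :* (q :* q)) :* (b :* b)) refl
               (fromℤ d) (fromℤ (+ b)) q)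
      (trans (cong (_⊛ (fromℤ (+ b) ⊛ fromℤ (+ b))) dq²≡z)
      (trans (cong (fromℤ z ⊛_) (fromℤ-* (+ b) (+ b))) (fromℤ-* z _))))))
      where open +-*-Solver

    coprime : Coprime b ℤ.∣ a ∣
    coprime = Coprimality.sym (Coprimality.recompute c)

    coprime² : Coprime (b ℕ.* b) ℤ.∣ a ∣
    coprime² {i} (i∣b² , i∣a) = coprime (i∣b , i∣a)
      where
      i∣b : i ∣ b
      i∣b = Coprimality.coprime-divisor
        (λ { (j∣i , j∣b) → coprime (j∣b , ∣-trans j∣i i∣a) }) i∣b²

    b²∣d : b ℕ.* b ∣ ℤ.∣ d ∣
    b²∣d = Coprimality.coprime-divisor coprime² (Coprimality.coprime-divisor coprime²
      (divides ℤ.∣ z ∣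
        (trans (abs₃ a a d) (trans (cong ℤ.∣_∣ (trans (rearrange a d) da²≡zb²))
        (ℤ.abs-* z (+ b ℤ.* + b))))))
      where
      abs₃ : ∀ x y z → ℤ.∣ x ∣ ℕ.* (ℤ.∣ y ∣ ℕ.* ℤ.∣ z ∣) ≡ ℤ.∣ x ℤ.* (y ℤ.* z) ∣
      abs₃ x y z = sym (trans (ℤ.abs-* x _) (cong (ℤ.∣ x ∣ ℕ.*_) (ℤ.abs-* y z)))
      rearrange : ∀ a d → a ℤ.* (a ℤ.* d) ≡ d ℤ.* (a ℤ.* a)
      rearrange = solve-∀

residue : ∀ z n .{{_ : NonZero n}} → ∃[ r ] ∃[ k ] r ℕ.< n × z ≡ + r ℤ.+ k ℤ.* + n
residue z n = z ℤ.%ℕ n , z ℤ./ℕ n , ℤ.n%ℕd<d z n , ℤ.a≡a%ℕn+[a/ℕn]*n z n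

-- z n = i + (x - y) with x = y forces n ∣ i.
congruent⇒∣ : ∀ {x y} n z i → x ≡ y → z ℤ.* + n ≡ i ℤ.+ (x ℤ.- y) → n ∣ ℤ.∣ i ∣
congruent⇒∣ {x} n z i refl eq = divides ℤ.∣ z ∣
  (trans (cong ℤ.∣_∣ (sym (trans eq (trans (cong (λ j → i ℤ.+ j) (ℤ.+-inverseʳ x)) (ℤ.+-identityʳ i)))))
    (ℤ.abs-* z (+ n)))

-- The hypotheses describe the trace T and norm M of the cube of an element with
-- trace X and norm N, and the proof runs through X and N modulo 2.
odd-trace-no-cube : ∀ X N {T M} t m →
  X ℤ.* X ℤ.* X ≡ T ℤ.+ + 3 ℤ.* (N ℤ.* X) → N ℤ.* N ℤ.* N ≡ M →
  M ≡ + 1 ℤ.+ m ℤ.* + 2 → T ≢ + 1 ℤ.+ t ℤ.* + 2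
odd-trace-no-cube X N t m cube norm refl refl with residue X 2 | residue N 2
... | suc (suc _) , _ , s≤s (s≤s ()) , _ | _
... | _ | suc (suc _) , _ , s≤s (s≤s ()) , _
... | _ | 0 , n , _ , refl = from-no (2 ∣? 1)
  (congruent⇒∣ 2 (+ 1 ℤ.+ m ℤ.- + 4 ℤ.* (n ℤ.* n ℤ.* n)) (+ 1) (sym norm) (eq n m))
  where
  eq : ∀ n m → (+ 1 ℤ.+ m ℤ.- + 4 ℤ.* (n ℤ.* n ℤ.* n)) ℤ.* + 2 ≡ + 1 ℤ.+ ((+ 1 ℤ.+ m ℤ.* + 2) ℤ.-
    ((+ 0 ℤ.+ n ℤ.* + 2) ℤ.* (+ 0 ℤ.+ n ℤ.* + 2) ℤ.* (+ 0 ℤ.+ n ℤ.* + 2)))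
  eq = solve-∀
... | 0 , x , _ , refl | 1 , n , _ , refl = from-no (2 ∣? 1)
  (congruent⇒∣ 2 (+ 4 ℤ.* (x ℤ.* x ℤ.* x) ℤ.- t ℤ.- + 3 ℤ.* ((+ 1 ℤ.+ n ℤ.* + 2) ℤ.* x))
    (+ 1) cube (eq x n t))
  where
  eq : ∀ x n t →
    (+ 4 ℤ.* (x ℤ.* x ℤ.* x) ℤ.- t ℤ.- + 3 ℤ.* ((+ 1 ℤ.+ n ℤ.* + 2) ℤ.* x)) ℤ.* + 2 ≡ + 1 ℤ.+
    ((+ 0 ℤ.+ x ℤ.* + 2) ℤ.* (+ 0 ℤ.+ x ℤ.* + 2) ℤ.* (+ 0 ℤ.+ x ℤ.* + 2) ℤ.-
    ((+ 1 ℤ.+ t ℤ.* + 2) ℤ.+ + 3 ℤ.* ((+ 1 ℤ.+ n ℤ.* + 2) ℤ.* (+ 0 ℤ.+ x ℤ.* + 2))))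
  eq = solve-∀
... | 1 , x , _ , refl | 1 , n , _ , refl = from-no (2 ∣? 1)
  (congruent⇒∣ 2 (+ 4 ℤ.* (x ℤ.* x ℤ.* x) ℤ.+ + 6 ℤ.* (x ℤ.* x) ℤ.- t ℤ.- + 3 ℤ.* n
    ℤ.- + 6 ℤ.* (n ℤ.* x) ℤ.- + 1) (+ 1) cube (eq x n t))
  where
  eq : ∀ x n t →
    (+ 4 ℤ.* (x ℤ.* x ℤ.* x) ℤ.+ + 6 ℤ.* (x ℤ.* x) ℤ.- t ℤ.- + 3 ℤ.* n
      ℤ.- + 6 ℤ.* (n ℤ.* x) ℤ.- + 1) ℤ.* + 2 ≡ + 1 ℤ.+
    ((+ 1 ℤ.+ x ℤ.* + 2) ℤ.* (+ 1 ℤ.+ x ℤ.* + 2) ℤ.* (+ 1 ℤ.+ x ℤ.* + 2) ℤ.-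
    ((+ 1 ℤ.+ t ℤ.* + 2) ℤ.+ + 3 ℤ.* ((+ 1 ℤ.+ n ℤ.* + 2) ℤ.* (+ 1 ℤ.+ x ℤ.* + 2))))
  eq = solve-∀

-- Here 3 divides M = N³, hence N, so that T is X³ modulo 9, and the cubes modulo
-- 9 are 0, 1 and 8.
trace-2-mod-9-no-cube : ∀ X N {T M} t m →
  X ℤ.* X ℤ.* X ≡ T ℤ.+ + 3 ℤ.* (N ℤ.* X) → N ℤ.* N ℤ.* N ≡ M →
  M ≡ m ℤ.* + 3 → T ≢ + 2 ℤ.+ t ℤ.* + 9
trace-2-mod-9-no-cube X N t m cube norm refl refl with residue N 3
... | suc (suc (suc _)) , _ , s≤s (s≤s (s≤s ())) , _
... | 1 , n , _ , refl = from-no (3 ∣? 1) (congruent⇒∣ 3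
  (m ℤ.- n ℤ.* (+ 9 ℤ.* (n ℤ.* n) ℤ.+ + 9 ℤ.* n ℤ.+ + 3)) (+ 1) (sym norm) (eq n m))
  where
  eq : ∀ n m → (m ℤ.- n ℤ.* (+ 9 ℤ.* (n ℤ.* n) ℤ.+ + 9 ℤ.* n ℤ.+ + 3)) ℤ.* + 3 ≡
    + 1 ℤ.+ (m ℤ.* + 3 ℤ.-
    (+ 1 ℤ.+ n ℤ.* + 3) ℤ.* (+ 1 ℤ.+ n ℤ.* + 3) ℤ.* (+ 1 ℤ.+ n ℤ.* + 3))
  eq = solve-∀
... | 2 , n , _ , refl = from-no (3 ∣? 8) (congruent⇒∣ 3
  (m ℤ.- n ℤ.* (+ 9 ℤ.* (n ℤ.* n) ℤ.+ + 18 ℤ.* n ℤ.+ + 12)) (+ 8) (sym norm) (eq n m))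
  where
  eq : ∀ n m → (m ℤ.- n ℤ.* (+ 9 ℤ.* (n ℤ.* n) ℤ.+ + 18 ℤ.* n ℤ.+ + 12)) ℤ.* + 3 ≡
    + 8 ℤ.+ (m ℤ.* + 3 ℤ.-
    (+ 2 ℤ.+ n ℤ.* + 3) ℤ.* (+ 2 ℤ.+ n ℤ.* + 3) ℤ.* (+ 2 ℤ.+ n ℤ.* + 3))
  eq = solve-∀
... | 0 , n , _ , refl with residue X 3
...   | r , x , r<3 , refl = not-cube r r<3 (congruent⇒∣ 9
  (+ 3 ℤ.* (x ℤ.* x ℤ.* x) ℤ.+ + 3 ℤ.* (x ℤ.* x) ℤ.* + r ℤ.+ x ℤ.* (+ r ℤ.* + r)
    ℤ.- t ℤ.- n ℤ.* (+ r ℤ.+ x ℤ.* + 3))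
  (+ 2 ℤ.- + r ℤ.* + r ℤ.* + r) cube (eq (+ r) x n t))
  where
  not-cube : ∀ r → r ℕ.< 3 → ¬ (9 ∣ ℤ.∣ + 2 ℤ.- + r ℤ.* + r ℤ.* + r ∣)
  not-cube 0 _ = from-no (9 ∣? 2)
  not-cube 1 _ = from-no (9 ∣? 1)
  not-cube 2 _ = from-no (9 ∣? 6)
  not-cube (suc (suc (suc _))) (s≤s (s≤s (s≤s ())))
  eq : ∀ r x n t →
    (+ 3 ℤ.* (x ℤ.* x ℤ.* x) ℤ.+ + 3 ℤ.* (x ℤ.* x) ℤ.* r ℤ.+ x ℤ.* (r ℤ.* r)
      ℤ.- t ℤ.- n ℤ.* (r ℤ.+ x ℤ.* + 3)) ℤ.* + 9 ≡
    (+ 2 ℤ.- r ℤ.* r ℤ.* r) ℤ.+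
    ((r ℤ.+ x ℤ.* + 3) ℤ.* (r ℤ.+ x ℤ.* + 3) ℤ.* (r ℤ.+ x ℤ.* + 3) ℤ.-
    ((+ 2 ℤ.+ t ℤ.* + 9) ℤ.+ + 3 ℤ.* ((+ 0 ℤ.+ n ℤ.* + 3) ℤ.* (r ℤ.+ x ℤ.* + 3))))
  eq = solve-∀

------------------------------------------------------------------------
-- Cubes and units in a quadratic ring

-- z has trace t and norm n.
record TraceNorm {K : Set} (_+_ _*_ : K → K → K) (ι : ℤ → K) (conjugate : K → K)
  (z : K) (t n : ℤ) : Set where
  constructor traceNorm
  field
    trace≡ : z + conjugate z ≡ ι t
    norm≡  : z * conjugate z ≡ ι n

open TraceNorm

-- The structure of a quadratic field and its algebraic integers that the study of
-- cubes and units relies on: a commutative ring containing the integers, with a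
-- conjugation, in which the integral elements are those whose trace and norm are
-- integers.
record QuadraticRing : Set₁ where
  infixl 6 _+_
  infixl 7 _*_
  infix  8 -_
  field
    K       : Set
    _+_ _*_ : K → K → K
    -_      : K → K
    ι       : ℤ → K
    isCommutativeRing : IsCommutativeRing _≡_ _+_ _*_ -_ (ι 0ℤ) (ι 1ℤ)
    ι-+     : ∀ y z → ι (y ℤ.+ z) ≡ ι y + ι z
    ι-*     : ∀ y z → ι (y ℤ.* z) ≡ ι y * ι z
    ι--     : ∀ z → ι (ℤ.- z) ≡ - ι z
    ι-injective : ∀ {y z} → ι y ≡ ι z → y ≡ z
    conjugate   : K → K
    conjugate-+ : ∀ x y → conjugate (x + y) ≡ conjugate x + conjugate y
    conjugate-* : ∀ x y → conjugate (x * y) ≡ conjugate x * conjugate y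
    conjugate-ι : ∀ z → conjugate (ι z) ≡ ι z
    conjugate-involutive : ∀ x → conjugate (conjugate x) ≡ x

  HasTraceNorm : K → ℤ → ℤ → Set
  HasTraceNorm = TraceNorm _+_ _*_ ι conjugate

  field
    IsIntegral : Pred K 0ℓ
    integral-* : ∀ {x y} → IsIntegral x → IsIntegral y → IsIntegral (x * y)
    integral⇒traceNorm : ∀ {z} → IsIntegral z → ∃[ t ] ∃[ n ] HasTraceNorm z t n
    traceNorm⇒integral : ∀ {z t n} → HasTraceNorm z t n → IsIntegral z

module CubesAndUnits (𝒦 : QuadraticRing) where
  open QuadraticRing 𝒦

  ring : CommutativeRing 0ℓ 0ℓ
  ring = record { isCommutativeRing = isCommutativeRing }

  open CommutativeRing ring
    using (commutativeSemiring; +-comm; *-comm; *-identityˡ; *-identityʳ)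

  private
    integerCoefficients :
      CommutativeRing.rawRing ℤ.+-*-commutativeRing -Raw-AlmostCommutative⟶ fromCommutativeRing ring
    integerCoefficients = record
      { ⟦_⟧ = ι ; +-homo = ι-+ ; *-homo = ι-* ; -‿homo = ι-- ; 0-homo = refl ; 1-homo = refl }

    coefficient≟ : ∀ y z → Maybe (ι y ≡ ι z)
    coefficient≟ y z = Maybe.map (cong ι) (dec⇒maybe (y ℤ.≟ z))

  -- A ring solver over K whose coefficients are integers, embedded by ι.
  open RingSolver (CommutativeRing.rawRing ℤ.+-*-commutativeRing) (fromCommutativeRing ring)
    integerCoefficients coefficient≟
    using (solve; con; _:+_; _:*_; :-_; _:=_)
  open Exponentiation commutativeSemiring using (_^_; ^-homo-*; ^-assocʳ; ^-distrib-*)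

  traceNorm-conjugate : ∀ {z t n} → HasTraceNorm z t n → HasTraceNorm (conjugate z) t n
  traceNorm-conjugate {z} (traceNorm tr nm) = traceNorm
    (trans (cong (λ w → conjugate z + w) (conjugate-involutive z)) (trans (+-comm _ z) tr))
    (trans (cong (conjugate z *_) (conjugate-involutive z)) (trans (*-comm _ z) nm))

  integral-conjugate : ∀ {z} → IsIntegral z → IsIntegral (conjugate z)
  integral-conjugate z-int = let (_ , _ , tn) = integral⇒traceNorm z-int in
    traceNorm⇒integral (traceNorm-conjugate tn)

  norm : K → K
  norm z = z * conjugate z

  norm-* : ∀ x y → norm (x * y) ≡ norm x * norm y
  norm-* x y = trans (cong ((x * y) *_) (conjugate-* x y))
    (solve 4 (λ x y x′ y′ → (x :* y) :* (x′ :* y′) := (x :* x′) :* (y :* y′)) refl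
      x y (conjugate x) (conjugate y))

  norm-conjugate : ∀ x → norm (conjugate x) ≡ norm x
  norm-conjugate x = trans (cong (conjugate x *_) (conjugate-involutive x)) (*-comm (conjugate x) x)

  infixr 9 _³
  _³ : K → K
  z ³ = z * (z * z)

  conjugate-³ : ∀ z → conjugate (z ³) ≡ conjugate z ³
  conjugate-³ z = trans (conjugate-* z (z * z)) (cong (conjugate z *_) (conjugate-* z z))

  *-³ : ∀ x y → (x * y) ³ ≡ x ³ * y ³
  *-³ = solve 2 (λ x y → (x :* y) :* ((x :* y) :* (x :* y)) := (x :* (x :* x)) :* (y :* (y :* y))) refl

  traceNorm-³ : ∀ {γ X N T M} → HasTraceNorm γ X N → HasTraceNorm (γ ³) T M →
    X ℤ.* X ℤ.* X ≡ T ℤ.+ + 3 ℤ.* (N ℤ.* X) × N ℤ.* N ℤ.* N ≡ M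
  traceNorm-³ {γ} {X} {N} {T} {M} (traceNorm tr nm) (traceNorm tr³ nm³) =
    ι-injective
      (trans (trans (ι-* (X ℤ.* X) X) (cong (_* ι X) (ι-* X X)))
      (trans (cong₂ _*_ (cong₂ _*_ (sym tr) (sym tr)) (sym tr))
      (trans (solve 2 (λ g h → (g :+ h) :* (g :+ h) :* (g :+ h) :=
                 (g :* (g :* g) :+ h :* (h :* h)) :+ con (+ 3) :* ((g :* h) :* (g :+ h))) refl
               γ γ̄)
      (trans (cong₂ _+_ (trans (cong (λ w → γ ³ + w) (sym (conjugate-³ γ))) tr³)
               (cong (ι (+ 3) *_) (trans (cong₂ _*_ nm tr) (sym (ι-* N X)))))
      (sym (trans (ι-+ T _) (cong (λ w → ι T + w) (ι-* (+ 3) (N ℤ.* X))))))))) ,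
    ι-injective
      (trans (trans (ι-* (N ℤ.* N) N) (cong (_* ι N) (ι-* N N)))
      (trans (cong₂ _*_ (cong₂ _*_ (sym nm) (sym nm)) (sym nm))
      (trans (solve 2 (λ g h → (g :* h) :* (g :* h) :* (g :* h) :=
                 (g :* (g :* g)) :* (h :* (h :* h))) refl γ γ̄)
      (trans (cong (γ ³ *_) (sym (conjugate-³ γ))) nm³))))
    where
    γ̄ = conjugate γ

  -- z is the cube of an integral element.
  IsCube : K → Set
  IsCube z = ∃[ γ ] IsIntegral γ × z ≡ γ ³

  odd-trace⇒¬cube : ∀ {z T M} t m → HasTraceNorm z T M →
    M ≡ + 1 ℤ.+ m ℤ.* + 2 → T ≡ + 1 ℤ.+ t ℤ.* + 2 → ¬ IsCube z
  odd-trace⇒¬cube t m tn M-odd T-odd (γ , γ-int , refl) =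
    let (X , N , tnγ) = integral⇒traceNorm γ-int
        (cube , nrm) = traceNorm-³ tnγ tn
    in odd-trace-no-cube X N t m cube nrm M-odd T-odd

  trace-2-mod-9⇒¬cube : ∀ {z T M} t m → HasTraceNorm z T M →
    M ≡ m ℤ.* + 3 → T ≡ + 2 ℤ.+ t ℤ.* + 9 → ¬ IsCube z
  trace-2-mod-9⇒¬cube t m tn M≡ T≡ (γ , γ-int , refl) =
    let (X , N , tnγ) = integral⇒traceNorm γ-int
        (cube , nrm) = traceNorm-³ tnγ tn
    in trace-2-mod-9-no-cube X N t m cube nrm M≡ T≡

  unit⇒norm±1 : ∀ {x y} → IsIntegral x → IsIntegral y → x * y ≡ ι 1ℤ →
    norm x ≡ ι 1ℤ ⊎ norm x ≡ ι -1ℤ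
  unit⇒norm±1 {x} {y} x-int y-int xy≡1 with integral⇒traceNorm x-int | integral⇒traceNorm y-int
  ... | _ , m , tnx | _ , n , tny = go m (ℕ.m*n≡1⇒m≡1 ℤ.∣ m ∣ ℤ.∣ n ∣
      (trans (sym (ℤ.abs-* m n)) (cong ℤ.∣_∣ mn≡1))) (norm≡ tnx)
    where
    mn≡1 : m ℤ.* n ≡ 1ℤ
    mn≡1 = ι-injective (trans (ι-* m n) (trans (sym (cong₂ _*_ (norm≡ tnx) (norm≡ tny)))
      (trans (sym (norm-* x y)) (trans (cong norm xy≡1)
        (trans (*-identityˡ _) (conjugate-ι 1ℤ))))))
    go : ∀ m → ℤ.∣ m ∣ ≡ 1 → norm x ≡ ι m → norm x ≡ ι 1ℤ ⊎ norm x ≡ ι -1ℤ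
    go (+ 1) refl nm = inj₁ nm
    go -[1+ 0 ] refl nm = inj₂ nm

  integral-^ : ∀ {x} → IsIntegral x → ∀ n → IsIntegral (x ^ n)
  integral-^ x-int zero    = traceNorm⇒integral
    (traceNorm {t = + 2} {n = 1ℤ}
      (trans (cong (λ w → ι 1ℤ + w) (conjugate-ι 1ℤ)) (sym (ι-+ 1ℤ 1ℤ)))
      (trans (cong (λ w → ι 1ℤ * w) (conjugate-ι 1ℤ)) (*-identityˡ _)))
  integral-^ x-int (suc n) = integral-* x-int (integral-^ x-int n)

  -- The norm is 1 or -1, as it is for every unit (unit⇒normSquare1).
  NormSquare1 : K → Set
  NormSquare1 x = norm x * norm x ≡ ι 1ℤ

  unit⇒normSquare1 : ∀ {x y} → IsIntegral x → IsIntegral y → x * y ≡ ι 1ℤ → NormSquare1 x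
  unit⇒normSquare1 x-int y-int xy≡1 with unit⇒norm±1 x-int y-int xy≡1
  ... | inj₁ eq = trans (cong₂ _*_ eq eq) (sym (ι-* 1ℤ 1ℤ))
  ... | inj₂ eq = trans (cong₂ _*_ eq eq) (sym (ι-* -1ℤ -1ℤ))

  normSquare1-* : ∀ {x y} → NormSquare1 x → NormSquare1 y → NormSquare1 (x * y)
  normSquare1-* {x} {y} p q = trans (cong₂ _*_ (norm-* x y) (norm-* x y))
    (trans (solve 2 (λ m n → (m :* n) :* (m :* n) := (m :* m) :* (n :* n)) refl (norm x) (norm y))
    (trans (cong₂ _*_ p q) (*-identityˡ _)))

  normSquare1-^ : ∀ {x} → NormSquare1 x → ∀ n → NormSquare1 (x ^ n)
  normSquare1-^ p zero    = trans (cong (λ n → (ι 1ℤ * n) * (ι 1ℤ * n)) (conjugate-ι 1ℤ))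
    (solve 0 ((con 1ℤ :* con 1ℤ) :* (con 1ℤ :* con 1ℤ) := con 1ℤ) refl)
  normSquare1-^ {x} p (suc n) = normSquare1-* {x} p (normSquare1-^ p n)

  -- If z² = γ³ then z = z³ z̄² = (z γ̄)³.
  square-cube⇒cube : ∀ {z} → IsIntegral z → NormSquare1 z → IsCube (z * z) → IsCube z
  square-cube⇒cube {z} z-int z-unit (γ , γ-int , z²≡γ³) =
    z * conjugate γ , integral-* z-int (integral-conjugate γ-int) ,
    sym (trans (*-³ z (conjugate γ))
      (trans (cong (z ³ *_) (trans (sym (conjugate-³ γ)) (trans (cong conjugate (sym z²≡γ³)) (conjugate-* z z))))
      (trans (solve 2 (λ z z̄ → (z :* (z :* z)) :* (z̄ :* z̄) := z :* ((z :* z̄) :* (z :* z̄))) refl z (conjugate z))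
      (trans (cong (z *_) z-unit) (*-identityʳ z)))))

  ^-3 : ∀ z → z ^ 3 ≡ z ³
  ^-3 z = cong (λ w → z * (z * w)) (*-identityʳ z)

  ^-*3 : ∀ w n → w ^ (n ℕ.* 3) ≡ (w ^ n) ³
  ^-*3 w n = trans (sym (^-assocʳ w n 3)) (^-3 (w ^ n))

  conjugate-^ : ∀ x n → conjugate (x ^ n) ≡ conjugate x ^ n
  conjugate-^ x zero    = conjugate-ι 1ℤ
  conjugate-^ x (suc n) = trans (conjugate-* x _) (cong (conjugate x *_) (conjugate-^ x n))

  -- η = (η³)³ as η⁴ = (η η̄)² = 1.
  -- A rational unit is ±1, hence a cube.
  unit-cube : ∀ {η β} → IsIntegral η → NormSquare1 η → conjugate η ≡ η → IsIntegral β → IsCube (η * β ³)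
  unit-cube {η} {β} η-int η-unit η̄≡η β-int =
    η ³ * β , integral-* (integral-* η-int (integral-* η-int η-int)) β-int ,
    trans (cong (_* β ³) (sym η⁹≡η)) (sym (*-³ (η ³) β))
    where
    η⁴≡1 : (η * η) * (η * η) ≡ ι 1ℤ
    η⁴≡1 = trans (sym (cong (λ x → (η * x) * (η * x)) η̄≡η)) η-unit
    η⁹≡η : (η ³) ³ ≡ η
    η⁹≡η = trans (solve 1 (λ η → (η :* (η :* η)) :* ((η :* (η :* η)) :* (η :* (η :* η))) :=
        (((η :* η) :* (η :* η)) :* ((η :* η) :* (η :* η))) :* η) refl η)
      (trans (cong (_* η) (trans (cong₂ _*_ η⁴≡1 η⁴≡1) (*-identityˡ _))) (*-identityˡ η))

  -- The element ε has norm -1 and trace A = n³, where n is an odd multiple of 3.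
  -- The only facts needed on A are its residues modulo 2 and modulo 9.
  module GeneratorModuloCubes {ε A} (ε-tn : HasTraceNorm ε A -1ℤ) (a c : ℤ)
    (A-odd : A ≡ + 1 ℤ.+ a ℤ.* + 2) (9∣A : A ≡ c ℤ.* + 9) where
    private
      ε̄ = conjugate ε

      plus : ∀ {x y m n} → x ≡ ι m → y ≡ ι n → x + y ≡ ι (m ℤ.+ n)
      plus {m = m} {n} p q = trans (cong₂ _+_ p q) (sym (ι-+ m n))
      times : ∀ {x y m n} → x ≡ ι m → y ≡ ι n → x * y ≡ ι (m ℤ.* n)
      times {m = m} {n} p q = trans (cong₂ _*_ p q) (sym (ι-* m n))
      minus : ∀ {x m} → x ≡ ι m → - x ≡ ι (ℤ.- m)
      minus {m = m} p = trans (cong -_ p) (sym (ι-- m))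

      s≡ : ε + ε̄ ≡ ι A
      s≡ = trace≡ ε-tn
      n≡ : ε * ε̄ ≡ ι -1ℤ
      n≡ = norm≡ ε-tn

    ε-1 : K
    ε-1 = ε + ι -1ℤ

    private
      conjugate-ε-1 : conjugate ε-1 ≡ ε̄ + ι -1ℤ
      conjugate-ε-1 = trans (conjugate-+ ε (ι -1ℤ)) (cong (λ w → ε̄ + w) (conjugate-ι -1ℤ))

    ε-1-traceNorm : HasTraceNorm ε-1 (A ℤ.+ -[1+ 1 ]) (ℤ.- A)
    ε-1-traceNorm = traceNorm
      (trans (cong (λ w → ε-1 + w) conjugate-ε-1)
      (trans (solve 2 (λ e f → (e :+ con -1ℤ) :+ (f :+ con -1ℤ) := (e :+ f) :+ con -[1+ 1 ]) refl ε ε̄)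
        (plus s≡ refl)))
      (trans (cong (ε-1 *_) conjugate-ε-1)
      (trans (solve 2 (λ e f → (e :+ con -1ℤ) :* (f :+ con -1ℤ) := (e :* f :+ con 1ℤ) :+ (:- (e :+ f))) refl ε ε̄)
      (trans (plus {m = 0ℤ} (plus n≡ refl) (minus s≡)) (cong ι (ℤ.+-identityˡ (ℤ.- A))))))

    [ε-1]ε-traceNorm : HasTraceNorm (ε-1 * ε) ((A ℤ.* A ℤ.+ + 2) ℤ.+ ℤ.- A) ((ℤ.- A) ℤ.* -1ℤ)
    [ε-1]ε-traceNorm = traceNorm
      (trans (cong (λ w → ε-1 * ε + w) (trans (conjugate-* ε-1 ε) (cong (_* ε̄) conjugate-ε-1)))
      (trans (solve 2 (λ e f → (e :+ con -1ℤ) :* e :+ (f :+ con -1ℤ) :* f :=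
                ((e :+ f) :* (e :+ f) :+ con -[1+ 1 ] :* (e :* f)) :+ (:- (e :+ f))) refl ε ε̄)
        (plus (plus (times s≡ s≡) (times refl n≡)) (minus s≡))))
      (trans (norm-* ε-1 ε) (times (norm≡ ε-1-traceNorm) n≡))

    [ε-1]ε²-traceNorm : HasTraceNorm (ε-1 * (ε * ε))
      (((A ℤ.* A ℤ.* A ℤ.+ + 3 ℤ.* A) ℤ.+ ℤ.- (A ℤ.* A)) ℤ.+ -[1+ 1 ]) ((ℤ.- A) ℤ.* + 1)
    [ε-1]ε²-traceNorm = traceNorm
      (trans (cong (λ w → ε-1 * (ε * ε) + w)
        (trans (conjugate-* ε-1 (ε * ε)) (cong₂ _*_ conjugate-ε-1 (conjugate-* ε ε))))
      (trans (solve 2 (λ e f → (e :+ con -1ℤ) :* (e :* e) :+ (f :+ con -1ℤ) :* (f :* f) :=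
                (((e :+ f) :* (e :+ f) :* (e :+ f) :+ (con -[1+ 2 ] :* (e :* f)) :* (e :+ f)) :+
                  (:- ((e :+ f) :* (e :+ f)))) :+ con (+ 2) :* (e :* f)) refl ε ε̄)
        (plus (plus (plus (times (times s≡ s≡) s≡) (times (times refl n≡) s≡)) (minus (times s≡ s≡)))
          (times refl n≡))))
      (trans (norm-* ε-1 (ε * ε)) (times (norm≡ ε-1-traceNorm) (trans (norm-* ε ε) (times n≡ n≡))))

    ε²-traceNorm : HasTraceNorm (ε * ε) (A ℤ.* A ℤ.+ + 2) 1ℤ
    ε²-traceNorm = traceNorm
      (trans (cong (λ w → ε * ε + w) (conjugate-* ε ε))
      (trans (solve 2 (λ e f → e :* e :+ f :* f := (e :+ f) :* (e :+ f) :+ con -[1+ 1 ] :* (e :* f)) refl ε ε̄)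
        (plus (times s≡ s≡) (times refl n≡))))
      (trans (norm-* ε ε) (times n≡ n≡))

    ε²-not-cube : ¬ IsCube (ε * ε)
    ε²-not-cube = odd-trace⇒¬cube (+ 2 ℤ.* a ℤ.+ + 2 ℤ.* (a ℤ.* a) ℤ.+ + 1) 0ℤ ε²-traceNorm refl
      (trans (cong (λ A → A ℤ.* A ℤ.+ + 2) A-odd) (eq a))
      where
      eq : ∀ a → (+ 1 ℤ.+ a ℤ.* + 2) ℤ.* (+ 1 ℤ.+ a ℤ.* + 2) ℤ.+ + 2 ≡
        + 1 ℤ.+ (+ 2 ℤ.* a ℤ.+ + 2 ℤ.* (a ℤ.* a) ℤ.+ + 1) ℤ.* + 2
      eq = solve-∀

    -- The exponents j = 0 and j = 2 are excluded by parity, j = 1 modulo 9.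
    not-cube : ∀ j → ¬ IsCube (ε-1 * ε ^ j)
    not-cube 0 cube = odd-trace⇒¬cube (a ℤ.- + 1) (ℤ.- (+ 1) ℤ.- a) ε-1-traceNorm
      (trans (cong ℤ.-_ A-odd) (eqN a)) (trans (cong (ℤ._+ -[1+ 1 ]) A-odd) (eqT a))
      (subst IsCube (*-identityʳ ε-1) cube)
      where
      eqN : ∀ a → ℤ.- (+ 1 ℤ.+ a ℤ.* + 2) ≡ + 1 ℤ.+ (ℤ.- (+ 1) ℤ.- a) ℤ.* + 2
      eqN = solve-∀
      eqT : ∀ a → (+ 1 ℤ.+ a ℤ.* + 2) ℤ.+ -[1+ 1 ] ≡ + 1 ℤ.+ (a ℤ.- + 1) ℤ.* + 2
      eqT = solve-∀
    not-cube 1 cube = trace-2-mod-9⇒¬cube (+ 9 ℤ.* (c ℤ.* c) ℤ.- c) (+ 3 ℤ.* c) [ε-1]ε-traceNorm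
      (trans (cong (λ A → (ℤ.- A) ℤ.* -1ℤ) 9∣A) (eqN c))
      (trans (cong (λ A → (A ℤ.* A ℤ.+ + 2) ℤ.+ ℤ.- A) 9∣A) (eqT c))
      (subst IsCube (cong (ε-1 *_) (*-identityʳ ε)) cube)
      where
      eqN : ∀ c → (ℤ.- (c ℤ.* + 9)) ℤ.* -1ℤ ≡ (+ 3 ℤ.* c) ℤ.* + 3
      eqN = solve-∀
      eqT : ∀ c → ((c ℤ.* + 9) ℤ.* (c ℤ.* + 9) ℤ.+ + 2) ℤ.+ ℤ.- (c ℤ.* + 9) ≡
        + 2 ℤ.+ (+ 9 ℤ.* (c ℤ.* c) ℤ.- c) ℤ.* + 9
      eqT = solve-∀
    not-cube 2 cube = odd-trace⇒¬cube
      (+ 4 ℤ.* a ℤ.+ + 4 ℤ.* (a ℤ.* a) ℤ.+ + 4 ℤ.* (a ℤ.* a ℤ.* a)) (ℤ.- (+ 1) ℤ.- a) [ε-1]ε²-traceNorm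
      (trans (cong (λ A → (ℤ.- A) ℤ.* + 1) A-odd) (eqN a))
      (trans (cong (λ A → ((A ℤ.* A ℤ.* A ℤ.+ + 3 ℤ.* A) ℤ.+ ℤ.- (A ℤ.* A)) ℤ.+ -[1+ 1 ]) A-odd) (eqT a))
      (subst IsCube (cong (λ x → ε-1 * (ε * x)) (*-identityʳ ε)) cube)
      where
      eqN : ∀ a → (ℤ.- (+ 1 ℤ.+ a ℤ.* + 2)) ℤ.* + 1 ≡ + 1 ℤ.+ (ℤ.- (+ 1) ℤ.- a) ℤ.* + 2
      eqN = solve-∀
      eqT : ∀ a → (((+ 1 ℤ.+ a ℤ.* + 2) ℤ.* (+ 1 ℤ.+ a ℤ.* + 2) ℤ.* (+ 1 ℤ.+ a ℤ.* + 2) ℤ.+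
          + 3 ℤ.* (+ 1 ℤ.+ a ℤ.* + 2)) ℤ.+
          ℤ.- ((+ 1 ℤ.+ a ℤ.* + 2) ℤ.* (+ 1 ℤ.+ a ℤ.* + 2))) ℤ.+ -[1+ 1 ] ≡
        + 1 ℤ.+ (+ 4 ℤ.* a ℤ.+ + 4 ℤ.* (a ℤ.* a) ℤ.+ + 4 ℤ.* (a ℤ.* a ℤ.* a)) ℤ.* + 2
      eqT = solve-∀
    -- ε³ is the cube of a unit with inverse -ε̄.
    not-cube (suc (suc (suc j))) (γ , γ-int , eq) = not-cube j
      ( γ * (ι -1ℤ * ε̄)
      , integral-* γ-int (traceNorm⇒integral -ε̄-traceNorm)
      , sym (trans (*-³ γ (ι -1ℤ * ε̄)) (trans (cong (_* (ι -1ℤ * ε̄) ³) (sym eq))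
          (trans (solve 4 (λ α e f x → (α :* (e :* (e :* (e :* x)))) :*
              ((con -1ℤ :* f) :* ((con -1ℤ :* f) :* (con -1ℤ :* f))) :=
              (α :* x) :* ((con -1ℤ :* (e :* f)) :* ((con -1ℤ :* (e :* f)) :* (con -1ℤ :* (e :* f)))))
              refl ε-1 ε ε̄ (ε ^ j))
          (trans (cong (λ y → (ε-1 * ε ^ j) * y) (times -n≡1 (times -n≡1 -n≡1))) (*-identityʳ _))))) )
      where
      -n≡1 : ι -1ℤ * (ε * ε̄) ≡ ι 1ℤ
      -n≡1 = times refl n≡
      -ε̄-traceNorm : HasTraceNorm (ι -1ℤ * ε̄) (ℤ.- A) -1ℤ
      -ε̄-traceNorm = traceNorm
        (trans (cong (λ w → ι -1ℤ * ε̄ + w) conj) (trans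
          (solve 2 (λ e f → con -1ℤ :* f :+ con -1ℤ :* e := :- (e :+ f)) refl ε ε̄) (minus s≡)))
        (trans (cong ((ι -1ℤ * ε̄) *_) conj) (trans
          (solve 2 (λ e f → (con -1ℤ :* f) :* (con -1ℤ :* e) := e :* f) refl ε ε̄) n≡))
        where
        conj : conjugate (ι -1ℤ * ε̄) ≡ ι -1ℤ * ε
        conj = trans (conjugate-* (ι -1ℤ) ε̄) (cong₂ _*_ (conjugate-ι -1ℤ) (conjugate-involutive ε))

    -- If every unit η becomes a cube after multiplication by a power of ε, then
    -- ε - 1 is not a unit times a cube.
    ε-1≢unit*cube :
      (∀ {η} → IsIntegral η → NormSquare1 η → ∃[ j ] IsCube (η * ε ^ j)) →
      ∀ {β η η′} → IsIntegral β → IsIntegral η → IsIntegral η′ → η * η′ ≡ ι 1ℤ → ε-1 ≢ η * β ³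
    ε-1≢unit*cube modulo-cubes {β} {η} β-int η-int η′-int ηη′≡1 eq
      with modulo-cubes η-int (unit⇒normSquare1 η-int η′-int ηη′≡1)
    ... | j , γ , γ-int , ηεʲ≡ = not-cube j
      ( γ * β , integral-* γ-int β-int
      , trans (cong (_* ε ^ j) eq)
        (trans (solve 3 (λ η b x → (η :* b) :* x := (η :* x) :* b) refl η (β ³) (ε ^ j))
        (trans (cong (_* β ³) ηεʲ≡) (sym (*-³ γ β)))) )

    ε-normSquare1 : NormSquare1 ε
    ε-normSquare1 = times n≡ n≡

  -- The group of units of norm 1, for a real field. In the application, Positive u
  -- says that u is a unit of norm 1 with u ≥ 1, and size u is its trace. The
  -- quotient of the larger by the smaller of two such units is u v̄ or v ū, and it
  -- is smaller than the unit divided (compare).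
  module Units
    (Positive : Pred K 0ℓ) (size : K → ℕ)
    (positive⇒integral : ∀ {u} → Positive u → IsIntegral u)
    (positive⇒norm1    : ∀ {u} → Positive u → norm u ≡ ι 1ℤ)
    (is-1?   : ∀ {u} → Positive u → Dec (u ≡ ι 1ℤ))
    (compare : ∀ {u v} → Positive u → Positive v → u ≢ ι 1ℤ → v ≢ ι 1ℤ →
      (Positive (u * conjugate v) × size (u * conjugate v) ℕ.< size u) ⊎
      (Positive (v * conjugate u) × size (v * conjugate u) ℕ.< size v))
    (positive-square : ∀ {z} → IsIntegral z → NormSquare1 z → Positive (z * z) ⊎ Positive (conjugate (z * z)))
    where

    -- The Euclidean algorithm: the subgroup generated by two units is cyclic.
    generator : ∀ {u v} → Positive u → Positive v →
      ∃[ w ] ∃[ a ] ∃[ b ] IsIntegral w × u ≡ w ^ a × v ≡ w ^ b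
    generator u⁺ v⁺ = go u⁺ v⁺ (<-wellFounded _)
      where
      restore : ∀ {u v w} a b → norm v ≡ ι 1ℤ → u * conjugate v ≡ w ^ a → v ≡ w ^ b → u ≡ w ^ (a ℕ.+ b)
      restore {u} {v} {w} a b nv uv̄ v≡ = sym (trans (^-homo-* w a b)
        (trans (cong₂ _*_ (sym uv̄) (sym v≡))
        (trans (solve 3 (λ u v v̄ → (u :* v̄) :* v := u :* (v :* v̄)) refl u v (conjugate v))
        (trans (cong (u *_) nv) (*-identityʳ u)))))

      go : ∀ {u v} → Positive u → Positive v → Acc ℕ._<_ (size u ℕ.+ size v) →
        ∃[ w ] ∃[ a ] ∃[ b ] IsIntegral w × u ≡ w ^ a × v ≡ w ^ b
      go {u} {v} u⁺ v⁺ (acc rec) with is-1? u⁺ | is-1? v⁺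
      ... | yes u≡1 | _ = v , 0 , 1 , positive⇒integral v⁺ , u≡1 , sym (*-identityʳ v)
      ... | no _ | yes v≡1 = u , 1 , 0 , positive⇒integral u⁺ , sym (*-identityʳ u) , v≡1
      ... | no u≢1 | no v≢1 with compare u⁺ v⁺ u≢1 v≢1
      ...   | inj₁ (x⁺ , x<u) with go x⁺ v⁺ (rec (ℕ.+-monoˡ-< (size v) x<u))
      ...     | w , a , b , w-int , x≡ , v≡ =
        w , a ℕ.+ b , b , w-int , restore a b (positive⇒norm1 v⁺) x≡ v≡ , v≡
      go {u} {v} u⁺ v⁺ (acc rec) | no _ | no _
            | inj₂ (x⁺ , x<v) with go u⁺ x⁺ (rec (ℕ.+-monoʳ-< (size u) x<v))
      ...     | w , a , b , w-int , u≡ , x≡ =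
        w , a , b ℕ.+ a , w-int , u≡ , restore b a (positive⇒norm1 u⁺) x≡ u≡

    -- The squares of two units are powers of one unit w. The signs of the exponents
    -- are normalised by conjugation, which inverts units of norm 1: y² is a power of
    -- w with nonnegative exponent, and so is either z² or its conjugate.
    squares : ∀ {y z} → IsIntegral y → NormSquare1 y → IsIntegral z → NormSquare1 z →
      ∃[ w ] ∃[ a ] ∃[ b ] IsIntegral w × y * y ≡ w ^ a × (z * z ≡ w ^ b ⊎ conjugate (z * z) ≡ w ^ b)
    squares {y} {z} y-int y-unit z-int z-unit
      with positive-square y-int y-unit | positive-square z-int z-unit
    ... | inj₁ y⁺ | inj₁ z⁺ = let (w , a , b , w-int , p , q) = generator y⁺ z⁺ in
      w , a , b , w-int , p , inj₁ q
    ... | inj₁ y⁺ | inj₂ z⁺ = let (w , a , b , w-int , p , q) = generator y⁺ z⁺ in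
      w , a , b , w-int , p , inj₂ q
    ... | inj₂ y⁺ | inj₁ z⁺ = let (w , a , b , w-int , p , q) = generator y⁺ z⁺ in
      conjugate w , a , b , integral-conjugate w-int ,
      trans (sym (conjugate-involutive _)) (trans (cong conjugate p) (conjugate-^ w a)) ,
      inj₂ (trans (cong conjugate q) (conjugate-^ w b))
    ... | inj₂ y⁺ | inj₂ z⁺ = let (w , a , b , w-int , p , q) = generator y⁺ z⁺ in
      conjugate w , a , b , integral-conjugate w-int ,
      trans (sym (conjugate-involutive _)) (trans (cong conjugate p) (conjugate-^ w a)) ,
      inj₁ (trans (sym (conjugate-involutive _)) (trans (cong conjugate q) (conjugate-^ w b)))

    -- With ε² = wᵃ, the exponent a is prime to 3, so a² = 1 + 3 q. If η² = wᵇ, then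
    -- (η εʲ)² is a cube for j = 2 a b. If η² = w⁻ᵇ, it is one for j = a b.
    unit-modulo-cubes : ∀ {ε η} → IsIntegral ε → NormSquare1 ε → ¬ IsCube (ε * ε) →
      IsIntegral η → NormSquare1 η → ∃[ j ] IsCube (η * ε ^ j)
    unit-modulo-cubes {ε} {η} ε-int ε-unit ε²≢cube η-int η-unit
      with squares ε-int ε-unit η-int η-unit
    ... | w , a , b , w-int , ε²≡ , η²≡ = from-square η²≡
      where
      a²≡1 : ∃[ q ] a ℕ.* a ≡ 1 ℕ.+ q ℕ.* 3
      a²≡1 with a ℕ.% 3 | a ℕ./ 3 | ℕ.m≡m%n+[m/n]*n a 3 | ℕ.m%n<n a 3
      ... | 0 | k | eq | _ = contradiction
        (w ^ k , integral-^ w-int k , trans ε²≡ (trans (cong (w ^_) eq) (^-*3 w k))) ε²≢cube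
      ... | 1 | k | eq | _ = k ℕ.* k ℕ.* 3 ℕ.+ k ℕ.* 2 , trans (cong₂ ℕ._*_ eq eq) (expand k)
        where
        expand : ∀ k → (1 ℕ.+ k ℕ.* 3) ℕ.* (1 ℕ.+ k ℕ.* 3) ≡ 1 ℕ.+ (k ℕ.* k ℕ.* 3 ℕ.+ k ℕ.* 2) ℕ.* 3
        expand = ℕ-Solver.solve-∀
      ... | 2 | k | eq | _ = k ℕ.* k ℕ.* 3 ℕ.+ k ℕ.* 4 ℕ.+ 1 , trans (cong₂ ℕ._*_ eq eq) (expand k)
        where
        expand : ∀ k → (2 ℕ.+ k ℕ.* 3) ℕ.* (2 ℕ.+ k ℕ.* 3) ≡ 1 ℕ.+ (k ℕ.* k ℕ.* 3 ℕ.+ k ℕ.* 4 ℕ.+ 1) ℕ.* 3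
        expand = ℕ-Solver.solve-∀
      ... | suc (suc (suc _)) | _ | _ | s≤s (s≤s (s≤s ()))

      q = proj₁ a²≡1

      square : ∀ j → (η * ε ^ j) * (η * ε ^ j) ≡ (η * η) * w ^ (a ℕ.* j)
      square j = trans
        (solve 2 (λ η x → (η :* x) :* (η :* x) := (η :* η) :* (x :* x)) refl η (ε ^ j))
        (cong ((η * η) *_) (trans (sym (^-distrib-* ε ε j))
          (trans (cong (_^ j) ε²≡) (^-assocʳ w a j))))

      conclude : ∀ j c → (η * η) * w ^ (a ℕ.* j) ≡ w ^ (c ℕ.* 3) → ∃[ j ] IsCube (η * ε ^ j)
      conclude j c eq = j , square-cube⇒cube
        (integral-* η-int (integral-^ ε-int j))
        (normSquare1-* {η} η-unit (normSquare1-^ ε-unit j))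
        (w ^ c , integral-^ w-int c , trans (square j) (trans eq (^-*3 w c)))

      from-square : η * η ≡ w ^ b ⊎ conjugate (η * η) ≡ w ^ b → ∃[ j ] IsCube (η * ε ^ j)
      from-square (inj₁ η²≡) = conclude (2 ℕ.* a ℕ.* b) (b ℕ.+ 2 ℕ.* q ℕ.* b)
        (trans (cong (_* w ^ (a ℕ.* (2 ℕ.* a ℕ.* b))) η²≡)
        (trans (sym (^-homo-* w b _)) (cong (w ^_)
          (trans (shape a b) (trans (cong (λ x → b ℕ.+ 2 ℕ.* x ℕ.* b) (proj₂ a²≡1)) (collect q b))))))
        where
        shape : ∀ a b → b ℕ.+ a ℕ.* (2 ℕ.* a ℕ.* b) ≡ b ℕ.+ 2 ℕ.* (a ℕ.* a) ℕ.* b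
        shape = ℕ-Solver.solve-∀
        collect : ∀ q b → b ℕ.+ 2 ℕ.* (1 ℕ.+ q ℕ.* 3) ℕ.* b ≡ (b ℕ.+ 2 ℕ.* q ℕ.* b) ℕ.* 3
        collect = ℕ-Solver.solve-∀
      from-square (inj₂ η̄²≡) = conclude (a ℕ.* b) (q ℕ.* b)
        (trans (cong (λ n → (η * η) * w ^ n)
          (trans (shape a b) (trans (cong (ℕ._* b) (proj₂ a²≡1)) (collect q b))))
        (trans (cong ((η * η) *_) (trans (^-homo-* w b _) (cong (_* w ^ (q ℕ.* b ℕ.* 3)) (trans (sym η̄²≡) (conjugate-* η η)))))
        (trans (solve 3 (λ η η̄ x → (η :* η) :* ((η̄ :* η̄) :* x) := ((η :* η̄) :* (η :* η̄)) :* x) refl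
                 η (conjugate η) (w ^ (q ℕ.* b ℕ.* 3)))
        (trans (cong (_* w ^ (q ℕ.* b ℕ.* 3)) η-unit) (*-identityˡ _)))))
        where
        shape : ∀ a b → a ℕ.* (a ℕ.* b) ≡ (a ℕ.* a) ℕ.* b
        shape = ℕ-Solver.solve-∀
        collect : ∀ q b → (1 ℕ.+ q ℕ.* 3) ℕ.* b ≡ b ℕ.+ q ℕ.* b ℕ.* 3
        collect = ℕ-Solver.solve-∀

------------------------------------------------------------------------
-- The quadratic field and its ideal classes of order 3

module _ {c ℓ} (R : CommutativeRing c ℓ) where
  open CommutativeRing R renaming (refl to ≈-refl; sym to ≈-sym; trans to ≈-trans)

  -- An element with trace t and norm n is a root of X² - t X + n.
  root-of-quadratic : ∀ {z z̄ t n} → z + z̄ ≈ t → z * z̄ ≈ n → n + z * (- t + z * 1#) ≈ 0#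
  root-of-quadratic {z} {z̄} {t} tr nm =
    ≈-trans (+-cong (≈-sym nm) (*-congˡ (+-congˡ (*-identityʳ z))))
    (≈-trans (≈-sym (distribˡ z z̄ (- t + z)))
    (≈-trans (*-congˡ (≈-trans (+-comm z̄ (- t + z)) (≈-trans (+-assoc (- t) z z̄)
      (≈-trans (+-congˡ tr) (-‿inverseˡ t))))) (zeroʳ z)))

module _ (d : ℤ) where
  open Quadratic d
  open ℚ[√_]
  open +-*-Solver using (solve; con; _:+_; _:*_; _:=_; :-_)

  private δ = fromℤ d

  -- The field ℚ(√d) with its algebraic integers.
  quadraticRing : QuadraticRing
  quadraticRing = record
    { isCommutativeRing    = isCommutativeRing
    ; ι                    = ι
    ; ι-+                  = λ y z → cong ⟨_, 0ℚ ⟩ (sym (fromℤ-+ y z))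
    ; ι-*                  = ι-*
    ; ι--                  = λ z → cong ⟨_, 0ℚ ⟩ (sym (fromℤ-- z))
    ; ι-injective          = λ eq → fromℤ-injective (cong rational eq)
    ; conjugate            = conjugate
    ; conjugate-+          = λ { ⟨ a , b ⟩ ⟨ a′ , b′ ⟩ → cong ⟨ a ⊕ a′ ,_⟩ (ℚ.neg-distrib-+ b b′) }
    ; conjugate-*          = conjugate-*
    ; conjugate-ι          = λ _ → refl
    ; conjugate-involutive = λ { ⟨ a , b ⟩ → cong ⟨ a ,_⟩ (solve 1 (λ b → (:- (:- b)) := b) refl b) }
    ; IsIntegral           = IsIntegral
    ; integral-*           = integral-*
    ; integral⇒traceNorm   = toTraceNorm
    ; traceNorm⇒integral   = fromTraceNorm
    }
    where
    toTraceNorm : ∀ {z} → IsIntegral z → ∃[ t ] ∃[ n ] TraceNorm _+_ _*_ ι conjugate z t n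
    toTraceNorm {z@(⟨ a , b ⟩)} z-int = proj₁ trace , proj₁ norm , traceNorm
      (cong₂ ⟨_,_⟩ (proj₂ trace) (ℚ.+-inverseʳ b))
      (cong₂ ⟨_,_⟩ (proj₂ norm) irr≡0)
      where
      irr≡0 : a ⊛ ⊖ b ⊕ b ⊛ a ≡ 0ℚ
      irr≡0 = solve 2 (λ a b → a :* (:- b) :+ b :* a := con 0ℚ) refl a b
      bounded = integral⇒bounded z-int
      trace : IsInteger (a ⊕ a)
      trace = bounded-rational _ (subst HasBoundedPowers
        (cong ⟨ a ⊕ a ,_⟩ (ℚ.+-inverseʳ b)) (bounded-+ bounded (bounded-conjugate bounded)))
      norm : IsInteger (a ⊛ a ⊕ δ ⊛ (b ⊛ ⊖ b))
      norm = bounded-rational _ (subst HasBoundedPowers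
        (cong ⟨ a ⊛ a ⊕ δ ⊛ (b ⊛ ⊖ b) ,_⟩ irr≡0) (bounded-* bounded (bounded-conjugate bounded)))

    fromTraceNorm : ∀ {z t n} → TraceNorm _+_ _*_ ι conjugate z t n → IsIntegral z
    fromTraceNorm {z} {t} {n} (traceNorm tr nm) = n ∷ ℤ.- t ∷ [] ,
      trans (cong (λ w → ι n + z * (w + z * 1#)) (cong ⟨_, 0ℚ ⟩ (sym (fromℤ-- t))))
        (root-of-quadratic commutativeRing {z} {conjugate z} tr nm)

  open QuadraticRing quadraticRing using (HasTraceNorm)

  -- (t + s √d) / 2
  half : ℤ → ℤ → ℚ[√ d ]
  half t s = ⟨ ½ ⊛ fromℤ t , ½ ⊛ fromℤ s ⟩

  half-traceNorm : ∀ t s n → t ℤ.* t ≡ + 4 ℤ.* n ℤ.+ s ℤ.* s ℤ.* d →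
    HasTraceNorm (half t s) t n
  half-traceNorm t s n eq = traceNorm
    (cong₂ ⟨_,_⟩ (solve 1 (λ t → con ½ :* t :+ con ½ :* t := t) refl (fromℤ t))
      (ℚ.+-inverseʳ (½ ⊛ fromℤ s)))
    (cong₂ ⟨_,_⟩
      (trans (solve 3 (λ e t s → (con ½ :* t) :* (con ½ :* t) :+ e :* ((con ½ :* s) :* (:- (con ½ :* s))) :=
                 (con ½ :* con ½) :* (t :* t :+ :- (s :* s :* e))) refl δ (fromℤ t) (fromℤ s))
      (trans (cong (λ u → (½ ⊛ ½) ⊛ (u ⊕ ⊖ (fromℤ s ⊛ fromℤ s ⊛ δ))) eqℚ)
        (solve 2 (λ n v → (con ½ :* con ½) :* ((con (fromℤ (+ 4)) :* n :+ v) :+ :- v) := n) refl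
          (fromℤ n) (fromℤ s ⊛ fromℤ s ⊛ δ))))
      (solve 2 (λ t s → (con ½ :* t) :* (:- (con ½ :* s)) :+ (con ½ :* s) :* (con ½ :* t) := con 0ℚ) refl (fromℤ t) (fromℤ s)))
    where
    eqℚ : fromℤ t ⊛ fromℤ t ≡ fromℤ (+ 4) ⊛ fromℤ n ⊕ fromℤ s ⊛ fromℤ s ⊛ δ
    eqℚ = trans (fromℤ-* t t) (trans (cong fromℤ eq) (trans (sym (fromℤ-+ (+ 4 ℤ.* n) (s ℤ.* s ℤ.* d)))
      (cong₂ _⊕_ (sym (fromℤ-* (+ 4) n))
        (trans (sym (fromℤ-* (s ℤ.* s) d)) (cong (_⊛ δ) (sym (fromℤ-* s s)))))))

module _ (K : QuadraticField) where
  open QuadraticField K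
  open QuadraticRing (quadraticRing radicand) using (HasTraceNorm; ι-+; ι-injective; traceNorm⇒integral)
  open CubesAndUnits (quadraticRing radicand) using (integral-conjugate)
  open CommutativeRing commutativeRing using (zeroˡ)

  private
    module Cube = IdealCube isCommutativeRing IsIntegral
      (integral-ι 0ℤ) (integral-ι 1ℤ) integral-+ integral-*

  -- If α has norm m³ and a trace prime to m, and α is not a unit η times the cube
  -- of an integer β, then the class of (m, α) has order 3 and is a square.
  order-3-class : ∀ {α t} m u v → m ≢ 0ℤ →
    HasTraceNorm α t (m ℤ.* (m ℤ.* m)) → u ℤ.* m ℤ.+ v ℤ.* t ≡ 1ℤ →
    (∀ {β η η′} → IsIntegral β → IsIntegral η → IsIntegral η′ → η * η′ ≡ 1# → α ≢ η * (β * (β * β))) →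
    PrincipalGenusHasElementOfOrder 3 K
  order-3-class {α} {t} m u v m≢0 tn bezout α≢ηβ³ =
    𝔞-invertible , order-3-square classGroup {𝔞-invertible} 𝔞³∼𝟙
      λ 𝔞∼𝟙 → let (β , η , η′ , β∈ , η∈ , η′∈ , ηη′≡1 , α≡) = principal⇒cube 𝔞∼𝟙 in
        α≢ηβ³ β∈ η∈ η′∈ ηη′≡1 α≡
    where
    α-int : IsIntegral α
    α-int = traceNorm⇒integral tn
    α-unit : Unit α
    α-unit = nonzero⇒unit α λ α≡0 → m≢0 (m³≡0 (ι-injective
      (trans (sym (norm≡ tn)) (trans (cong (_* conjugate α) α≡0) (zeroˡ (conjugate α))))))
      where
      m³≡0 : m ℤ.* (m ℤ.* m) ≡ 0ℤ → m ≡ 0ℤ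
      m³≡0 eq with ℤ.i*j≡0⇒i≡0∨j≡0 m eq
      ... | inj₁ m≡0 = m≡0
      ... | inj₂ m²≡0 with ℤ.i*j≡0⇒i≡0∨j≡0 m m²≡0
      ...   | inj₁ m≡0 = m≡0
      ...   | inj₂ m≡0 = m≡0
    bezout′ : ι u * ι m + ι v * (α + conjugate α) ≡ 1#
    bezout′ = trans (cong₂ _+_ (sym (ι-* u m)) (trans (cong (ι v *_) (trace≡ tn)) (sym (ι-* v t))))
      (trans (sym (ι-+ (u ℤ.* m) (v ℤ.* t))) (cong ι bezout))
    norm′ : α * conjugate α ≡ ι m * (ι m * ι m)
    norm′ = trans (norm≡ tn) (trans (ι-* m (m ℤ.* m)) (cong (ι m *_) (ι-* m m)))
    open Cube.PrincipalCube (integral-ι m) α-int (integral-conjugate α-int) (integral-ι u) (integral-ι v)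
      α-unit norm′ bezout′

------------------------------------------------------------------------
-- Units of a real quadratic field

pos-* : ∀ {p q} → 0ℚ ℚ.< p → 0ℚ ℚ.< q → 0ℚ ℚ.< p ⊛ q
pos-* {p} {q} 0<p 0<q =
  ℚ.positive⁻¹ (p ⊛ q) {{ℚ.pos*pos⇒pos p {{ℚ.positive 0<p}} q {{ℚ.positive 0<q}}}}

nonNeg-* : ∀ {p q} → 0ℚ ℚ.≤ p → 0ℚ ℚ.≤ q → 0ℚ ℚ.≤ p ⊛ q
nonNeg-* {p} {q} 0≤p 0≤q =
  ℚ.nonNegative⁻¹ (p ⊛ q) {{ℚ.nonNeg*nonNeg⇒nonNeg p {{ℚ.nonNegative 0≤p}} q {{ℚ.nonNegative 0≤q}}}}

nonNeg-+ : ∀ {p q} → 0ℚ ℚ.≤ p → 0ℚ ℚ.≤ q → 0ℚ ℚ.≤ p ⊕ q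
nonNeg-+ = ℚ.+-mono-≤

pos-+ : ∀ {p q} → 0ℚ ℚ.< p → 0ℚ ℚ.≤ q → 0ℚ ℚ.< p ⊕ q
pos-+ = ℚ.+-mono-<-≤

≤0⇒0≤- : ∀ {p} → p ℚ.≤ 0ℚ → 0ℚ ℚ.≤ ⊖ p
≤0⇒0≤- = ℚ.neg-antimono-≤

square-nonNeg : ∀ p → 0ℚ ℚ.≤ p ⊛ p
square-nonNeg p with ℚ.≤-total 0ℚ p
... | inj₁ 0≤p = nonNeg-* 0≤p 0≤p
... | inj₂ p≤0 = subst (0ℚ ℚ.≤_) (solve 1 (λ p → :- p :* :- p := p :* p) refl p)
  (nonNeg-* (≤0⇒0≤- p≤0) (≤0⇒0≤- p≤0))
  where open +-*-Solver

pos+nonNeg≢0 : ∀ {p q} → 0ℚ ℚ.< p → 0ℚ ℚ.≤ q → p ⊕ q ≢ 0ℚ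
pos+nonNeg≢0 0<p 0≤q eq = ℚ.<-irrefl (sym eq) (pos-+ 0<p 0≤q)

0<1 : 0ℚ ℚ.< 1ℚ
0<1 = *<* (ℤ.+<+ (ℕ.s≤s ℕ.z≤n))

<-from-difference : ∀ {p q} → 0ℚ ℚ.< q ⊕ ⊖ p → p ℚ.< q
<-from-difference {p} {q} 0<q-p = subst₂ ℚ._<_ (ℚ.+-identityˡ p)
  (solve 2 (λ p q → (q :+ :- p) :+ p := q) refl p q) (ℚ.+-monoˡ-< p 0<q-p)
  where open +-*-Solver

-- If p > 0, q ≥ 0 and p = r q, then r > 0.
0<-from-product : ∀ {p q r} → 0ℚ ℚ.< p → 0ℚ ℚ.≤ q → p ⊕ ⊖ r ⊛ q ≡ 0ℚ → 0ℚ ℚ.< r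
0<-from-product {p} {q} {r} 0<p 0≤q eq = ℚ.≰⇒> λ r≤0 →
  pos+nonNeg≢0 0<p (nonNeg-* (≤0⇒0≤- r≤0) 0≤q) eq

fromℤ-cancel-< : ∀ {y z} → fromℤ y ℚ.< fromℤ z → y ℤ.< z
fromℤ-cancel-< {y} {z} (*<* y<z) = subst₂ ℤ._<_ (ℤ.*-identityʳ y) (ℤ.*-identityʳ z) y<z

-- The ordering of units is expressed by coordinates, without real numbers: a unit
-- a + b √d of norm 1 is at least 1 exactly if a > 0 and b ≥ 0.
module RealField (d : ℤ) (0<d : 0ℤ ℤ.< d) where
  open +-*-Solver using (solve; con; _:+_; _:*_; _:=_; :-_)
  open Quadratic d
  open ℚ[√_]
  open QuadraticRing (quadraticRing d) using (integral⇒traceNorm)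
  open CubesAndUnits (quadraticRing d) using (norm; norm-*; norm-conjugate; integral-conjugate; NormSquare1)

  private
    K = ℚ[√ d ]
    δ = fromℤ d

    0<δ : 0ℚ ℚ.< δ
    0<δ = *<* (subst (0ℤ ℤ.<_) (sym (ℤ.*-identityʳ d)) 0<d)

    0≤δ : 0ℚ ℚ.≤ δ
    0≤δ = ℚ.<⇒≤ 0<δ

  -- A unit of norm 1 that is at least 1.
  record Positive (z : K) : Set where
    constructor positiveUnit
    field
      integral  : IsIntegral z
      norm≡1    : norm z ≡ ι 1ℤ
      0<rat     : 0ℚ ℚ.< rational z
      0≤irr     : 0ℚ ℚ.≤ irrational z

  open Positive

  -- The absolute value of the trace 2 a of a + b √d, which is an integer if a + b √d
  -- is integral.
  size : K → ℕ
  size z = ℤ.∣ ℚ.↥ (rational z ⊕ rational z) ∣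

  pell : ∀ {a b} → norm ⟨ a , b ⟩ ≡ ι 1ℤ → a ⊛ a ≡ 1ℚ ⊕ δ ⊛ (b ⊛ b)
  pell {a} {b} eq = trans
    (solve 3 (λ e a b → a :* a := (a :* a :+ e :* (b :* :- b)) :+ e :* (b :* b)) refl δ a b)
    (cong (_⊕ δ ⊛ (b ⊛ b)) (cong rational eq))

  δ-square : ∀ b → 0ℚ ℚ.≤ δ ⊛ (b ⊛ b)
  δ-square b = nonNeg-* 0≤δ (square-nonNeg b)

  irr≡0⇒1 : ∀ {z} → Positive z → irrational z ≡ 0ℚ → z ≡ ι 1ℤ
  irr≡0⇒1 {⟨ a , b ⟩} z⁺ refl = cong ⟨_, 0ℚ ⟩ (ℚ.≤-antisym (ℚ.≮⇒≥ 1≮a) (ℚ.≮⇒≥ a≮1))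
    where
    a²≡1 : a ⊛ a ≡ 1ℚ
    a²≡1 = trans (pell {a} {0ℚ} (norm≡1 z⁺)) (solve 1 (λ e → con 1ℚ :+ e :* (con 0ℚ :* con 0ℚ) := con 1ℚ) refl δ)
    0<a+1 : 0ℚ ℚ.< 1ℚ ⊕ a
    0<a+1 = pos-+ 0<1 (ℚ.<⇒≤ (0<rat z⁺))
    1≮a : ¬ (1ℚ ℚ.< a)
    1≮a 1<a = ℚ.<-irrefl (sym vanishes) (pos-* (subst (ℚ._< a ⊕ ⊖ 1ℚ) (ℚ.+-inverseʳ 1ℚ) (ℚ.+-monoˡ-< (⊖ 1ℚ) 1<a)) 0<a+1)
      where
      vanishes : (a ⊕ ⊖ 1ℚ) ⊛ (1ℚ ⊕ a) ≡ 0ℚ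
      vanishes = trans (solve 1 (λ a → (a :+ :- con 1ℚ) :* (con 1ℚ :+ a) := a :* a :+ :- con 1ℚ) refl a) (cong (_⊕ ⊖ 1ℚ) a²≡1)
    a≮1 : ¬ (a ℚ.< 1ℚ)
    a≮1 a<1 = ℚ.<-irrefl (sym vanishes) (pos-* (subst (ℚ._< 1ℚ ⊕ ⊖ a) (ℚ.+-inverseʳ a) (ℚ.+-monoˡ-< (⊖ a) a<1)) 0<a+1)
      where
      vanishes : (1ℚ ⊕ ⊖ a) ⊛ (1ℚ ⊕ a) ≡ 0ℚ
      vanishes = trans (solve 1 (λ a → (con 1ℚ :+ :- a) :* (con 1ℚ :+ a) := con 1ℚ :+ :- (a :* a)) refl a) (cong (λ x → 1ℚ ⊕ ⊖ x) a²≡1)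

  is-1? : ∀ {z} → Positive z → Dec (z ≡ ι 1ℤ)
  is-1? {⟨ a , b ⟩} z⁺ with b ℚ.≟ 0ℚ
  ... | yes b≡0 = yes (irr≡0⇒1 z⁺ b≡0)
  ... | no b≢0  = no λ z≡1 → b≢0 (cong irrational z≡1)

  ≢1⇒0<irr : ∀ {z} → Positive z → z ≢ ι 1ℤ → 0ℚ ℚ.< irrational z
  ≢1⇒0<irr z⁺ z≢1 = ℚ.≰⇒> λ b≤0 → z≢1 (irr≡0⇒1 z⁺ (ℚ.≤-antisym b≤0 (0≤irr z⁺)))

  quotient-norm : ∀ {u v} → Positive u → Positive v → norm (u * conjugate v) ≡ ι 1ℤ
  quotient-norm {u} {v} u⁺ v⁺ = trans (norm-* u (conjugate v))
    (trans (cong₂ _*_ (norm≡1 u⁺) (trans (norm-conjugate v) (norm≡1 v⁺))) (sym (ι-* 1ℤ 1ℤ)))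

  quotient-integral : ∀ {u v} → Positive u → Positive v → IsIntegral (u * conjugate v)
  quotient-integral u⁺ v⁺ = integral-* (integral u⁺) (integral-conjugate (integral v⁺))

  -- The rational part a a′ - d b b′ is positive, because
  -- (a a′)² - (d b b′)² = 1 + d b² + d b′².
  quotient-positive : ∀ {u v} → Positive u → Positive v →
    0ℚ ℚ.≤ irrational (u * conjugate v) → Positive (u * conjugate v)
  quotient-positive {u@(⟨ a , b ⟩)} {v@(⟨ a′ , b′ ⟩)} u⁺ v⁺ 0≤irr′ = positiveUnit
    (quotient-integral u⁺ v⁺) (quotient-norm u⁺ v⁺)
    (0<-from-product {1ℚ ⊕ (B ⊕ B′)} {a ⊛ a′ ⊕ δ ⊛ (b ⊛ b′)}
      (pos-+ 0<1 (nonNeg-+ (δ-square b) (δ-square b′)))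
      (nonNeg-+ (nonNeg-* (ℚ.<⇒≤ (0<rat u⁺)) (ℚ.<⇒≤ (0<rat v⁺)))
                (nonNeg-* 0≤δ (nonNeg-* (0≤irr u⁺) (0≤irr v⁺))))
      vanishes)
    0≤irr′
    where
    B  = δ ⊛ (b ⊛ b)
    B′ = δ ⊛ (b′ ⊛ b′)
    vanishes : (1ℚ ⊕ (B ⊕ B′)) ⊕ ⊖ (a ⊛ a′ ⊕ δ ⊛ (b ⊛ ⊖ b′)) ⊛ (a ⊛ a′ ⊕ δ ⊛ (b ⊛ b′)) ≡ 0ℚ
    vanishes = trans
      (solve 5 (λ e a b a′ b′ →
          (con 1ℚ :+ (e :* (b :* b) :+ e :* (b′ :* b′))) :+
            :- (a :* a′ :+ e :* (b :* :- b′)) :* (a :* a′ :+ e :* (b :* b′)) :=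
          (con 1ℚ :+ e :* (b :* b)) :* (con 1ℚ :+ e :* (b′ :* b′)) :+ :- ((a :* a) :* (a′ :* a′)))
        refl δ a b a′ b′)
      (trans (cong₂ (λ x y → (1ℚ ⊕ B) ⊛ (1ℚ ⊕ B′) ⊕ ⊖ (x ⊛ y)) (pell {a} {b} (norm≡1 u⁺)) (pell {a′} {b′} (norm≡1 v⁺)))
        (ℚ.+-inverseʳ ((1ℚ ⊕ B) ⊛ (1ℚ ⊕ B′))))

  -- (a - 1) (1 + a) = d b² > 0
  1<rat : ∀ {v} → Positive v → v ≢ ι 1ℤ → 0ℚ ℚ.< rational v ⊕ ⊖ 1ℚ
  1<rat {v@(⟨ a , b ⟩)} v⁺ v≢1 = 0<-from-product {δ ⊛ (b ⊛ b)} {1ℚ ⊕ a}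
    (pos-* 0<δ (pos-* (≢1⇒0<irr v⁺ v≢1) (≢1⇒0<irr v⁺ v≢1)))
    (nonNeg-+ (ℚ.<⇒≤ 0<1) (ℚ.<⇒≤ (0<rat v⁺)))
    (trans (solve 2 (λ B a → B :+ :- (a :+ :- con 1ℚ) :* (con 1ℚ :+ a) := (con 1ℚ :+ B) :+ :- (a :* a)) refl (δ ⊛ (b ⊛ b)) a)
    (trans (cong (λ x → (1ℚ ⊕ δ ⊛ (b ⊛ b)) ⊕ ⊖ x) (pell {a} {b} (norm≡1 v⁺))) (ℚ.+-inverseʳ (1ℚ ⊕ δ ⊛ (b ⊛ b)))))

  -- With w = u v̄ one has rat u = rat w rat v + d irr w irr v, and rat v > 1.
  quotient-rat< : ∀ {u v} → Positive u → Positive v → v ≢ ι 1ℤ → Positive (u * conjugate v) →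
    rational (u * conjugate v) ℚ.< rational u
  quotient-rat< {u@(⟨ a , b ⟩)} {v@(⟨ a′ , b′ ⟩)} u⁺ v⁺ v≢1 w⁺ = <-from-difference
    (subst (0ℚ ℚ.<_) eq (pos-+ (pos-* (1<rat v⁺ v≢1) (0<rat w⁺))
      (nonNeg-* 0≤δ (nonNeg-* (0≤irr w⁺) (0≤irr v⁺)))))
    where
    x = a ⊛ a′ ⊕ δ ⊛ (b ⊛ ⊖ b′)
    y = a ⊛ ⊖ b′ ⊕ b ⊛ a′
    eq : (a′ ⊕ ⊖ 1ℚ) ⊛ x ⊕ δ ⊛ (y ⊛ b′) ≡ a ⊕ ⊖ x
    eq = trans (solve 5 (λ e a b a′ b′ →
          (a′ :+ :- con 1ℚ) :* (a :* a′ :+ e :* (b :* :- b′)) :+ e :* ((a :* :- b′ :+ b :* a′) :* b′) :=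
          (a :* (a′ :* a′) :+ :- (a :* (e :* (b′ :* b′)))) :+ :- (a :* a′ :+ e :* (b :* :- b′))) refl δ a b a′ b′)
      (cong (_⊕ ⊖ x) (trans (cong (λ z → a ⊛ z ⊕ ⊖ (a ⊛ (δ ⊛ (b′ ⊛ b′)))) (pell {a′} {b′} (norm≡1 v⁺)))
        (solve 2 (λ a B → a :* (con 1ℚ :+ B) :+ :- (a :* B) := a) refl a (δ ⊛ (b′ ⊛ b′)))))

  rat<⇒size< : ∀ {w u} → Positive w → Positive u → rational w ℚ.< rational u → size w ℕ.< size u
  rat<⇒size< {w} {u} w⁺ u⁺ w<u = go (trace w (integral w⁺)) (trace u (integral u⁺))
    where
    trace : ∀ z → IsIntegral z → IsInteger (rational z ⊕ rational z)
    trace z z-int = let (t , _ , tn) = integral⇒traceNorm z-int in t , cong rational (TraceNorm.trace≡ tn)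
    0<2w : 0ℚ ℚ.< rational w ⊕ rational w
    0<2w = pos-+ (0<rat w⁺) (ℚ.<⇒≤ (0<rat w⁺))
    2w<2u : rational w ⊕ rational w ℚ.< rational u ⊕ rational u
    2w<2u = ℚ.+-mono-< w<u w<u
    abs-< : ∀ s t → 0ℤ ℤ.< s → s ℤ.< t → ℤ.∣ s ∣ ℕ.< ℤ.∣ t ∣
    abs-< (+ s) (+ t) _ (ℤ.+<+ s<t) = s<t
    go : IsInteger (rational w ⊕ rational w) → IsInteger (rational u ⊕ rational u) → size w ℕ.< size u
    go (s , ws) (t , ut) = subst₂ ℕ._<_ (sym (cong (λ q → ℤ.∣ ℚ.↥ q ∣) ws)) (sym (cong (λ q → ℤ.∣ ℚ.↥ q ∣) ut))
      (abs-< s t (fromℤ-cancel-< (subst (0ℚ ℚ.<_) ws 0<2w)) (fromℤ-cancel-< (subst₂ ℚ._<_ ws ut 2w<2u)))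

  compare : ∀ {u v} → Positive u → Positive v → u ≢ ι 1ℤ → v ≢ ι 1ℤ →
    (Positive (u * conjugate v) × size (u * conjugate v) ℕ.< size u) ⊎
    (Positive (v * conjugate u) × size (v * conjugate u) ℕ.< size v)
  compare {u@(⟨ a , b ⟩)} {v@(⟨ a′ , b′ ⟩)} u⁺ v⁺ u≢1 v≢1 with ℚ.≤-total 0ℚ (irrational (u * conjugate v))
  ... | inj₁ 0≤ = inj₁ (w⁺ , rat<⇒size< w⁺ u⁺ (quotient-rat< u⁺ v⁺ v≢1 w⁺))
    where
    w⁺ : Positive (u * conjugate v)
    w⁺ = quotient-positive u⁺ v⁺ 0≤
  ... | inj₂ ≤0 = inj₂ (w⁺ , rat<⇒size< w⁺ v⁺ (quotient-rat< v⁺ u⁺ u≢1 w⁺))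
    where
    w⁺ : Positive (v * conjugate u)
    w⁺ = quotient-positive v⁺ u⁺ (subst (0ℚ ℚ.≤_)
      (solve 4 (λ a b a′ b′ → :- (a :* :- b′ :+ b :* a′) := a′ :* :- b :+ b′ :* a) refl a b a′ b′)
      (≤0⇒0≤- ≤0))

  positive-square : ∀ {z} → IsIntegral z → NormSquare1 z → Positive (z * z) ⊎ Positive (conjugate (z * z))
  positive-square {z@(⟨ a , b ⟩)} z-int z-unit = go (ℚ.≤-total 0ℚ (irrational (z * z)))
    where
    norm² : norm (z * z) ≡ ι 1ℤ
    norm² = trans (norm-* z z) z-unit
    s = a ⊛ a ⊕ δ ⊛ (b ⊛ b)
    4δa²b² = fromℤ (+ 4) ⊛ (δ ⊛ ((a ⊛ b) ⊛ (a ⊛ b)))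
    -- The square of a² + d b² is 1 + 4 d a² b².
    0<s : 0ℚ ℚ.< s
    0<s = 0<-from-product {1ℚ ⊕ 4δa²b²} {s}
      (pos-+ 0<1 (nonNeg-* {fromℤ (+ 4)} (*≤* (ℤ.+≤+ ℕ.z≤n)) (nonNeg-* 0≤δ (square-nonNeg (a ⊛ b)))))
      (nonNeg-+ (square-nonNeg a) (δ-square b))
      (trans (cong (λ x → (x ⊕ 4δa²b²) ⊕ ⊖ s ⊛ s) (sym (cong rational z-unit)))
        (solve 3 (λ e a b →
            (((a :* a :+ e :* (b :* :- b)) :* (a :* a :+ e :* (b :* :- b)) :+
              e :* ((a :* :- b :+ b :* a) :* (a :* :- b :+ b :* a))) :+
            con (fromℤ (+ 4)) :* (e :* ((a :* b) :* (a :* b)))) :+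
            :- (a :* a :+ e :* (b :* b)) :* (a :* a :+ e :* (b :* b)) := con 0ℚ)
          refl δ a b))
    go : 0ℚ ℚ.≤ irrational (z * z) ⊎ irrational (z * z) ℚ.≤ 0ℚ →
      Positive (z * z) ⊎ Positive (conjugate (z * z))
    go (inj₁ 0≤) = inj₁ (positiveUnit (integral-* z-int z-int) norm² 0<s 0≤)
    go (inj₂ ≤0) = inj₂ (positiveUnit (integral-conjugate (integral-* z-int z-int))
      (trans (norm-conjugate (z * z)) norm²) 0<s (≤0⇒0≤- ≤0))

module _ (K : QuadraticField) (real : Real K) where
  open QuadraticField K
  open QuadraticRing (quadraticRing radicand) using (HasTraceNorm; traceNorm⇒integral)
  open CubesAndUnits (quadraticRing radicand)
  open RealField radicand real

  open Units Positive size Positive.integral Positive.norm≡1 is-1? compare positive-square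

  -- If ε has norm -1 and trace n³, where n is an odd multiple of 3, then ε - 1 has
  -- norm (-n)³ and trace n³ - 2, which is prime to n.
  real-class : ∀ {ε} n j c → HasTraceNorm ε (n ℤ.* n ℤ.* n) -1ℤ →
    n ≡ + 1 ℤ.+ j ℤ.* + 2 → n ≡ c ℤ.* + 3 → PrincipalGenusHasElementOfOrder 3 K
  real-class {ε} n j c ε-tn n-odd 3∣n =
    order-3-class K m u v m≢0
      (subst (HasTraceNorm ε-1 (A ℤ.+ -[1+ 1 ])) (cubed n) ε-1-traceNorm)
      (trans (bezout n j) (trans (cong (λ i → i ℤ.+ j ℤ.* -[1+ 1 ]) n-odd) (bezout′ j)))
      (ε-1≢unit*cube (unit-modulo-cubes (traceNorm⇒integral ε-tn) ε-normSquare1 ε²-not-cube))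
    where
    A = n ℤ.* n ℤ.* n
    a = + 3 ℤ.* j ℤ.+ + 6 ℤ.* (j ℤ.* j) ℤ.+ + 4 ℤ.* (j ℤ.* j ℤ.* j)
    b = + 3 ℤ.* (c ℤ.* c ℤ.* c)
    m = ℤ.- n
    u = j ℤ.* (n ℤ.* n) ℤ.- + 1
    v = j
    A-odd : A ≡ + 1 ℤ.+ a ℤ.* + 2
    A-odd = trans (cong (λ n → n ℤ.* n ℤ.* n) n-odd) (eq j)
      where
      eq : ∀ j → (+ 1 ℤ.+ j ℤ.* + 2) ℤ.* (+ 1 ℤ.+ j ℤ.* + 2) ℤ.* (+ 1 ℤ.+ j ℤ.* + 2) ≡
        + 1 ℤ.+ (+ 3 ℤ.* j ℤ.+ + 6 ℤ.* (j ℤ.* j) ℤ.+ + 4 ℤ.* (j ℤ.* j ℤ.* j)) ℤ.* + 2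
      eq = solve-∀
    9∣A : A ≡ b ℤ.* + 9
    9∣A = trans (cong (λ n → n ℤ.* n ℤ.* n) 3∣n) (eq c)
      where
      eq : ∀ c → (c ℤ.* + 3) ℤ.* (c ℤ.* + 3) ℤ.* (c ℤ.* + 3) ≡ (+ 3 ℤ.* (c ℤ.* c ℤ.* c)) ℤ.* + 9
      eq = solve-∀
    cubed : ∀ n → ℤ.- (n ℤ.* n ℤ.* n) ≡ (ℤ.- n) ℤ.* ((ℤ.- n) ℤ.* (ℤ.- n))
    cubed = solve-∀
    bezout : ∀ n j → (j ℤ.* (n ℤ.* n) ℤ.- + 1) ℤ.* (ℤ.- n) ℤ.+ j ℤ.* (n ℤ.* n ℤ.* n ℤ.+ -[1+ 1 ]) ≡ n ℤ.+ j ℤ.* -[1+ 1 ]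
    bezout = solve-∀
    bezout′ : ∀ j → (+ 1 ℤ.+ j ℤ.* + 2) ℤ.+ j ℤ.* -[1+ 1 ] ≡ + 1
    bezout′ = solve-∀
    open GeneratorModuloCubes ε-tn a b A-odd 9∣A
    m≢0 : m ≢ 0ℤ
    m≢0 m≡0 = from-no (2 ∣? 1) (congruent⇒∣ 2 (ℤ.- j) 1ℤ
      (trans (sym (trans (sym (ℤ.neg-involutive n)) (cong ℤ.-_ m≡0))) n-odd) (eq j))
      where
      eq : ∀ j → (ℤ.- j) ℤ.* + 2 ≡ 1ℤ ℤ.+ ((+ 0) ℤ.- (+ 1 ℤ.+ j ℤ.* + 2))
      eq = solve-∀

------------------------------------------------------------------------
-- Isomorphic quadratic fields

squarefree-factor : ∀ {d} e z → Squarefree d → d ≡ e ℤ.* (z ℤ.* z) → d ≡ e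
squarefree-factor {d} e z d-sf d≡ = trans d≡ (trans (cong (e ℤ.*_) (unit z
  (d-sf ℤ.∣ z ∣ (divides ℤ.∣ e ∣ (trans (cong ℤ.∣_∣ d≡)
    (trans (ℤ.abs-* e (z ℤ.* z)) (cong (ℤ.∣ e ∣ ℕ.*_) (ℤ.abs-* z z)))))))) (ℤ.*-identityʳ e))
  where
  unit : ∀ z → ℤ.∣ z ∣ ≡ 1 → z ℤ.* z ≡ 1ℤ
  unit (+ 1)      refl = refl
  unit -[1+ 0 ]   refl = refl

rational-product≡0 : ∀ p q → p ⊛ q ⊕ q ⊛ p ≡ 0ℚ → p ≡ 0ℚ ⊎ q ≡ 0ℚ
rational-product≡0 p q eq with p ℚ.≟ 0ℚ
... | yes p≡0 = inj₁ p≡0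
... | no p≢0 = inj₂ (trans
    (trans (trans (sym (ℚ.*-identityˡ q)) (cong (_⊛ q) (sym (ℚ.*-inverseˡ p))))
      (solve 3 (λ p q r → (r :* p) :* q := con (½) :* (r :* (p :* q :+ q :* p))) refl p q (ℚ.1/ p)))
    (trans (cong (λ x → ½ ⊛ (ℚ.1/ p ⊛ x)) eq)
      (solve 1 (λ r → con ½ :* (r :* con 0ℚ) := con 0ℚ) refl (ℚ.1/ p))))
  where
  open +-*-Solver
  instance
    p-nonZero : ℚ.NonZero p
    p-nonZero = ℚ.≢-nonZero p≢0

-- A homomorphism maps √d to some a + b √e with square d, so a b = 0. If a = 0 then
-- d = e b² with b an integer, and d = e. If b = 0 then d = a² with a an integer, and
-- d = 1, which is excluded.
isomorphic⇒radicand≡ : ∀ K L → K ≅ L → QuadraticField.radicand K ≡ QuadraticField.radicand L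
isomorphic⇒radicand≡ K L (f , iso) = go (f √d) refl
  where
  open IsRingIsomorphism iso using (+-homo; *-homo; 1#-homo; 0#-homo; -‿homo)
  open QuadraticField K using () renaming (radicand to d; squarefree to d-sf; radicand≢1 to d≢1)
  open QuadraticField L using () renaming (radicand to e; squarefree to e-sf)
  module Q = Quadratic d
  module R = Quadratic e
  module QK = QuadraticRing (quadraticRing d)
  module QL = QuadraticRing (quadraticRing e)
  open +-*-Solver

  f-ι⁺ : ∀ n → f (Q.ι (+ n)) ≡ R.ι (+ n)
  f-ι⁺ zero    = 0#-homo
  f-ι⁺ (suc n) = trans (cong f (QK.ι-+ 1ℤ (+ n)))
    (trans (+-homo Q.1# (Q.ι (+ n))) (trans (cong₂ R._+_ 1#-homo (f-ι⁺ n)) (sym (QL.ι-+ 1ℤ (+ n)))))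

  f-ι : ∀ z → f (Q.ι z) ≡ R.ι z
  f-ι (+ n)    = f-ι⁺ n
  f-ι -[1+ n ] = trans (cong f (QK.ι-- (+ suc n)))
    (trans (-‿homo (Q.ι (+ suc n))) (trans (cong R.-_ (f-ι⁺ (suc n))) (sym (QL.ι-- (+ suc n)))))

  √d : ℚ[√ d ]
  √d = ⟨ 0ℚ , 1ℚ ⟩

  √d²≡d : √d Q.* √d ≡ Q.ι d
  √d²≡d = cong ⟨_, 0ℚ ⟩ (solve 1 (λ e → con 0ℚ :* con 0ℚ :+ e :* (con 1ℚ :* con 1ℚ) := e) refl (fromℤ d))

  go : ∀ z → f √d ≡ z → d ≡ e
  go z@(⟨ a , b ⟩) f√d≡z = cases (rational-product≡0 a b (cong ℚ[√_].irrational z²≡d))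
    where
    z²≡d : z R.* z ≡ R.ι d
    z²≡d = trans (cong₂ R._*_ (sym f√d≡z) (sym f√d≡z))
      (trans (sym (*-homo √d √d)) (trans (cong f √d²≡d) (f-ι d)))
    rat : a ⊛ a ⊕ fromℤ e ⊛ (b ⊛ b) ≡ fromℤ d
    rat = cong ℚ[√_].rational z²≡d
    square : ∀ c q → Squarefree c → fromℤ c ⊛ (q ⊛ q) ≡ fromℤ d → d ≡ c
    square c q c-sf eq with squarefree⇒integer c c-sf q (d , eq)
    ... | y , refl = squarefree-factor c y d-sf (fromℤ-injective (sym
      (trans (trans (sym (Q.fromℤ-* c (y ℤ.* y))) (cong (fromℤ c ⊛_) (sym (Q.fromℤ-* y y)))) eq)))
    cases : a ≡ 0ℚ ⊎ b ≡ 0ℚ → d ≡ e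
    cases (inj₁ refl) = square e b e-sf
      (trans (solve 2 (λ e b → e :* (b :* b) := con 0ℚ :* con 0ℚ :+ e :* (b :* b)) refl (fromℤ e) b) rat)
    cases (inj₂ refl) = contradiction (square 1ℤ a (λ m m²∣1 → ℕ.m*n≡1⇒m≡1 m m (∣1⇒≡1 m²∣1))
      (trans (solve 2 (λ e a → con 1ℚ :* (a :* a) := a :* a :+ e :* (con 0ℚ :* con 0ℚ)) refl (fromℤ e) a) rat)) d≢1

-- More than length xs distinct integers cannot all belong to xs.
value-outside : ∀ xs (f : Fin (suc (length xs)) → ℤ) →
  (∀ {i j} → i Fin.< j → f i ≢ f j) → ∃[ i ] f i ∉ˡ xs
value-outside xs f distinct with Fin.any? (λ i → ¬? (f i ∈? xs))
... | yes found = found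
... | no none = contradiction fi≡fj (distinct i<j)
  where
  f∈ : ∀ i → f i ∈ˡ xs
  f∈ i = decidable-stable (f i ∈? xs) λ f∉ → none (i , f∉)
  collision = Fin.pigeonhole (ℕ.n<1+n (length xs)) (λ i → Any.index (f∈ i))
  i = proj₁ collision
  j = proj₁ (proj₂ collision)
  i<j = proj₁ (proj₂ (proj₂ collision))
  fi≡fj : f i ≡ f j
  fi≡fj = trans (Any.lookup-index (f∈ i))
    (trans (cong (lookup xs) (proj₂ (proj₂ (proj₂ collision)))) (sym (Any.lookup-index (f∈ j))))

-- With B = A + s and P = A B, the product (A² + 4) (B² + 4) is (P + 4)² + 4 s²,
-- which is below (P + 6)² and differs from (P + 5)² = (P + 4)² + 2 P + 9.
product-not-square : ∀ {A B} Z → A ℕ.< B → B ℕ.≤ A ℕ.+ A →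
  (A ℕ.* A ℕ.+ 4) ℕ.* (B ℕ.* B ℕ.+ 4) ≢ Z ℕ.* Z
product-not-square {A} {B} Z A<B B≤2A eq with ℕ.m≤n⇒∃[o]m+o≡n A<B
... | t , refl with ℕ.m≤n⇒∃[o]m+o≡n {suc t} {A}
                      (ℕ.+-cancelˡ-≤ A (suc t) A (subst (ℕ._≤ A ℕ.+ A) (sym (ℕ.+-suc A t)) B≤2A))
... | r , refl = ℕ.even≢odd (2 ℕ.* (s ℕ.* s)) (P ℕ.+ 4) (ℕ.+-cancelˡ-≡ ((P ℕ.+ 4) ℕ.* (P ℕ.+ 4)) _ _
    (trans (sym (trans Z²≡ (lower s r))) (trans (cong (λ Z → Z ℕ.* Z) Z≡P+5) (middle P))))
  where
  s = suc t
  a = s ℕ.+ r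
  b = s ℕ.+ r ℕ.+ s
  P = a ℕ.* b

  lower : ∀ s r → ((s ℕ.+ r) ℕ.* (s ℕ.+ r) ℕ.+ 4) ℕ.* ((s ℕ.+ r ℕ.+ s) ℕ.* (s ℕ.+ r ℕ.+ s) ℕ.+ 4) ≡
    ((s ℕ.+ r) ℕ.* (s ℕ.+ r ℕ.+ s) ℕ.+ 4) ℕ.* ((s ℕ.+ r) ℕ.* (s ℕ.+ r ℕ.+ s) ℕ.+ 4) ℕ.+ 2 ℕ.* (2 ℕ.* (s ℕ.* s))
  lower = ℕ-Solver.solve-∀

  upper : ∀ s r → ((s ℕ.+ r) ℕ.* (s ℕ.+ r ℕ.+ s) ℕ.+ 6) ℕ.* ((s ℕ.+ r) ℕ.* (s ℕ.+ r ℕ.+ s) ℕ.+ 6) ≡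
    ((s ℕ.+ r) ℕ.* (s ℕ.+ r) ℕ.+ 4) ℕ.* ((s ℕ.+ r ℕ.+ s) ℕ.* (s ℕ.+ r ℕ.+ s) ℕ.+ 4) ℕ.+
    (20 ℕ.+ 4 ℕ.* (s ℕ.* s) ℕ.+ 12 ℕ.* (s ℕ.* r) ℕ.+ 4 ℕ.* (r ℕ.* r))
  upper = ℕ-Solver.solve-∀

  middle : ∀ P → (P ℕ.+ 5) ℕ.* (P ℕ.+ 5) ≡ (P ℕ.+ 4) ℕ.* (P ℕ.+ 4) ℕ.+ (1 ℕ.+ 2 ℕ.* (P ℕ.+ 4))
  middle = ℕ-Solver.solve-∀

  Z²≡ : Z ℕ.* Z ≡ (a ℕ.* a ℕ.+ 4) ℕ.* (b ℕ.* b ℕ.+ 4)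
  Z²≡ = trans (sym eq) (cong (λ b → (a ℕ.* a ℕ.+ 4) ℕ.* (b ℕ.* b ℕ.+ 4)) (sym (ℕ.+-suc a t)))

  P+5≤Z : P ℕ.+ 5 ℕ.≤ Z
  P+5≤Z = subst (ℕ._≤ Z) (sym (ℕ.+-suc P 4)) (ℕ.≰⇒> λ Z≤ → ℕ.<⇒≱
    (subst ((P ℕ.+ 4) ℕ.* (P ℕ.+ 4) ℕ.<_) (sym (trans Z²≡ (lower s r))) (ℕ.m<m+n _ (s≤s z≤n)))
    (ℕ.*-mono-≤ Z≤ Z≤))

  Z≤P+5 : Z ℕ.≤ P ℕ.+ 5
  Z≤P+5 = ℕ.≤-pred (subst (Z ℕ.<_) (ℕ.+-suc P 5) (ℕ.≰⇒> λ ≤Z → ℕ.<⇒≱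
    (subst₂ ℕ._<_ (sym Z²≡) (sym (upper s r)) (ℕ.m<m+n _ (s≤s z≤n)))
    (ℕ.*-mono-≤ ≤Z ≤Z)))

  Z≡P+5 : Z ≡ P ℕ.+ 5
  Z≡P+5 = ℕ.≤-antisym Z≤P+5 P+5≤Z

------------------------------------------------------------------------
-- Infinitely many real fields

open QuadraticField using (radicand)

-- The odd multiples of 3.
base : ℕ → ℕ
base k = 6 ℕ.* k ℕ.+ 3

-- The trace A of the unit of norm -1.
base³ : ℕ → ℕ
base³ k = base k ℕ.* base k ℕ.* base k

-- The field ℚ(√(A² + 4)). Its radicand is the squarefree part of A² + 4.
record RealFamily (k : ℕ) : Set where
  field
    quadraticField : QuadraticField
    root part      : ℕ
    radicand≡      : radicand quadraticField ≡ + part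
    part>0         : 0 < part
    square         : base³ k ℕ.* base³ k ℕ.+ 4 ≡ root ℕ.* root ℕ.* part

real-field : ∀ k → RealFamily k
real-field k = record
  { quadraticField = record { radicand = + e ; squarefree = e-sf ; radicand≢1 = λ e≡1 → e≢1 (ℤ.+-injective e≡1) }
  ; root = s ; part = e ; radicand≡ = refl ; part>0 = ℕ.n≢0⇒n>0 e≢0 ; square = eq }
  where
  A = base³ k
  instance
    N-nonZero : ℕ.NonZero (A ℕ.* A ℕ.+ 4)
    N-nonZero = ℕ.≢-nonZero λ N≡0 → contradiction (trans (ℕ.+-comm 4 (A ℕ.* A)) N≡0) λ ()
  decomposition = squarefree-part (A ℕ.* A ℕ.+ 4)
  s = proj₁ decomposition
  e = proj₁ (proj₂ decomposition)
  eq = proj₁ (proj₂ (proj₂ decomposition))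
  e-sf = proj₂ (proj₂ (proj₂ decomposition))

  e≢0 : e ≢ 0
  e≢0 e≡0 = ℕ.≢-nonZero⁻¹ _ (trans eq (trans (cong (s ℕ.* s ℕ.*_) e≡0) (ℕ.*-zeroʳ (s ℕ.* s))))

  2≤A : 2 ≤ A
  2≤A = ℕ.≤-trans (s≤s (s≤s z≤n)) (ℕ.*-mono-≤ (ℕ.*-mono-≤ 3≤n 3≤n) 3≤n)
    where
    3≤n : 3 ≤ base k
    3≤n = ℕ.m≤n+m 3 (6 ℕ.* k)

  -- A² < A² + 4 < (A + 1)²
  e≢1 : e ≢ 1
  e≢1 e≡1 with ℕ.≤-<-connex s A
  ... | inj₁ s≤A = ℕ.<⇒≱ (subst (A ℕ.* A <_) N≡s² (ℕ.m<m+n _ (s≤s z≤n))) (ℕ.*-mono-≤ s≤A s≤A)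
    where
    N≡s² = trans eq (trans (cong (s ℕ.* s ℕ.*_) e≡1) (ℕ.*-identityʳ (s ℕ.* s)))
  ... | inj₂ A<s = ℕ.<⇒≱ (subst (_< suc A ℕ.* suc A) N≡s²
          (subst (A ℕ.* A ℕ.+ 4 <_) (sym (expand A))
            (ℕ.+-monoʳ-< (A ℕ.* A) (s≤s (ℕ.*-monoʳ-≤ 2 2≤A)))))
        (ℕ.*-mono-≤ A<s A<s)
    where
    N≡s² = trans eq (trans (cong (s ℕ.* s ℕ.*_) e≡1) (ℕ.*-identityʳ (s ℕ.* s)))
    expand : ∀ A → suc A ℕ.* suc A ≡ A ℕ.* A ℕ.+ suc (2 ℕ.* A)
    expand = ℕ-Solver.solve-∀

module _ {k : ℕ} (F : RealFamily k) where
  open RealFamily F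

  family-real : Real quadraticField
  family-real = subst (0ℤ ℤ.<_) (sym radicand≡) (ℤ.+<+ part>0)

  -- The unit of norm -1 is (A + root √radicand) / 2.
  family-class : PrincipalGenusHasElementOfOrder 3 quadraticField
  family-class = real-class quadraticField family-real n (+ 1 ℤ.+ + 3 ℤ.* + k) (+ 1 ℤ.+ + 2 ℤ.* + k)
    (half-traceNorm (radicand quadraticField) (n ℤ.* n ℤ.* n) (+ root) -1ℤ eq)
    (trans n≡ (odd (+ k))) (trans n≡ (three (+ k)))
    where
    n = + base k
    n≡ : n ≡ + 6 ℤ.* + k ℤ.+ + 3
    n≡ = cong (ℤ._+ + 3) (ℤ.pos-* 6 k)
    odd : ∀ k → + 6 ℤ.* k ℤ.+ + 3 ≡ + 1 ℤ.+ (+ 1 ℤ.+ + 3 ℤ.* k) ℤ.* + 2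
    odd = solve-∀
    three : ∀ k → + 6 ℤ.* k ℤ.+ + 3 ≡ (+ 1 ℤ.+ + 2 ℤ.* k) ℤ.* + 3
    three = solve-∀
    A≡ : + base³ k ≡ n ℤ.* n ℤ.* n
    A≡ = trans (ℤ.pos-* (base k ℕ.* base k) (base k)) (cong (ℤ._* n) (ℤ.pos-* (base k) (base k)))
    move : ∀ x → x ≡ -[1+ 3 ] ℤ.+ (x ℤ.+ + 4)
    move = solve-∀
    eq : (n ℤ.* n ℤ.* n) ℤ.* (n ℤ.* n ℤ.* n) ≡
      + 4 ℤ.* -1ℤ ℤ.+ + root ℤ.* + root ℤ.* radicand quadraticField
    eq = trans (cong₂ ℤ._*_ (sym A≡) (sym A≡)) (trans (move _) (cong (λ x → -[1+ 3 ] ℤ.+ x)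
      (trans (cong (ℤ._+ + 4) (sym (ℤ.pos-* (base³ k) (base³ k))))
      (trans (cong +_ square)
      (trans (ℤ.pos-* (root ℕ.* root) part)
        (cong₂ ℤ._*_ (ℤ.pos-* root root) (sym radicand≡)))))))

-- If the radicands were both e, the product of A² + 4 = s² e and B² + 4 = t² e
-- would be (s t e)². The bound 4 j ≤ 5 i ensures B ≤ 2 A.
family-distinct : ∀ {i j} (F : RealFamily i) (G : RealFamily j) → i < j → 4 ℕ.* j ≤ 5 ℕ.* i →
  radicand (RealFamily.quadraticField F) ≢ radicand (RealFamily.quadraticField G)
family-distinct {i} {j} F G i<j 4j≤5i eq = product-not-square Z A<B B≤2A
  (trans (cong₂ ℕ._*_ F.square (trans G.square (cong (G.root ℕ.* G.root ℕ.*_) (sym part≡)))) (regroup F.root G.root F.part))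
  where
  module F = RealFamily F
  module G = RealFamily G
  part≡ : F.part ≡ G.part
  part≡ = ℤ.+-injective (trans (sym F.radicand≡) (trans eq G.radicand≡))
  Z = F.root ℕ.* G.root ℕ.* F.part
  regroup : ∀ s t e → (s ℕ.* s ℕ.* e) ℕ.* (t ℕ.* t ℕ.* e) ≡ (s ℕ.* t ℕ.* e) ℕ.* (s ℕ.* t ℕ.* e)
  regroup = ℕ-Solver.solve-∀
  n = base i
  m = base j
  n<m : n < m
  n<m = ℕ.+-monoˡ-< 3 (ℕ.*-monoʳ-< 6 i<j)
  A<B : base³ i < base³ j
  A<B = ℕ.*-mono-< (ℕ.*-mono-< n<m n<m) n<m
  4m≤5n : 4 ℕ.* m ≤ 5 ℕ.* n
  4m≤5n = subst₂ _≤_ (eqˡ j) (eqʳ i) (ℕ.+-mono-≤ (ℕ.*-monoʳ-≤ 6 4j≤5i) (ℕ.m≤m+n 12 3))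
    where
    eqˡ : ∀ j → 6 ℕ.* (4 ℕ.* j) ℕ.+ 12 ≡ 4 ℕ.* (6 ℕ.* j ℕ.+ 3)
    eqˡ = ℕ-Solver.solve-∀
    eqʳ : ∀ i → 6 ℕ.* (5 ℕ.* i) ℕ.+ 15 ≡ 5 ℕ.* (6 ℕ.* i ℕ.+ 3)
    eqʳ = ℕ-Solver.solve-∀
  -- 64 m³ ≤ 125 n³ ≤ 128 n³
  B≤2A : base³ j ≤ base³ i ℕ.+ base³ i
  B≤2A = ℕ.*-cancelˡ-≤ 64 (subst₂ _≤_ (eqˡ m) (eqʳ n)
    (ℕ.≤-trans (ℕ.*-mono-≤ (ℕ.*-mono-≤ 4m≤5n 4m≤5n) 4m≤5n) (ℕ.m≤m+n _ (3 ℕ.* base³ i))))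
    where
    eqˡ : ∀ m → 4 ℕ.* m ℕ.* (4 ℕ.* m) ℕ.* (4 ℕ.* m) ≡ 64 ℕ.* (m ℕ.* m ℕ.* m)
    eqˡ = ℕ-Solver.solve-∀
    eqʳ : ∀ n → 5 ℕ.* n ℕ.* (5 ℕ.* n) ℕ.* (5 ℕ.* n) ℕ.+ 3 ℕ.* (n ℕ.* n ℕ.* n) ≡
      64 ℕ.* (n ℕ.* n ℕ.* n ℕ.+ n ℕ.* n ℕ.* n)
    eqʳ = ℕ-Solver.solve-∀

module _ (fields : ∀ k → RealFamily k) (Ls : List QuadraticField) where
  xs : List ℤ
  xs = map radicand Ls
  l : ℕ
  l = length xs
  -- The range 4 l ≤ k ≤ 5 l has l + 1 elements, and any two of them, i and j,
  -- satisfy 4 j ≤ 5 i.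
  index : Fin (suc l) → ℕ
  index i = 4 ℕ.* l ℕ.+ toℕ i
  radicands : Fin (suc l) → ℤ
  radicands i = radicand (RealFamily.quadraticField (fields (index i)))

  close : ∀ i (j : Fin (suc l)) → 4 ℕ.* index j ≤ 5 ℕ.* index i
  close i j = ℕ.≤-trans (ℕ.*-monoʳ-≤ 4 (ℕ.+-monoʳ-≤ (4 ℕ.* l) (Fin.toℕ≤pred[n] j)))
    (ℕ.≤-trans (ℕ.≤-reflexive (eq l)) (ℕ.*-monoʳ-≤ 5 (ℕ.m≤m+n (4 ℕ.* l) (toℕ i))))
    where
    eq : ∀ l → 4 ℕ.* (4 ℕ.* l ℕ.+ l) ≡ 5 ℕ.* (4 ℕ.* l)
    eq = ℕ-Solver.solve-∀

  found : ∃[ i ] radicands i ∉ˡ xs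
  found = value-outside xs radicands
    (λ {i} {j} i<j → family-distinct (fields (index i)) (fields (index j)) (ℕ.+-monoʳ-< (4 ℕ.* l) i<j) (close i j))
  answer : ∃[ i ] radicands i ∉ˡ xs →
    ∃[ K ] (Real K × PrincipalGenusHasElementOfOrder 3 K) × All (λ L → ¬ (K ≅ L)) Ls
  answer (i , ∉xs) = conclude (fields (index i)) ∉xs
    where
    conclude : ∀ {k} (F : RealFamily k) → radicand (RealFamily.quadraticField F) ∉ˡ xs →
      ∃[ K ] (Real K × PrincipalGenusHasElementOfOrder 3 K) × All (λ L → ¬ (K ≅ L)) Ls
    conclude F ∉xs = RealFamily.quadraticField F , (family-real F , family-class F) ,
      All.tabulate λ {L} L∈Ls K≅L →
        ∉xs (subst (_∈ˡ xs) (sym (isomorphic⇒radicand≡ (RealFamily.quadraticField F) L K≅L)) (∈-map⁺ radicand L∈Ls))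

infinitely-many-real : (∀ k → RealFamily k) →
  InfinitelyMany (λ K → Real K × PrincipalGenusHasElementOfOrder 3 K)
infinitely-many-real fields Ls = answer fields Ls (found fields Ls)

------------------------------------------------------------------------
-- Units of an imaginary quadratic field

square-abs : ∀ i → i ℤ.* i ≡ + (ℤ.∣ i ∣ ℕ.* ℤ.∣ i ∣)
square-abs (+ n)    = sym (ℤ.pos-* n n)
square-abs -[1+ n ] = refl

-- Here d = - e with e ≥ 5, which excludes the fields ℚ(√-1) and ℚ(√-3) with
-- additional units.
module ImaginaryField (d : ℤ) (d-squarefree : Squarefree d)
  (e : ℕ) (d≡-e : d ≡ ℤ.- (+ e)) (5≤e : 5 ≤ e) where
  open Quadratic d
  open ℚ[√_]
  open QuadraticRing (quadraticRing d) using (integral⇒traceNorm; ι-injective)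
  open CubesAndUnits (quadraticRing d) using (NormSquare1)

  private
    δ = fromℤ d

  -- 4 n = t² + e w² with n = ±1 and e ≥ 5 forces w = 0.
  no-irrational-part : ∀ t n w → ℤ.∣ n ∣ ≡ 1 → d ℤ.* (w ℤ.* w) ≡ t ℤ.* t ℤ.- + 4 ℤ.* n → w ≡ 0ℤ
  no-irrational-part t n w ∣n∣≡1 eq = ℤ.∣i∣≡0⇒i≡0 (w²≡0 ℤ.∣ w ∣ bound)
    where
    sum≡4 : ℤ.∣ t ∣ ℕ.* ℤ.∣ t ∣ ℕ.+ e ℕ.* (ℤ.∣ w ∣ ℕ.* ℤ.∣ w ∣) ≡ 4
    sum≡4 = trans (cong ℤ.∣_∣ (trans
        (cong₂ ℤ._+_ (sym (square-abs t)) (trans (ℤ.pos-* e _) (cong (+ e ℤ.*_) (sym (square-abs w)))))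
        (trans (rearrange (+ e) t w) (trans (cong (λ x → t ℤ.* t ℤ.- x) (trans (cong (ℤ._* (w ℤ.* w)) (sym d≡-e)) eq)) (cancel t n)))))
      (trans (ℤ.abs-* (+ 4) n) (cong (4 ℕ.*_) ∣n∣≡1))
      where
      rearrange : ∀ e t w → t ℤ.* t ℤ.+ e ℤ.* (w ℤ.* w) ≡ t ℤ.* t ℤ.- (ℤ.- e) ℤ.* (w ℤ.* w)
      rearrange = solve-∀
      cancel : ∀ t n → t ℤ.* t ℤ.- (t ℤ.* t ℤ.- + 4 ℤ.* n) ≡ + 4 ℤ.* n
      cancel = solve-∀
    bound : e ℕ.* (ℤ.∣ w ∣ ℕ.* ℤ.∣ w ∣) < 5
    bound = s≤s (subst (e ℕ.* (ℤ.∣ w ∣ ℕ.* ℤ.∣ w ∣) ≤_) sum≡4 (ℕ.m≤n+m _ _))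
    w²≡0 : ∀ w → e ℕ.* (w ℕ.* w) < 5 → w ≡ 0
    w²≡0 zero    _ = refl
    w²≡0 (suc w) p = contradiction (ℕ.≤-<-trans (ℕ.≤-trans 5≤e (ℕ.m≤m*n e (suc w ℕ.* suc w))) p) (ℕ.<-irrefl refl)

  -- The units are rational, since 2 η = t + w √d with an integer w.
  unit-rational : ∀ {η} → IsIntegral η → NormSquare1 η → conjugate η ≡ η
  unit-rational {η@(⟨ x , y ⟩)} η-int η-unit = cong ⟨ x ,_⟩ (trans (cong ⊖_ y≡0) (sym y≡0))
    where
    t = proj₁ (integral⇒traceNorm η-int)
    n = proj₁ (proj₂ (integral⇒traceNorm η-int))
    tn = proj₂ (proj₂ (integral⇒traceNorm η-int))
    n²≡1 : n ℤ.* n ≡ 1ℤ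
    n²≡1 = ι-injective (trans (ι-* n n) (trans (sym (cong₂ _*_ (norm≡ tn) (norm≡ tn))) η-unit))
    ∣n∣≡1 : ℤ.∣ n ∣ ≡ 1
    ∣n∣≡1 = ℕ.m*n≡1⇒m≡1 ℤ.∣ n ∣ ℤ.∣ n ∣ (trans (sym (ℤ.abs-* n n)) (cong ℤ.∣_∣ n²≡1))
    d[2y]²≡ : δ ⊛ ((y ⊕ y) ⊛ (y ⊕ y)) ≡ fromℤ (t ℤ.* t ℤ.- + 4 ℤ.* n)
    d[2y]²≡ = trans
      (solve 3 (λ e x y → e :* ((y :+ y) :* (y :+ y)) :=
        (x :+ x) :* (x :+ x) :+ :- (con (fromℤ (+ 4)) :* (x :* x :+ e :* (y :* :- y)))) refl δ x y)
      (trans (cong₂ (λ u v → u ⊛ u ⊕ ⊖ (fromℤ (+ 4) ⊛ v)) (cong rational (trace≡ tn)) (cong rational (norm≡ tn)))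
      (trans (cong₂ _⊕_ (fromℤ-* t t) (trans (cong ⊖_ (fromℤ-* (+ 4) n)) (fromℤ-- (+ 4 ℤ.* n))))
        (fromℤ-+ (t ℤ.* t) (ℤ.- (+ 4 ℤ.* n)))))
      where open +-*-Solver
    2y-integer : IsInteger (y ⊕ y)
    2y-integer = squarefree⇒integer d d-squarefree (y ⊕ y) (_ , d[2y]²≡)
    w = proj₁ 2y-integer
    w≡0 : w ≡ 0ℤ
    w≡0 = no-irrational-part t n w ∣n∣≡1 (fromℤ-injective (trans
      (trans (sym (fromℤ-* d (w ℤ.* w))) (cong (δ ⊛_) (sym (fromℤ-* w w))))
      (trans (cong (λ v → δ ⊛ (v ⊛ v)) (sym (proj₂ 2y-integer))) d[2y]²≡)))
    y≡0 : y ≡ 0ℚ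
    y≡0 = trans (solve 1 (λ y → y := con ½ :* (y :+ y)) refl y)
      (cong (½ ⊛_) (trans (proj₂ 2y-integer) (cong fromℤ w≡0)))
      where open +-*-Solver

module _ (K : QuadraticField) where
  open QuadraticField K using () renaming (radicand to d; squarefree to d-sf)
  open CubesAndUnits (quadraticRing d)

  -- The case m = t² of order-3-class. The trace 2 t³ - p is prime to t as
  -- (1 + k) p - k t = 1. The square of this identity gives the coefficients u and v,
  -- after replacing one factor p by 2 t m - τ, where τ = 2 t³ - p is the trace.
  imaginary-class : ∀ {α} e k → d ≡ ℤ.- (+ e) → 5 ≤ e →
    (let p = + 1 ℤ.+ k ℤ.* + 2 ; t = p ℤ.+ + 2 ; m = t ℤ.* t) →
    QuadraticRing.HasTraceNorm (quadraticRing d) α (+ 2 ℤ.* (t ℤ.* t ℤ.* t) ℤ.- p) (m ℤ.* (m ℤ.* m)) →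
    PrincipalGenusHasElementOfOrder 3 K
  imaginary-class {α} e k d≡ 5≤e tn = order-3-class K m u v m≢0 tn (bezout k)
    λ {β} {η} β-int η-int η′-int ηη′≡1 α≡ → odd-trace⇒¬cube T M tn (M-odd k) (T-odd k)
      (subst IsCube (sym α≡) (let η-unit = unit⇒normSquare1 η-int η′-int ηη′≡1 in
        unit-cube η-int η-unit (unit-rational η-int η-unit) β-int))
    where
    open ImaginaryField d d-sf e d≡ 5≤e using (unit-rational)
    p = + 1 ℤ.+ k ℤ.* + 2
    t = p ℤ.+ + 2
    m = t ℤ.* t
    Q = (+ 1 ℤ.+ k) ℤ.* (+ 1 ℤ.+ k) ℤ.* p ℤ.- + 2 ℤ.* k ℤ.* (+ 1 ℤ.+ k) ℤ.* t
    u = + 2 ℤ.* t ℤ.* Q ℤ.+ k ℤ.* k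
    v = ℤ.- Q
    T = t ℤ.* t ℤ.* t ℤ.- + 1 ℤ.- k
    g = k ℤ.+ + 1
    h = + 2 ℤ.* g ℤ.+ + 2 ℤ.* (g ℤ.* g)
    M = + 3 ℤ.* h ℤ.+ + 6 ℤ.* (h ℤ.* h) ℤ.+ + 4 ℤ.* (h ℤ.* h ℤ.* h)
    bezout : ∀ k → let p = + 1 ℤ.+ k ℤ.* + 2 ; t = p ℤ.+ + 2 ; m = t ℤ.* t
                       Q = (+ 1 ℤ.+ k) ℤ.* (+ 1 ℤ.+ k) ℤ.* p ℤ.- + 2 ℤ.* k ℤ.* (+ 1 ℤ.+ k) ℤ.* t in
      (+ 2 ℤ.* t ℤ.* Q ℤ.+ k ℤ.* k) ℤ.* m ℤ.+ (ℤ.- Q) ℤ.* (+ 2 ℤ.* (t ℤ.* t ℤ.* t) ℤ.- p) ≡ + 1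
    bezout = solve-∀
    M-odd : ∀ k → let t = (+ 1 ℤ.+ k ℤ.* + 2) ℤ.+ + 2 ; m = t ℤ.* t ; g = k ℤ.+ + 1
                      h = + 2 ℤ.* g ℤ.+ + 2 ℤ.* (g ℤ.* g) in
      m ℤ.* (m ℤ.* m) ≡ + 1 ℤ.+ (+ 3 ℤ.* h ℤ.+ + 6 ℤ.* (h ℤ.* h) ℤ.+ + 4 ℤ.* (h ℤ.* h ℤ.* h)) ℤ.* + 2
    M-odd = solve-∀
    T-odd : ∀ k → let p = + 1 ℤ.+ k ℤ.* + 2 ; t = p ℤ.+ + 2 in
      + 2 ℤ.* (t ℤ.* t ℤ.* t) ℤ.- p ≡ + 1 ℤ.+ (t ℤ.* t ℤ.* t ℤ.- + 1 ℤ.- k) ℤ.* + 2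
    T-odd = solve-∀
    m≢0 : m ≢ 0ℤ
    m≢0 m≡0 = from-no (2 ∣? 1) (congruent⇒∣ 2 (ℤ.- h) 1ℤ (sym m≡0) (eq k))
      where
      eq : ∀ k → let t = (+ 1 ℤ.+ k ℤ.* + 2) ℤ.+ + 2 ; g = k ℤ.+ + 1 in
        (ℤ.- (+ 2 ℤ.* g ℤ.+ + 2 ℤ.* (g ℤ.* g))) ℤ.* + 2 ≡ 1ℤ ℤ.+ (+ 0 ℤ.- t ℤ.* t)
      eq = solve-∀

------------------------------------------------------------------------
-- Infinitely many imaginary fields

-- 4 (p + 2)³ - p, which is 32 modulo p.
cofactor : ℕ → ℕ
cofactor p = p ℕ.* (p ℕ.* (p ℕ.* 4 ℕ.+ 24) ℕ.+ 47) ℕ.+ 32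

-- The field ℚ(√(p (p - 4 t³))) with t = p + 2. Its radicand is minus the squarefree
-- part of p (4 t³ - p), and p divides the radicand.
record ImaginaryFamily (p : ℕ) : Set where
  field
    quadraticField : QuadraticField
    root part      : ℕ
    radicand≡      : radicand quadraticField ≡ ℤ.- (+ part)
    p∣part         : p ∣ part
    part≢0         : part ≢ 0
    square         : p ℕ.* cofactor p ≡ root ℕ.* root ℕ.* part

prime-∣-2^ : ∀ {p} → Prime p → ∀ n → p ∣ 2 ℕ.^ n → p ≤ 2
prime-∣-2^ p-prime zero    p∣1 = contradiction (subst Prime (∣1⇒≡1 p∣1) p-prime) ¬prime[1]
prime-∣-2^ p-prime (suc n) p∣2^ with euclidsLemma 2 (2 ℕ.^ n) p-prime p∣2^
... | inj₁ p∣2  = ∣⇒≤ p∣2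
... | inj₂ p∣2ⁿ = prime-∣-2^ p-prime n p∣2ⁿ

-- A prime dividing s² e = p M but not M divides e.
prime-∣-squarefree-part : ∀ {p} → Prime p → ∀ M s e → p ℕ.* M ≡ s ℕ.* s ℕ.* e → ¬ (p ∣ M) → p ∣ e
prime-∣-squarefree-part {p} p-prime M s e eq p∤M
  with euclidsLemma (s ℕ.* s) e p-prime (subst (p ∣_) eq (m∣m*n M))
... | inj₂ p∣e  = p∣e
... | inj₁ p∣s² = contradiction (*-cancelˡ-∣ p {{prime⇒nonZero p-prime}}
    (subst (p ℕ.* p ∣_) (sym eq) (∣m⇒∣m*n e (*-pres-∣ p∣s p∣s)))) p∤M
  where
  p∣s : p ∣ s
  p∣s with euclidsLemma s s p-prime p∣s²
  ... | inj₁ p∣s = p∣s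
  ... | inj₂ p∣s = p∣s

odd-prime : ∀ {p} → Prime p → 2 < p → ∃[ k ] p ≡ 1 ℕ.+ k ℕ.* 2
odd-prime {p} p-prime 2<p with p ℕ.% 2 | p ℕ./ 2 | ℕ.m≡m%n+[m/n]*n p 2 | ℕ.m%n<n p 2
... | 1 | k | eq | _ = k , eq
... | suc (suc _) | _ | _ | s≤s (s≤s ())
... | 0 | k | eq | _ with prime⇒irreducible p-prime (divides k eq)
...   | inj₁ ()
...   | inj₂ refl = contradiction 2<p (ℕ.<-irrefl refl)

imaginary-field : ∀ {p} → Prime p → 2 < p → ImaginaryFamily p
imaginary-field {p} p-prime 2<p = record
  { quadraticField = record
    { radicand   = ℤ.- (+ e)
    ; squarefree = λ m m²∣ → e-sf m (subst (m ℕ.* m ∣_) (ℤ.∣-i∣≡∣i∣ (+ e)) m²∣)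
    ; radicand≢1 = negative≢1 e
    }
  ; root = s ; part = e ; radicand≡ = refl
  ; p∣part = prime-∣-squarefree-part p-prime (cofactor p) s e eq p∤M
  ; part≢0 = λ e≡0 → ℕ.≢-nonZero⁻¹ N (trans eq (trans (cong (s ℕ.* s ℕ.*_) e≡0) (ℕ.*-zeroʳ (s ℕ.* s))))
  ; square = eq }
  where
  N = p ℕ.* cofactor p
  instance
    N-nonZero : ℕ.NonZero N
    N-nonZero = ℕ.m*n≢0 p (cofactor p) {{prime⇒nonZero p-prime}}
      {{ℕ.>-nonZero (ℕ.≤-trans (s≤s z≤n) (ℕ.m≤n+m 32 _))}}
  decomposition = squarefree-part N
  s = proj₁ decomposition
  e = proj₁ (proj₂ decomposition)
  eq = proj₁ (proj₂ (proj₂ decomposition))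
  e-sf = proj₂ (proj₂ (proj₂ decomposition))

  negative≢1 : ∀ e → ℤ.- (+ e) ≢ 1ℤ
  negative≢1 zero    ()
  negative≢1 (suc _) ()

  p∤M : ¬ (p ∣ cofactor p)
  p∤M p∣M = ℕ.<⇒≱ 2<p (prime-∣-2^ p-prime 5
    (∣m+n∣m⇒∣n p∣M (m∣m*n (p ℕ.* (p ℕ.* 4 ℕ.+ 24) ℕ.+ 47))))

module _ {p : ℕ} (F : ImaginaryFamily p) where
  open ImaginaryFamily F

  family-imaginary : Imaginary quadraticField
  family-imaginary = subst (ℤ._< 0ℤ) (sym radicand≡) (negative part part≢0)
    where
    negative : ∀ n → n ≢ 0 → ℤ.- (+ n) ℤ.< 0ℤ
    negative zero    0≢0 = contradiction refl 0≢0
    negative (suc n) _   = ℤ.-<+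

  p≤∣radicand∣ : p ≤ ℤ.∣ radicand quadraticField ∣
  p≤∣radicand∣ = subst (p ≤_) (sym (trans (cong ℤ.∣_∣ radicand≡) (ℤ.∣-i∣≡∣i∣ (+ part))))
    (∣⇒≤ {{ℕ.≢-nonZero part≢0}} p∣part)

  imaginary-family-class : ∀ k → p ≡ 1 ℕ.+ k ℕ.* 2 → 5 ≤ p → PrincipalGenusHasElementOfOrder 3 quadraticField
  imaginary-family-class k p≡ 5≤p = imaginary-class quadraticField part (+ k) radicand≡
    (ℕ.≤-trans 5≤p (∣⇒≤ {{ℕ.≢-nonZero part≢0}} p∣part))
    (half-traceNorm (radicand quadraticField) T (+ root) (m ℤ.* (m ℤ.* m)) discriminant)
    where
    P = + 1 ℤ.+ + k ℤ.* + 2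
    t = P ℤ.+ + 2
    m = t ℤ.* t
    T = + 2 ℤ.* (t ℤ.* t ℤ.* t) ℤ.- P

    P≡ : + p ≡ P
    P≡ = trans (cong +_ p≡) (cong (λ x → + 1 ℤ.+ x) (ℤ.pos-* k 2))

    N≡ : + (p ℕ.* cofactor p) ≡ P ℤ.* (P ℤ.* (P ℤ.* (P ℤ.* + 4 ℤ.+ + 24) ℤ.+ + 47) ℤ.+ + 32)
    N≡ = times (cong (ℤ._+ + 32) (times (cong (ℤ._+ + 47) (times (cong (ℤ._+ + 24) (times refl))))))
      where
      times : ∀ {x y} → + x ≡ y → + (p ℕ.* x) ≡ P ℤ.* y
      times {x} x≡y = trans (ℤ.pos-* p x) (cong₂ ℤ._*_ P≡ x≡y)

    discriminant : T ℤ.* T ≡ + 4 ℤ.* (m ℤ.* (m ℤ.* m)) ℤ.+ + root ℤ.* + root ℤ.* radicand quadraticField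
    discriminant = trans (expand P) (cong (λ x → + 4 ℤ.* (m ℤ.* (m ℤ.* m)) ℤ.+ x)
      (trans (cong ℤ.-_ (trans (sym N≡) (trans (cong +_ square) (trans (ℤ.pos-* (root ℕ.* root) part)
          (cong (ℤ._* + part) (ℤ.pos-* root root))))))
      (trans (ℤ.neg-distribʳ-* (+ root ℤ.* + root) (+ part)) (cong (+ root ℤ.* + root ℤ.*_) (sym radicand≡)))))
      where
      expand : ∀ P → let t = P ℤ.+ + 2 ; m = t ℤ.* t ; T = + 2 ℤ.* (t ℤ.* t ℤ.* t) ℤ.- P in
        T ℤ.* T ≡ + 4 ℤ.* (m ℤ.* (m ℤ.* m)) ℤ.+
          ℤ.- (P ℤ.* (P ℤ.* (P ℤ.* (P ℤ.* + 4 ℤ.+ + 24) ℤ.+ + 47) ℤ.+ + 32))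
      expand = solve-∀

bounded : ∀ (Ls : List QuadraticField) → ∃[ N ] All (λ L → ℤ.∣ radicand L ∣ ≤ N) Ls
bounded []       = 0 , []
bounded (L ∷ Ls) = let (N , ≤N) = bounded Ls in
  ℤ.∣ radicand L ∣ ℕ.+ N , ℕ.m≤m+n _ N ∷ All.map (λ ≤N → ℕ.≤-trans ≤N (ℕ.m≤n+m N _)) ≤N

-- A prime larger than all radicands of the list gives a field outside the list.
infinitely-many-imaginary : (∀ {p} → Prime p → 2 < p → ImaginaryFamily p) →
  InfinitelyMany (λ K → Imaginary K × PrincipalGenusHasElementOfOrder 3 K)
infinitely-many-imaginary fields Ls = conclude (prime-above (4 ℕ.+ N))
  where
  N = proj₁ (bounded Ls)
  conclude : ∃[ p ] Prime p × 4 ℕ.+ N < p →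
    ∃[ K ] (Imaginary K × PrincipalGenusHasElementOfOrder 3 K) × All (λ L → ¬ (K ≅ L)) Ls
  conclude (p , p-prime , N<p) = choose (fields p-prime 2<p) (odd-prime p-prime 2<p)
    where
    5≤p : 5 ≤ p
    5≤p = ℕ.≤-trans (s≤s (ℕ.m≤m+n 4 N)) N<p
    2<p : 2 < p
    2<p = ℕ.≤-trans (s≤s (s≤s (s≤s z≤n))) 5≤p
    choose : ImaginaryFamily p → ∃[ k ] p ≡ 1 ℕ.+ k ℕ.* 2 →
      ∃[ K ] (Imaginary K × PrincipalGenusHasElementOfOrder 3 K) × All (λ L → ¬ (K ≅ L)) Ls
    choose F (k , p≡) = ImaginaryFamily.quadraticField F ,
      (family-imaginary F , imaginary-family-class F k p≡ 5≤p) ,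
      All.map (λ {L} ≤N K≅L → ℕ.<⇒≱ (ℕ.≤-<-trans ≤N (ℕ.≤-trans (s≤s (ℕ.m≤n+m N 4)) N<p))
          (subst (p ≤_) (cong ℤ.∣_∣ (isomorphic⇒radicand≡ (ImaginaryFamily.quadraticField F) L K≅L)) (p≤∣radicand∣ F)))
        (proj₂ (bounded Ls))

theorem89 : InfinitelyMany (λ K → Real K × PrincipalGenusHasElementOfOrder 3 K) ×
    InfinitelyMany (λ K → Imaginary K × PrincipalGenusHasElementOfOrder 3 K)
theorem89 = infinitely-many-real real-field , infinitely-many-imaginary imaginary-field
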